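{- Let $p \equiv 3 \pmod{8}$ be prime. (1) If $K = \mathbb{Q}(\sqrt{p})$, then there is no elliptic curve $E/K$ with everywhere good reduction over $K$ and $j(E) \in \mathbb{Q}$. (2) If $K = \mathbb{Q}(\sqrt{ -p})$, then there is no elliptic curve $E/K$ with everywhere good reduction over $K$ and $j(E) \in \mathbb{Q}$.
   Context: An elliptic curve $E$ over a number field $K$ has everywhere good reduction if it has good reduction at every prime ideal of the ring of integers $\mathcal{O}_K$; $j(E)$ denotes its $j$-invariant. -}

module Defs where

open import Level using (Level; suc; zero)
open import Data.Nat as ℕ using (ℕ)
open import Data.Integer as ℤ using (ℤ)
open import Data.Rational as ℚ using (ℚ; 0ℚ; 1ℚ)
open import Data.Product using (Σ; ∃; _×_; _,_; proj₁; proj₂)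
open import Data.Sum using (_⊎_)
open import Relation.Binary.PropositionalEquality using (_≡_; _≢_)
open import Relation.Nullary using (¬_)

-- The quadratic field K = ℚ(√d), d : ℤ a non-square.
-- An element (a , b) represents a + b √d.

Quad : Set
Quad = ℚ × ℚ

module QuadField (d : ℤ) where

  dℚ : ℚ
  dℚ = d ℚ./ 1

  emb : ℚ → Quad
  emb q = q , 0ℚ

  fromInt : ℤ → Quad
  fromInt z = emb (z ℚ./ 1)

  0K 1K : Quad
  0K = emb 0ℚ
  1K = emb 1ℚ

  infixl 6 _+K_ _-K_
  infixl 7 _*K_

  _+K_ : Quad → Quad → Quad
  (a , b) +K (c , e) = (a ℚ.+ c) , (b ℚ.+ e)

  -K_ : Quad → Quad
  -K (a , b) = ℚ.- a , ℚ.- b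

  _-K_ : Quad → Quad → Quad
  x -K y = x +K (-K y)

  _*K_ : Quad → Quad → Quad
  (a , b) *K (c , e) = (a ℚ.* c ℚ.+ dℚ ℚ.* b ℚ.* e) , (a ℚ.* e ℚ.+ b ℚ.* c)

  n· : ℤ → Quad → Quad
  n· z x = fromInt z *K x

  -- Ring of integers O_K: x is an algebraic integer iff its minimal
  -- polynomial X² - Tr(x) X + N(x) (or X - x for x ∈ ℚ) has integer
  -- coefficients, i.e. iff Tr(x) = 2a and N(x) = a² - d b² lie in ℤ.

  IsIntℚ : ℚ → Set
  IsIntℚ q = ∃ λ (z : ℤ) → q ≡ z ℚ./ 1

  trace norm : Quad → ℚ
  trace (a , b) = a ℚ.+ a
  norm  (a , b) = a ℚ.* a ℚ.- dℚ ℚ.* b ℚ.* b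

  Integral : Quad → Set
  Integral x = IsIntℚ (trace x) × IsIntℚ (norm x)

  record IsNonzeroPrimeIdeal (P : Quad → Set) : Set where
    field
      ⊆O      : ∀ x → P x → Integral x
      zero∈   : P 0K
      +-closed : ∀ x y → P x → P y → P (x +K y)
      absorb  : ∀ r x → Integral r → P x → P (r *K x)
      proper  : ¬ P 1K
      prime   : ∀ x y → Integral x → Integral y → P (x *K y) → P x ⊎ P y
      nonzero : ∃ λ x → P x × x ≢ 0K

  Local : (Quad → Set) → Quad → Set
  Local P x = ∃ λ s → Integral s × ¬ P s × Integral (s *K x)

  LocalUnit : (Quad → Set) → Quad → Set
  LocalUnit P x = Local P x × ∃ λ y → Local P y × (x *K y ≡ 1K)

  -- Weierstrass equations  y² + a1 xy + a3 y = x³ + a2 x² + a4 x + a6.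

  record Weierstrass : Set where
    constructor mkW
    field
      a1 a2 a3 a4 a6 : Quad

  module _ (W : Weierstrass) where
    open Weierstrass W
    b2 b4 b6 b8 c4 disc : Quad
    b2 = a1 *K a1 +K n· (ℤ.+ 4) a2
    b4 = n· (ℤ.+ 2) a4 +K a1 *K a3
    b6 = a3 *K a3 +K n· (ℤ.+ 4) a6
    b8 = a1 *K a1 *K a6 +K n· (ℤ.+ 4) (a2 *K a6) -K a1 *K a3 *K a4
           +K a2 *K a3 *K a3 -K a4 *K a4
    c4 = b2 *K b2 -K n· (ℤ.+ 24) b4
    disc = -K (b2 *K b2 *K b8) -K n· (ℤ.+ 8) (b4 *K b4 *K b4)
             -K n· (ℤ.+ 27) (b6 *K b6) +K n· (ℤ.+ 9) (b2 *K b4 *K b6)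

  record EllipticCurve : Set where
    constructor mkE
    field
      eqn  : Weierstrass
      Δ≢0  : disc eqn ≢ 0K

  -- W' is obtained from W by the change of variables
  --   x = u² x' + r ,  y = u³ y' + s u² x' + t   (u ≠ 0)
  -- (Silverman, AEC, Table 3.1).
  IsChange : Weierstrass → Weierstrass → Quad → Quad → Quad → Quad → Set
  IsChange (mkW a1 a2 a3 a4 a6) (mkW a1' a2' a3' a4' a6') u r s t =
      (u ≢ 0K)
    × (u *K a1' ≡ a1 +K n· (ℤ.+ 2) s)
    × (u *K u *K a2' ≡ a2 -K s *K a1 +K n· (ℤ.+ 3) r -K s *K s)
    × (u *K u *K u *K a3' ≡ a3 +K r *K a1 +K n· (ℤ.+ 2) t)
    × (u *K u *K u *K u *K a4' ≡
         a4 -K s *K a3 +K n· (ℤ.+ 2) (r *K a2) -K (t +K r *K s) *K a1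
           +K n· (ℤ.+ 3) (r *K r) -K n· (ℤ.+ 2) (s *K t))
    × (u *K u *K u *K u *K u *K u *K a6' ≡
         a6 +K r *K a4 +K r *K r *K a2 +K r *K r *K r -K t *K a3
           -K t *K t -K r *K t *K a1)

  GoodReductionAt : EllipticCurve → (Quad → Set) → Set
  GoodReductionAt E P =
    ∃ λ (W' : Weierstrass) → ∃ λ u → ∃ λ r → ∃ λ s → ∃ λ t →
      IsChange (EllipticCurve.eqn E) W' u r s t
      × Local P (Weierstrass.a1 W') × Local P (Weierstrass.a2 W')
      × Local P (Weierstrass.a3 W') × Local P (Weierstrass.a4 W')
      × Local P (Weierstrass.a6 W')
      × LocalUnit P (disc W')

  EverywhereGoodReduction : EllipticCurve → Set₁
  EverywhereGoodReduction E =
    (P : Quad → Set) → IsNonzeroPrimeIdeal P → GoodReductionAt E P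

  -- j(E) = c4³ / Δ lies in ℚ  (Δ ≠ 0).
  jRational : EllipticCurve → Set
  jRational E = ∃ λ (q : ℚ) →
    c4 W *K c4 W *K c4 W ≡ emb q *K disc W
    where W = EllipticCurve.eqn E

{-# OPTIONS --safe #-}

{-
Suppose E has everywhere good reduction and j = j(E) is rational.  At each prime P, E has a model
with coefficients in the maximal order whose discriminant D is prime to P and differs from Δ(E) by a
twelfth power.  Hence N(Δ(E)) is a twelfth power up to sign, and the sign is + because no −t² with
t ≠ 0 is a norm (a descent modulo 4 in the real case, positivity in the imaginary one).  By
Hilbert 90 an element whose norm is a square is a rational multiple of a square; this takes the
place of the oddness of the class number.  From c₆² = (j − 1728) Δ, j − 1728 has even valuation at
every prime other than 2 and p.

Now consider a model that is good at 2.
* If a₁ is a 2-adic unit, so is j, and taking norms in c₄³ = j Δ shows that j = (a/b)³ with a and b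
  odd and coprime.  Then a² + 12ab + 144b² ≡ 5 mod 8, while away from the primes 3 and p, which are
  ≡ 3 mod 8, all its valuations are even: it would have to be ≡ 1 or 3 mod 8.
* If a₁ is neither a unit nor divisible by 2 (so 2 ramifies and d = p), then c₄/4 ≡ 1 + 2√p mod 4,
  which is not a rational multiple of a square, whereas c₄³ = j Δ says that it is.
* If 2 divides a₁, then (j − 1728)/64 ≡ 5 mod 8, so j − 1728 = −p m².  Then √±p · c₆ has norm ± a
  square, hence is a rational multiple of a square.  This contradicts c₆/8 ≡ a₃² mod 4.
-}

module Submission where

open import Defs
open import Algebra.Bundles using (CommutativeRing)
open import Algebra.Structures using (IsCommutativeRing)
open import Data.Empty using (⊥; ⊥-elim)
open import Data.Integer as ℤ using (ℤ; +_; -[1+_]; ∣_∣)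
open import Data.Integer.Tactic.RingSolver using (solve-∀)
open import Data.Maybe using (Maybe; just; nothing)
open import Data.Nat as ℕ using (ℕ; zero; suc; _%_)
open import Data.Nat.Induction using (<-rec)
open import Data.Nat.Primality using (Prime; prime?; prime[2]; euclidsLemma; prime⇒nonZero; prime⇒nonTrivial; prime⇒irreducible)
open import Data.Nat.Tactic.RingSolver using () renaming (solve-∀ to ℕ-solve-∀)
open import Data.Product using (∃; ∃₂; _×_; _,_; proj₁; proj₂)
open import Data.Sum using (_⊎_; inj₁; inj₂; [_,_]′)
open import Function using (_∘_)
open import Relation.Binary.PropositionalEquality
open import Relation.Nullary using (¬_; Dec; yes; no)
open import Relation.Nullary.Decidable using (False; _×-dec_; toWitness; toWitnessFalse)
import Algebra.Solver.Ring as RingSolver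
import Algebra.Solver.Ring.AlmostCommutativeRing as ACR
import Data.Integer.DivMod as ℤDM
import Data.Integer.Divisibility.Signed as ℤD
import Data.Integer.Properties as ℤP
import Data.Nat.Coprimality as Coprimality
import Data.Nat.Divisibility as ℕD
import Data.Nat.Properties as ℕP

-- The obstacle is the class group: that the ideal of Δ(E) is a twelfth power says nothing direct
-- about a generator. Passing to norms loses the ideals but keeps enough, because j is rational and
-- rational factors are harmless throughout. The case distinction concerns a single model, the one
-- at 2; the models at all other primes supply only divisibilities of exponents. The congruence p ≡
-- 3 mod 8 acts in several places. Modulo 4 it excludes nontrivial solutions of m² + t² = p n². It
-- makes 2 ramify in ℚ(√p) and stay inert in ℚ(√-p), so the prime above 2 is stable under
-- conjugation and elements outside it have odd norm. The classes 1 and 3 form a subgroup of the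
-- units modulo 8 that contains 3, p and the odd squares but not 5, and among ± m², ± p m² with m
-- odd only -p m² is ≡ 5. Valuations count powers of the rational prime below, not of a uniformiser;
-- hence neither factorisation of ideals nor completions enter.

cong₃ : {A B C D : Set} (f : A → B → C → D) {a a′ : A} {b b′ : B} {c c′ : C} →
  a ≡ a′ → b ≡ b′ → c ≡ c′ → f a b c ≡ f a′ b′ c′
cong₃ f refl refl refl = refl

cong₄ : {A B C D E : Set} (f : A → B → C → D → E) {a a′ : A} {b b′ : B} {c c′ : C} {d d′ : D} →
  a ≡ a′ → b ≡ b′ → c ≡ c′ → d ≡ d′ → f a b c d ≡ f a′ b′ c′ d′
cong₄ f refl refl refl refl = refl

-- Weierstrass invariants and changes of variables

module WeierstrassPolynomials
  {A : Set} (_+_ _*_ : A → A → A) (-_ : A → A) (ι : ℤ → A) where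

  infixl 6 _⊕_ _⊖_
  infixl 7 _⊗_
  _⊕_ _⊗_ _⊖_ : A → A → A
  x ⊕ y = x + y
  x ⊗ y = x * y
  x ⊖ y = x + (- y)

  b2 : A → A → A
  b2 a1 a2 = a1 ⊗ a1 ⊕ ι (+ 4) ⊗ a2

  b4 : A → A → A → A
  b4 a1 a3 a4 = ι (+ 2) ⊗ a4 ⊕ a1 ⊗ a3

  b6 : A → A → A
  b6 a3 a6 = a3 ⊗ a3 ⊕ ι (+ 4) ⊗ a6

  b8 : A → A → A → A → A → A
  b8 a1 a2 a3 a4 a6 = a1 ⊗ a1 ⊗ a6 ⊕ ι (+ 4) ⊗ (a2 ⊗ a6) ⊖ a1 ⊗ a3 ⊗ a4 ⊕ a2 ⊗ a3 ⊗ a3 ⊖ a4 ⊗ a4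

  c4ᵇ : A → A → A
  c4ᵇ b2 b4 = b2 ⊗ b2 ⊖ ι (+ 24) ⊗ b4

  c6ᵇ : A → A → A → A
  c6ᵇ b2 b4 b6 = - (b2 ⊗ b2 ⊗ b2) ⊕ ι (+ 36) ⊗ (b2 ⊗ b4) ⊖ ι (+ 216) ⊗ b6

  Δᵇ : A → A → A → A → A
  Δᵇ b2 b4 b6 b8 = (- (b2 ⊗ b2 ⊗ b8)) ⊖ ι (+ 8) ⊗ (b4 ⊗ b4 ⊗ b4) ⊖ ι (+ 27) ⊗ (b6 ⊗ b6) ⊕ ι (+ 9) ⊗ (b2 ⊗ b4 ⊗ b6)

  c4 c6 Δ : A → A → A → A → A → A
  c4 a1 a2 a3 a4 a6 = c4ᵇ (b2 a1 a2) (b4 a1 a3 a4)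
  c6 a1 a2 a3 a4 a6 = c6ᵇ (b2 a1 a2) (b4 a1 a3 a4) (b6 a3 a6)
  Δ a1 a2 a3 a4 a6 = Δᵇ (b2 a1 a2) (b4 a1 a3 a4) (b6 a3 a6) (b8 a1 a2 a3 a4 a6)

-- The map `ι` is a field and not derived from `𝟙`, so each instance chooses a form of the integers
-- that computes (`z ∔ + 0 ω`, `z / 1`, `z` itself) and the solver can work with integer
-- coefficients. One set of identities then serves ℤ, the orders, ℚ and the quadratic fields.
record ℤAlgebra : Set₁ where
  infixl 6 _⊕_ _⊖_
  infixl 7 _⊗_
  infix 8 ⊝_
  field
    Carrier : Set
    _⊕_ _⊗_ : Carrier → Carrier → Carrier
    ⊝_      : Carrier → Carrier
    𝟘 𝟙     : Carrier
    isCommutativeRing : IsCommutativeRing _≡_ _⊕_ _⊗_ ⊝_ 𝟘 𝟙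
    ι       : ℤ → Carrier
    ι-+     : ∀ m n → ι (m ℤ.+ n) ≡ ι m ⊕ ι n
    ι-*     : ∀ m n → ι (m ℤ.* n) ≡ ι m ⊗ ι n
    ι-neg   : ∀ m → ι (ℤ.- m) ≡ ⊝ ι m
    ι-0     : ι (+ 0) ≡ 𝟘
    ι-1     : ι (+ 1) ≡ 𝟙

  _⊖_ : Carrier → Carrier → Carrier
  x ⊖ y = x ⊕ (⊝ y)

  commutativeRing : CommutativeRing _ _
  commutativeRing = record { isCommutativeRing = isCommutativeRing }

  open IsCommutativeRing isCommutativeRing public
    using (+-identityˡ; +-identityʳ; *-identityˡ; *-identityʳ; *-comm; *-assoc;
           +-assoc; +-comm; zeroˡ; zeroʳ; -‿inverseʳ; -‿inverseˡ)

module Identities (R : ℤAlgebra) where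
  open ℤAlgebra R
  private
    almost = ACR.fromCommutativeRing commutativeRing
    morphism : CommutativeRing.rawRing ℤP.+-*-commutativeRing ACR.-Raw-AlmostCommutative⟶ almost
    morphism = record { ⟦_⟧ = ι ; +-homo = ι-+ ; *-homo = ι-* ; -‿homo = ι-neg
                      ; 0-homo = ι-0 ; 1-homo = ι-1 }
    dec⇒maybe′ : ∀ m n → Maybe (ι m ≡ ι n)
    dec⇒maybe′ m n with m ℤP.≟ n
    ... | yes eq = just (cong ι eq)
    ... | no _   = nothing
  module Solver = RingSolver (CommutativeRing.rawRing ℤP.+-*-commutativeRing) almost morphism
    (λ m n → dec⇒maybe′ m n)

  open Solver using (solve; _:+_; _:*_; :-_; con; _:=_; Polynomial) public
  open WeierstrassPolynomials _⊕_ _⊗_ ⊝_ ι public hiding (_⊕_; _⊗_; _⊖_)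

  infix 10 #_
  #_ : ∀ {n} → ℕ → Polynomial n
  # k = con (+ k)

  -- The same formulas over the syntax of the solver. Evaluating the syntax gives back the formulas
  -- in the ring, so the long invariants are written only once.
  module Poly {n : ℕ} = WeierstrassPolynomials {Polynomial n} _:+_ _:*_ :-_ con

  sq pow4 pow6 pow12 : Carrier → Carrier
  sq x = x ⊗ x
  pow4 x = sq (sq x)
  pow6 x = sq x ⊗ pow4 x
  pow12 x = sq (pow6 x)
  module PolyPow {n : ℕ} where
    sq′ pow4′ pow6′ pow12′ : Polynomial n → Polynomial n
    sq′ x = x :* x
    pow4′ x = sq′ (sq′ x)
    pow6′ x = sq′ x :* pow4′ x
    pow12′ x = sq′ (pow6′ x)
  open PolyPow public

  4b8-identity : ∀ a1 a2 a3 a4 a6 →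
    ι (+ 4) ⊗ b8 a1 a2 a3 a4 a6 ≡ b2 a1 a2 ⊗ b6 a3 a6 ⊖ sq (b4 a1 a3 a4)
  4b8-identity = solve 5 (λ a1 a2 a3 a4 a6 →
    # 4 :* Poly.b8 a1 a2 a3 a4 a6 := Poly.b2 a1 a2 :* Poly.b6 a3 a6 :+ :- sq′ (Poly.b4 a1 a3 a4)) refl

  -- Here `b8` is a free variable. The term with 432 = 1728 / 4 measures the failure of 4 b₈ = b₂ b₆
  -- - b₄², which keeps the identity in four variables; the relation is substituted afterwards.
  c4³-c6²-b : ∀ b2 b4 b6 b8 →
    c4ᵇ b2 b4 ⊗ c4ᵇ b2 b4 ⊗ c4ᵇ b2 b4 ⊖ sq (c6ᵇ b2 b4 b6) ≡
    ι (+ 1728) ⊗ Δᵇ b2 b4 b6 b8 ⊕ ι (+ 432) ⊗ (sq b2 ⊗ (ι (+ 4) ⊗ b8 ⊖ (b2 ⊗ b6 ⊖ sq b4)))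
  c4³-c6²-b = solve 4 (λ b2 b4 b6 b8 →
    Poly.c4ᵇ b2 b4 :* Poly.c4ᵇ b2 b4 :* Poly.c4ᵇ b2 b4 :+ :- sq′ (Poly.c6ᵇ b2 b4 b6) :=
    # 1728 :* Poly.Δᵇ b2 b4 b6 b8 :+ # 432 :* (sq′ b2 :* (# 4 :* b8 :+ :- (b2 :* b6 :+ :- sq′ b4)))) refl

  c4³-c6²≡1728Δ : ∀ a1 a2 a3 a4 a6 →
    c4 a1 a2 a3 a4 a6 ⊗ c4 a1 a2 a3 a4 a6 ⊗ c4 a1 a2 a3 a4 a6 ⊖ sq (c6 a1 a2 a3 a4 a6) ≡ ι (+ 1728) ⊗ Δ a1 a2 a3 a4 a6
  c4³-c6²≡1728Δ a1 a2 a3 a4 a6 = trans (c4³-c6²-b B2 B4 B6 B8) (trans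
    (cong (λ z → ι (+ 1728) ⊗ Δᵇ B2 B4 B6 B8 ⊕ ι (+ 432) ⊗ (sq B2 ⊗ (z ⊖ (B2 ⊗ B6 ⊖ sq B4)))) (4b8-identity a1 a2 a3 a4 a6))
    (solve 4 (λ x k b z → x :+ k :* (b :* (z :+ :- z)) := x) refl
       (ι (+ 1728) ⊗ Δᵇ B2 B4 B6 B8) (ι (+ 432)) (sq B2) (B2 ⊗ B6 ⊖ sq B4)))
    where
    B2 = b2 a1 a2
    B4 = b4 a1 a3 a4
    B6 = b6 a3 a6
    B8 = b8 a1 a2 a3 a4 a6

  module Scaling (s a1 a2 a3 a4 a6 : Carrier) where
    b2-scale : b2 (s ⊗ a1) (s ⊗ s ⊗ a2) ≡ sq s ⊗ b2 a1 a2
    b2-scale = solve 3 (λ s a1 a2 → Poly.b2 (s :* a1) (s :* s :* a2) := sq′ s :* Poly.b2 a1 a2) refl s a1 a2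

    b4-scale : b4 (s ⊗ a1) (s ⊗ s ⊗ s ⊗ a3) (s ⊗ s ⊗ s ⊗ s ⊗ a4) ≡ pow4 s ⊗ b4 a1 a3 a4
    b4-scale = solve 4 (λ s a1 a3 a4 → Poly.b4 (s :* a1) (s :* s :* s :* a3) (s :* s :* s :* s :* a4)
                         := pow4′ s :* Poly.b4 a1 a3 a4) refl s a1 a3 a4

    b6-scale : b6 (s ⊗ s ⊗ s ⊗ a3) (s ⊗ s ⊗ s ⊗ s ⊗ s ⊗ s ⊗ a6) ≡ pow6 s ⊗ b6 a3 a6
    b6-scale = solve 3 (λ s a3 a6 → Poly.b6 (s :* s :* s :* a3) (s :* s :* s :* s :* s :* s :* a6)
                         := pow6′ s :* Poly.b6 a3 a6) refl s a3 a6

    b8-scale : b8 (s ⊗ a1) (s ⊗ s ⊗ a2) (s ⊗ s ⊗ s ⊗ a3) (s ⊗ s ⊗ s ⊗ s ⊗ a4) (s ⊗ s ⊗ s ⊗ s ⊗ s ⊗ s ⊗ a6)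
               ≡ sq (pow4 s) ⊗ b8 a1 a2 a3 a4 a6
    b8-scale = solve 6 (λ s a1 a2 a3 a4 a6 →
      Poly.b8 (s :* a1) (s :* s :* a2) (s :* s :* s :* a3) (s :* s :* s :* s :* a4) (s :* s :* s :* s :* s :* s :* a6)
               := sq′ (pow4′ s) :* Poly.b8 a1 a2 a3 a4 a6) refl s a1 a2 a3 a4 a6

    c4-scale : c4 (s ⊗ a1) (s ⊗ s ⊗ a2) (s ⊗ s ⊗ s ⊗ a3) (s ⊗ s ⊗ s ⊗ s ⊗ a4) (s ⊗ s ⊗ s ⊗ s ⊗ s ⊗ s ⊗ a6)
               ≡ pow4 s ⊗ c4 a1 a2 a3 a4 a6
    c4-scale = trans (cong₂ c4ᵇ b2-scale b4-scale)
      (solve 3 (λ s b2 b4 → Poly.c4ᵇ (sq′ s :* b2) (pow4′ s :* b4) := pow4′ s :* Poly.c4ᵇ b2 b4) refl s (b2 a1 a2) (b4 a1 a3 a4))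

    Δ-scale : Δ (s ⊗ a1) (s ⊗ s ⊗ a2) (s ⊗ s ⊗ s ⊗ a3) (s ⊗ s ⊗ s ⊗ s ⊗ a4) (s ⊗ s ⊗ s ⊗ s ⊗ s ⊗ s ⊗ a6)
               ≡ pow12 s ⊗ Δ a1 a2 a3 a4 a6
    Δ-scale = trans (cong₄ Δᵇ b2-scale b4-scale b6-scale b8-scale)
      (solve 5 (λ s b2 b4 b6 b8 → Poly.Δᵇ (sq′ s :* b2) (pow4′ s :* b4) (pow6′ s :* b6) (sq′ (pow4′ s) :* b8)
                   := pow12′ s :* Poly.Δᵇ b2 b4 b6 b8)
        refl s (b2 a1 a2) (b4 a1 a3 a4) (b6 a3 a6) (b8 a1 a2 a3 a4 a6))

  module Translation (r s t a1 a2 a3 a4 a6 : Carrier) where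
    A1 = a1 ⊕ ι (+ 2) ⊗ s
    A2 = a2 ⊖ s ⊗ a1 ⊕ ι (+ 3) ⊗ r ⊖ s ⊗ s
    A3 = a3 ⊕ r ⊗ a1 ⊕ ι (+ 2) ⊗ t
    A4 = a4 ⊖ s ⊗ a3 ⊕ ι (+ 2) ⊗ (r ⊗ a2) ⊖ (t ⊕ r ⊗ s) ⊗ a1 ⊕ ι (+ 3) ⊗ (r ⊗ r) ⊖ ι (+ 2) ⊗ (s ⊗ t)
    A6 = a6 ⊕ r ⊗ a4 ⊕ r ⊗ r ⊗ a2 ⊕ r ⊗ r ⊗ r ⊖ t ⊗ a3 ⊖ t ⊗ t ⊖ r ⊗ t ⊗ a1

    b2-translate : b2 A1 A2 ≡ b2 a1 a2 ⊕ ι (+ 12) ⊗ r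
    b2-translate = solve 4 (λ r s a1 a2 →
      Poly.b2 (a1 :+ # 2 :* s) (a2 :+ :- (s :* a1) :+ # 3 :* r :+ :- (s :* s)) := Poly.b2 a1 a2 :+ # 12 :* r)
      refl r s a1 a2

    b4-translate : b4 A1 A3 A4 ≡ b4 a1 a3 a4 ⊕ r ⊗ b2 a1 a2 ⊕ ι (+ 6) ⊗ (r ⊗ r)
    b4-translate = solve 7 (λ r s t a1 a2 a3 a4 →
      Poly.b4 (a1 :+ # 2 :* s) (a3 :+ r :* a1 :+ # 2 :* t)
        (a4 :+ :- (s :* a3) :+ # 2 :* (r :* a2) :+ :- ((t :+ r :* s) :* a1) :+ # 3 :* (r :* r) :+ :- (# 2 :* (s :* t)))
        := Poly.b4 a1 a3 a4 :+ r :* Poly.b2 a1 a2 :+ # 6 :* (r :* r))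
      refl r s t a1 a2 a3 a4

    b6-translate : b6 A3 A6 ≡ b6 a3 a6 ⊕ ι (+ 2) ⊗ (r ⊗ b4 a1 a3 a4) ⊕ r ⊗ r ⊗ b2 a1 a2 ⊕ ι (+ 4) ⊗ (r ⊗ r ⊗ r)
    b6-translate = solve 7 (λ r t a1 a2 a3 a4 a6 →
      Poly.b6 (a3 :+ r :* a1 :+ # 2 :* t)
        (a6 :+ r :* a4 :+ r :* r :* a2 :+ r :* r :* r :+ :- (t :* a3) :+ :- (t :* t) :+ :- (r :* t :* a1))
        := Poly.b6 a3 a6 :+ # 2 :* (r :* Poly.b4 a1 a3 a4) :+ r :* r :* Poly.b2 a1 a2 :+ # 4 :* (r :* r :* r))
      refl r t a1 a2 a3 a4 a6

    c4-translate : c4 A1 A2 A3 A4 A6 ≡ c4 a1 a2 a3 a4 a6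
    c4-translate = trans (cong₂ c4ᵇ b2-translate b4-translate)
      (solve 3 (λ r b2 b4 → Poly.c4ᵇ (b2 :+ # 12 :* r) (b4 :+ r :* b2 :+ # 6 :* (r :* r)) := Poly.c4ᵇ b2 b4)
        refl r (b2 a1 a2) (b4 a1 a3 a4))

    c6-translate : c6 A1 A2 A3 A4 A6 ≡ c6 a1 a2 a3 a4 a6
    c6-translate = trans (cong₃ c6ᵇ b2-translate b4-translate b6-translate)
      (solve 4 (λ r b2 b4 b6 → Poly.c6ᵇ (b2 :+ # 12 :* r) (b4 :+ r :* b2 :+ # 6 :* (r :* r))
                  (b6 :+ # 2 :* (r :* b4) :+ r :* r :* b2 :+ # 4 :* (r :* r :* r)) := Poly.c6ᵇ b2 b4 b6)
        refl r (b2 a1 a2) (b4 a1 a3 a4) (b6 a3 a6))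

    -- Invariance is read off from c₄ and c₆ instead of expanding the discriminant in eight
    -- variables. This yields it only up to the factor 1728, which is cancelled later in the
    -- quadratic field.
    1728Δ-translate : ι (+ 1728) ⊗ Δ A1 A2 A3 A4 A6 ≡ ι (+ 1728) ⊗ Δ a1 a2 a3 a4 a6
    1728Δ-translate = trans (sym (c4³-c6²≡1728Δ A1 A2 A3 A4 A6))
      (trans (cong₂ (λ x y → x ⊗ x ⊗ x ⊖ sq y) c4-translate c6-translate) (c4³-c6²≡1728Δ a1 a2 a3 a4 a6))

    module ChangeOfVariables
      {u a1′ a2′ a3′ a4′ a6′ : Carrier}
      (e1 : u ⊗ a1′ ≡ A1) (e2 : u ⊗ u ⊗ a2′ ≡ A2) (e3 : u ⊗ u ⊗ u ⊗ a3′ ≡ A3)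
      (e4 : u ⊗ u ⊗ u ⊗ u ⊗ a4′ ≡ A4) (e6 : u ⊗ u ⊗ u ⊗ u ⊗ u ⊗ u ⊗ a6′ ≡ A6) where
      open Scaling u a1′ a2′ a3′ a4′ a6′

      transport : (f : Carrier → Carrier → Carrier → Carrier → Carrier → Carrier) →
        f (u ⊗ a1′) (u ⊗ u ⊗ a2′) (u ⊗ u ⊗ u ⊗ a3′) (u ⊗ u ⊗ u ⊗ u ⊗ a4′) (u ⊗ u ⊗ u ⊗ u ⊗ u ⊗ u ⊗ a6′) ≡ f A1 A2 A3 A4 A6
      transport f rewrite e1 | e2 | e3 | e4 | e6 = refl

      c4-change : pow4 u ⊗ c4 a1′ a2′ a3′ a4′ a6′ ≡ c4 a1 a2 a3 a4 a6
      c4-change = trans (sym c4-scale) (trans (transport c4) c4-translate)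

      1728Δ-change : ι (+ 1728) ⊗ (pow12 u ⊗ Δ a1′ a2′ a3′ a4′ a6′) ≡ ι (+ 1728) ⊗ Δ a1 a2 a3 a4 a6
      1728Δ-change = trans (cong (ι (+ 1728) ⊗_) (trans (sym Δ-scale) (transport Δ))) 1728Δ-translate

-- Prime factorisation of natural numbers

module NaturalValuations where
  open import Data.Nat using (NonZero; _^_; _*_; _<_)
  open import Data.Nat.Divisibility using (_∣_; divides; _∣?_)
  open import Data.Nat.Primality.Factorisation using (factorise)
  open import Data.List using ([]; _∷_)
  open import Data.Nat.ListAction using (product)
  open import Data.List.Relation.Unary.All using (_∷_)

  factor-< : ∀ {ℓ} → Prime ℓ → ∀ q → .{{NonZero q}} → q < ℓ * q
  factor-< {ℓ} pr q = subst (q <_) (ℕP.*-comm q ℓ) (ℕP.m<m*n q ℓ (ℕ.nonTrivial⇒n>1 ℓ {{prime⇒nonTrivial pr}}))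

  factor-out : ∀ {ℓ} → Prime ℓ → ∀ n → .{{NonZero n}} → ∃₂ λ k w → n ≡ ℓ ^ k * w × ¬ ℓ ∣ w
  factor-out {ℓ} pr n = go n
    where
    go : ∀ n → .{{NonZero n}} → ∃₂ λ k w → n ≡ ℓ ^ k * w × ¬ ℓ ∣ w
    go n {{nz}} = <-rec (λ n → .(NonZero n) → ∃₂ λ k w → n ≡ ℓ ^ k * w × ¬ ℓ ∣ w) step n nz
      where
      step : ∀ n → (∀ {m} → m < n → .(NonZero m) → ∃₂ λ k w → m ≡ ℓ ^ k * w × ¬ ℓ ∣ w) →
             .(NonZero n) → ∃₂ λ k w → n ≡ ℓ ^ k * w × ¬ ℓ ∣ w
      step n rec nz with ℓ ∣? n
      ... | no ∤ = 0 , n , sym (ℕP.*-identityˡ n) , ∤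
      ... | yes (divides q refl) =
            let nzq = ℕP.m*n≢0⇒m≢0 q {{nz}}
                k , w , eq , ∤ = rec (subst (q <_) (ℕP.*-comm ℓ q) (factor-< pr q {{nzq}})) nzq
            in suc k , w , trans (ℕP.*-comm q ℓ) (trans (cong (ℓ *_) eq) (sym (ℕP.*-assoc ℓ (ℓ ^ k) w))) , ∤

  prime-divisor : ∀ n → .{{NonZero n}} → n ≢ 1 → ∃ λ ℓ → Prime ℓ × ℓ ∣ n
  prime-divisor n n≢1 with factorise n
  ... | record { factors = []     ; isFactorisation = eq } = ⊥-elim (n≢1 eq)
  ... | record { factors = ℓ ∷ ps ; isFactorisation = eq ; factorsPrime = pr ∷ _ } =
        ℓ , pr , divides (product ps) (trans eq (ℕP.*-comm ℓ (product ps)))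

  *-distrib-^ : ∀ a b k → (a * b) ^ k ≡ a ^ k * b ^ k
  *-distrib-^ a b zero = refl
  *-distrib-^ a b (suc k) = trans (cong (a * b *_) (*-distrib-^ a b k)) (ℕP.[m*n]*[o*p]≡[m*o]*[n*p] a b (a ^ k) (b ^ k))

  prime∣power : ∀ {ℓ} → Prime ℓ → ∀ m k → ℓ ∣ m ^ k → ℓ ∣ m
  prime∣power pr m zero d = ⊥-elim (ℕ.nonTrivial⇒≢1 {{prime⇒nonTrivial pr}} (ℕD.∣1⇒≡1 d))
  prime∣power pr m (suc k) d with euclidsLemma m (m ^ k) pr d
  ... | inj₁ d′ = d′
  ... | inj₂ d′ = prime∣power pr m k d′

  prime∣prime : ∀ {ℓ ℓ′} → Prime ℓ → Prime ℓ′ → ℓ ∣ ℓ′ → ℓ ≡ ℓ′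
  prime∣prime pr pr′ d with prime⇒irreducible pr′ d
  ... | inj₁ eq = ⊥-elim (ℕ.nonTrivial⇒≢1 {{prime⇒nonTrivial pr}} eq)
  ... | inj₂ eq = eq

  module _ (Good : ℕ → ℕ → Set) (good₀ : ∀ {ℓ} → Prime ℓ → Good ℓ 0)
           (C : ℕ → Set) (c₁ : C 1) (step : ∀ {ℓ k w} → Prime ℓ → Good ℓ k → C w → C (ℓ ^ k * w)) where

    Valuations : ℕ → Set
    Valuations n = ∀ ℓ k w → Prime ℓ → n ≡ ℓ ^ k * w → ¬ ℓ ∣ w → Good ℓ k

    -- Complete prime powers are split off one prime at a time. Once ℓ has been removed its exponent
    -- in the cofactor is 0, which is where `good₀` is used; the exponents of the other primes are
    -- unchanged. This turns local information into a multiplicative property of n.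
    valuation-induction : ∀ n → .{{NonZero n}} → Valuations n → C n
    valuation-induction n {{nz}} = <-rec (λ n → .(NonZero n) → Valuations n → C n) go n nz
      where
      go : ∀ n → (∀ {m} → m < n → .(NonZero m) → Valuations m → C m) → .(NonZero n) → Valuations n → C n
      go n rec nz vals with n ℕ.≟ 1
      ... | yes refl = c₁
      ... | no n≢1 with prime-divisor n {{nz}} n≢1
      ... | ℓ , pr , ℓ∣n with factor-out pr n {{nz}}
      ... | zero , w , eq , ∤ = ⊥-elim (∤ (subst (ℓ ∣_) (trans eq (ℕP.*-identityˡ w)) ℓ∣n))
      ... | suc k , w , refl , ∤ = step {ℓ} {suc k} pr (vals ℓ (suc k) w pr refl ∤) (rec w< nzw vals-w)
        where
        nzw : NonZero w
        nzw = ℕP.m*n≢0⇒n≢0 (ℓ ^ suc k) {{nz}}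
        w< : w < ℓ ^ suc k * w
        w< = ℕP.≤-trans (factor-< pr w {{nzw}})
               (ℕP.*-monoˡ-≤ w (ℕP.m≤m*n ℓ (ℓ ^ k) {{ℕP.m^n≢0 ℓ k {{prime⇒nonZero pr}}}}))
        vals-w : Valuations w
        vals-w ℓ′ k′ w′ pr′ eq ∤′ with ℓ′ ℕ.≟ ℓ
        vals-w _ zero _ pr′ eq ∤′ | yes refl = good₀ pr′
        vals-w _ (suc k′) w′ pr′ eq ∤′ | yes refl =
          ⊥-elim (∤ (divides (ℓ ^ k′ * w′) (trans eq (trans (ℕP.*-assoc ℓ (ℓ ^ k′) w′) (ℕP.*-comm ℓ _)))))
        vals-w ℓ′ k′ w′ pr′ eq ∤′ | no ℓ′≢ℓ = vals ℓ′ k′ (ℓ ^ suc k * w′) pr′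
          (trans (cong (ℓ ^ suc k *_) eq) (trans (sym (ℕP.*-assoc (ℓ ^ suc k) (ℓ′ ^ k′) w′))
            (trans (cong (_* w′) (ℕP.*-comm (ℓ ^ suc k) (ℓ′ ^ k′))) (ℕP.*-assoc (ℓ′ ^ k′) (ℓ ^ suc k) w′))))
          ∤″
          where
          ∤″ : ¬ ℓ′ ∣ ℓ ^ suc k * w′
          ∤″ d with euclidsLemma (ℓ ^ suc k) w′ pr′ d
          ... | inj₁ d′ = ℓ′≢ℓ (prime∣prime pr′ pr (prime∣power pr′ ℓ (suc k) d′))
          ... | inj₂ d′ = ∤′ d′

-- Divisibility, parity and descent in ℤ

module IntegerLemmas where
  open import Data.Integer using (_+_; _*_; -_; _-_)
  open import Data.Integer.Divisibility.Signed using (_∣_; divides; ∣⇒∣ᵤ; ∣ᵤ⇒∣)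
  open import Data.Nat.Solver
  module ℕSolver = +-*-Solver
  open NaturalValuations using (factor-out)

  square-abs : ∀ x → x * x ≡ + (∣ x ∣ ℕ.* ∣ x ∣)
  square-abs (+ n)    = sym (ℤP.pos-* n n)
  square-abs -[1+ n ] = refl

  *-≢0 : ∀ {x y} → x ≢ + 0 → y ≢ + 0 → x * y ≢ + 0
  *-≢0 {x} x≢ y≢ eq with ℤP.i*j≡0⇒i≡0∨j≡0 x eq
  ... | inj₁ e = x≢ e
  ... | inj₂ e = y≢ e

  *-cancelˡ : ∀ {x} y z → x ≢ + 0 → x * y ≡ x * z → y ≡ z
  *-cancelˡ {x} y z x≢ = ℤP.*-cancelˡ-≡ x y z {{ℤ.≢-nonZero x≢}}

  x-y≡0⇒x≡y : ∀ x y → x - y ≡ + 0 → x ≡ y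
  x-y≡0⇒x≡y = ℤP.i-j≡0⇒i≡j

  x≡y⇒x-y≡0 : ∀ {x y} → x ≡ y → x - y ≡ + 0
  x≡y⇒x-y≡0 {x} refl = ℤP.+-inverseʳ x

  euclid : ∀ {ℓ} → Prime ℓ → ∀ x y → + ℓ ∣ x * y → (+ ℓ ∣ x) ⊎ (+ ℓ ∣ y)
  euclid {ℓ} pr x y d with euclidsLemma ∣ x ∣ ∣ y ∣ pr (subst (ℓ ℕD.∣_) (ℤP.abs-* x y) (∣⇒∣ᵤ d))
  ... | inj₁ e = inj₁ (∣ᵤ⇒∣ e)
  ... | inj₂ e = inj₂ (∣ᵤ⇒∣ e)

  euclid-square : ∀ {ℓ} → Prime ℓ → ∀ x → + ℓ ∣ x * x → + ℓ ∣ x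
  euclid-square pr x d = [ (λ e → e) , (λ e → e) ]′ (euclid pr x x d)

  prime∤1 : ∀ {ℓ} → Prime ℓ → ¬ + ℓ ∣ + 1
  prime∤1 pr d = ℕ.nonTrivial⇒≢1 {{prime⇒nonTrivial pr}} (ℕD.∣1⇒≡1 (∣⇒∣ᵤ d))

  signed-factor : ∀ {ℓ} z k w → ∣ z ∣ ≡ ℓ ℕ.^ k ℕ.* w → ¬ ℓ ℕD.∣ w → ∃ λ w′ → z ≡ + (ℓ ℕ.^ k) * w′ × ¬ + ℓ ∣ w′
  signed-factor {ℓ} z k w eq ∤ with ℤP.+∣i∣≡i⊎+∣i∣≡-i z
  ... | inj₁ e = + w , trans (sym e) (trans (cong +_ eq) (ℤP.pos-* (ℓ ℕ.^ k) w)) , λ d → ∤ (∣⇒∣ᵤ d)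
  ... | inj₂ e = - + w ,
      trans (sym (ℤP.neg-involutive z)) (trans (cong -_ (trans (sym e) (trans (cong +_ eq) (ℤP.pos-* (ℓ ℕ.^ k) w))))
        (ℤP.neg-distribʳ-* (+ (ℓ ℕ.^ k)) (+ w))) ,
      λ d → ∤ (subst (ℓ ℕD.∣_) (ℤP.∣-i∣≡∣i∣ (+ w)) (∣⇒∣ᵤ d))

  factor-outℤ : ∀ {ℓ} → Prime ℓ → ∀ x → x ≢ + 0 → ∃₂ λ k w → x ≡ + (ℓ ℕ.^ k) * w × ¬ + ℓ ∣ w
  factor-outℤ pr x x≢ with factor-out pr ∣ x ∣ {{ℤ.≢-nonZero x≢}}
  ... | k , w , eq , ∤ = k , signed-factor x k w eq ∤

  data Parity : ℤ → Set where
    even : ∀ k → Parity (+ 2 * k)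
    odd  : ∀ k → Parity (+ 1 + + 2 * k)

  parity : ∀ x → Parity x
  parity x with x ℤDM.%ℕ 2 | ℤDM.n%ℕd<d x 2 | ℤDM.a≡a%ℕn+[a/ℕn]*n x 2
  ... | 0 | _ | eq = subst Parity (sym (trans eq (trans (ℤP.+-identityˡ _) (ℤP.*-comm _ (+ 2))))) (even (x ℤDM./ℕ 2))
  ... | 1 | _ | eq = subst Parity (sym (trans eq (cong (λ z → + 1 + z) (ℤP.*-comm (x ℤDM./ℕ 2) (+ 2))))) (odd (x ℤDM./ℕ 2))
  ... | suc (suc _) | ℕ.s≤s (ℕ.s≤s ()) | _

  no-multiple : ∀ {d c} → ¬ d ℕD.∣ c → ∀ {x} → + c + + d * x ≢ + 0
  no-multiple {d} {c} ∤ {x} eq = ∤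
      (∣⇒∣ᵤ {+ d} {+ c} (divides (- x) (trans (lemma (+ c) (+ d) x) (trans (cong (_+ - x * + d) eq)
      (ℤP.+-identityˡ _)))))
    where
    lemma : ∀ c d x → c ≡ (c + d * x) + - x * d
    lemma = solve-∀

  -- A nonzero integer cannot be halved for ever, since its absolute value drops. The other unknowns
  -- of an equation are meant to be hidden inside `Q`, so that a form in several variables is
  -- treated one variable at a time.
  descent : (Q : ℤ → Set) → (∀ x → Q x → ∃ λ y → x ≡ + 2 * y × Q y) → ∀ x → Q x → x ≡ + 0
  descent Q halve x q = <-rec (λ n → ∀ x → ∣ x ∣ ≡ n → Q x → x ≡ + 0) go ∣ x ∣ x refl q
    where
    go : ∀ n → (∀ {m} → m ℕ.< n → ∀ x → ∣ x ∣ ≡ m → Q x → x ≡ + 0) → ∀ x → ∣ x ∣ ≡ n → Q x → x ≡ + 0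
    go _ rec x refl q with x ℤ.≟ + 0
    ... | yes e = e
    ... | no x≢ with halve x q
    ... | y , refl , qy = cong (+ 2 *_) (rec y< y refl qy)
      where
      y≢ : ∣ y ∣ ≢ 0
      y≢ e = x≢ (cong (+ 2 *_) (ℤP.∣i∣≡0⇒i≡0 e))
      y< : ∣ y ∣ ℕ.< ∣ + 2 * y ∣
      y< = subst (∣ y ∣ ℕ.<_) (trans (ℕP.*-comm ∣ y ∣ 2) (sym (ℤP.abs-* (+ 2) y)))
             (ℕP.m<m*n ∣ y ∣ 2 {{ℕ.≢-nonZero y≢}} (ℕ.s≤s (ℕ.s≤s ℕ.z≤n)))

  infix 9 _² _⁴ _⁶ _¹²
  _² _⁴ _⁶ _¹² : ℤ → ℤ
  x ² = x * x
  x ⁴ = (x ²) ²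
  x ⁶ = x ² * x ⁴
  x ¹² = (x ⁶) ²

  ²-≢0 : ∀ {x} → x ≢ + 0 → x ² ≢ + 0
  ²-≢0 x≢ = *-≢0 x≢ x≢

  ⁶-≢0 : ∀ {x} → x ≢ + 0 → x ⁶ ≢ + 0
  ⁶-≢0 x≢ = *-≢0 (²-≢0 x≢) (²-≢0 (²-≢0 x≢))

  pos-¹² : ∀ n → + (n ℕ.^ 12) ≡ (+ n) ¹²
  pos-¹² n = trans (cong +_ (lemma n)) (trans (ℤP.pos-* n⁶ n⁶) (cong _² (trans (ℤP.pos-* (n ℕ.* n) _)
      (cong₂ _*_ (ℤP.pos-* n n) (trans (ℤP.pos-* (n ℕ.* n) _) (cong _² (ℤP.pos-* n n)))))))
    where
    n⁶ = (n ℕ.* n) ℕ.* ((n ℕ.* n) ℕ.* (n ℕ.* n))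
    lemma : ∀ n → n ℕ.^ 12 ≡ ((n ℕ.* n) ℕ.* ((n ℕ.* n) ℕ.* (n ℕ.* n))) ℕ.* ((n ℕ.* n) ℕ.* ((n ℕ.* n) ℕ.* (n ℕ.* n)))
    lemma = ℕSolver.solve 1 (λ n → n :^ 12 := ((n :* n) :* ((n :* n) :* (n :* n))) :* ((n :* n) :* ((n :* n) :* (n :* n)))) refl
      where open ℕSolver

  Odd : ℤ → Set
  Odd x = ∃ λ k → x ≡ + 1 + + 2 * k

  even-or-odd : ∀ x → (∃ λ k → x ≡ + 2 * k) ⊎ Odd x
  even-or-odd x with parity x
  ... | even k = inj₁ (k , refl)
  ... | odd k  = inj₂ (k , refl)

  ¬even-and-odd : ∀ {x k} → x ≡ + 2 * k → ¬ Odd x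
  ¬even-and-odd {x} {k} eq (j , eq′) = no-multiple {2} {1} (λ { (ℕD.divides (suc _) ()) }) {j - k}
    (trans (lemma k j) (x≡y⇒x-y≡0 (trans (sym eq′) eq)))
    where
    lemma : ∀ k j → + 1 + + 2 * (j - k) ≡ (+ 1 + + 2 * j) - + 2 * k
    lemma = solve-∀

  odd-≢0 : ∀ {x} → Odd x → x ≢ + 0
  odd-≢0 o refl = ¬even-and-odd {+ 0} {+ 0} refl o

  odd-* : ∀ {x y} → Odd x → Odd y → Odd (x * y)
  odd-* (i , refl) (j , refl) = i + j + + 2 * (i * j) , lemma i j
    where
    lemma : ∀ i j → (+ 1 + + 2 * i) * (+ 1 + + 2 * j) ≡ + 1 + + 2 * (i + j + + 2 * (i * j))
    lemma = solve-∀

  odd-*⁻ˡ : ∀ x y → Odd (x * y) → Odd x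
  odd-*⁻ˡ x y o = [ (λ { (k , eq) → ⊥-elim (¬even-and-odd (trans (cong (_* y) eq) (ℤP.*-assoc (+ 2) k y)) o) }) ,
      (λ o′ → o′) ]′ (even-or-odd x)

  odd-*⁻ʳ : ∀ x y → Odd (x * y) → Odd y
  odd-*⁻ʳ x y o = odd-*⁻ˡ y x (subst Odd (ℤP.*-comm x y) o)

  odd-² : ∀ {x} → Odd x → ∃ λ k → x ² ≡ + 1 + + 8 * k
  odd-² (i , refl) = [ (λ { (k , refl) → k + + 2 * (k * k) , lemma₁ k }) ,
      (λ { (k , refl) → + 1 + + 3 * k + + 2 * (k * k) , lemma₂ k }) ]′ (even-or-odd i)
    where
    lemma₁ : ∀ k → (+ 1 + + 2 * (+ 2 * k)) * (+ 1 + + 2 * (+ 2 * k)) ≡ + 1 + + 8 * (k + + 2 * (k * k))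
    lemma₁ = solve-∀
    lemma₂ : ∀ k → (+ 1 + + 2 * (+ 1 + + 2 * k)) * (+ 1 + + 2 * (+ 1 + + 2 * k)) ≡ + 1 + + 8 * (+ 1 + + 3 * k + + 2 * (k * k))
    lemma₂ = solve-∀

  square-roots : ∀ x y → x ² ≡ y ² → x ≡ y ⊎ x ≡ - y
  square-roots x y eq = [ (λ e → inj₁ (x-y≡0⇒x≡y x y e)) ,
      (λ e → inj₂ (trans (lemma₂ x y) (trans (cong (_- y) e) (ℤP.+-identityˡ (- y))))) ]′
    (ℤP.i*j≡0⇒i≡0∨j≡0 (x - y) (trans (lemma₁ x y) (x≡y⇒x-y≡0 eq)))
    where
    lemma₁ : ∀ x y → (x - y) * (x + y) ≡ x * x - y * y
    lemma₁ = solve-∀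
    lemma₂ : ∀ x y → x ≡ (x + y) - y
    lemma₂ = solve-∀

  abs-cases : ∀ z {n} → ∣ z ∣ ≡ n → z ≡ + n ⊎ z ≡ - + n
  abs-cases z refl with ℤP.+∣i∣≡i⊎+∣i∣≡-i z
  ... | inj₁ e = inj₁ (sym e)
  ... | inj₂ e = inj₂ (trans (sym (ℤP.neg-involutive z)) (cong -_ (sym e)))

-- Quadratic orders

module QuadraticOrders where

  infix 5 _∔_ω
  -- A data type has no eta rule: a product of variables does not unfold into components, so ring
  -- identities treat elements of the order as atoms.
  data Order : Set where
    _∔_ω : ℤ → ℤ → Order

-- The order ℤ[ω] with ω² = τ ω − ν.
module QuadraticOrder (τ ν : ℤ) where
  open import Data.Integer using (_+_; _*_; -_; _-_)
  open QuadraticOrders public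
  open IntegerLemmas

  ring : ℤAlgebra
  ring = record
    { Carrier = Order ; _⊕_ = add ; _⊗_ = mul ; ⊝_ = neg ; 𝟘 = + 0 ∔ + 0 ω ; 𝟙 = + 1 ∔ + 0 ω
    ; isCommutativeRing = record
      { isRing = record
        { +-isAbelianGroup = record
          { isGroup = record
            { isMonoid = record
              { isSemigroup = record
                { isMagma = record { isEquivalence = isEquivalence ; ∙-cong = cong₂ add }
                ; assoc = λ { (a ∔ b ω) (c ∔ d ω) (e ∔ f ω) → cong₂ _∔_ω (ℤP.+-assoc a c e) (ℤP.+-assoc b d f) } }
              ; identity = (λ { (a ∔ b ω) → cong₂ _∔_ω (ℤP.+-identityˡ a) (ℤP.+-identityˡ b) })
                         , (λ { (a ∔ b ω) → cong₂ _∔_ω (ℤP.+-identityʳ a) (ℤP.+-identityʳ b) }) }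
            ; inverse = (λ { (a ∔ b ω) → cong₂ _∔_ω (ℤP.+-inverseˡ a) (ℤP.+-inverseˡ b) })
                      , (λ { (a ∔ b ω) → cong₂ _∔_ω (ℤP.+-inverseʳ a) (ℤP.+-inverseʳ b) })
            ; ⁻¹-cong = cong neg }
          ; comm = λ { (a ∔ b ω) (c ∔ d ω) → cong₂ _∔_ω (ℤP.+-comm a c) (ℤP.+-comm b d) } }
        ; *-cong = cong₂ mul
        ; *-assoc = λ { (a ∔ b ω) (c ∔ d ω) (e ∔ f ω) → cong₂ _∔_ω (assoc₁ τ ν a b c d e f) (assoc₂ τ ν a b c d e f) }
        ; *-identity = (λ { (a ∔ b ω) → cong₂ _∔_ω (idˡ₁ τ ν a b) (idˡ₂ τ a b) })
                     , (λ { (a ∔ b ω) → cong₂ _∔_ω (idʳ₁ ν a b) (idʳ₂ τ a b) })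
        ; distrib = (λ { (a ∔ b ω) (c ∔ d ω) (e ∔ f ω) → cong₂ _∔_ω (distˡ₁ ν a b c d e f) (distˡ₂ τ a b c d e f) })
                  , (λ { (a ∔ b ω) (c ∔ d ω) (e ∔ f ω) → cong₂ _∔_ω (distʳ₁ ν a b c d e f) (distʳ₂ τ a b c d e f) }) }
      ; *-comm = λ { (a ∔ b ω) (c ∔ d ω) → cong₂ _∔_ω (comm₁ ν a b c d) (comm₂ τ a b c d) } }
    ; ι = λ z → z ∔ + 0 ω
    ; ι-+ = λ _ _ → refl
    ; ι-* = λ m n → cong₂ _∔_ω (hom₁ ν m n) (hom₂ τ m n)
    ; ι-neg = λ _ → refl
    ; ι-0 = refl
    ; ι-1 = refl
    }
    where
    add mul : Order → Order → Order
    add (a ∔ b ω) (c ∔ d ω) = a + c ∔ b + d ω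
    mul (a ∔ b ω) (c ∔ d ω) = a * c - ν * (b * d) ∔ a * d + b * c + τ * (b * d) ω
    neg : Order → Order
    neg (a ∔ b ω) = - a ∔ - b ω
    assoc₁ : ∀ τ ν a b c d e f → (a * c - ν * (b * d)) * e - ν * ((a * d + b * c + τ * (b * d)) * f)
             ≡ a * (c * e - ν * (d * f)) - ν * (b * (c * f + d * e + τ * (d * f)))
    assoc₁ = solve-∀
    assoc₂ : ∀ τ ν a b c d e f →
      (a * c - ν * (b * d)) * f + (a * d + b * c + τ * (b * d)) * e + τ * ((a * d + b * c + τ * (b * d)) * f)
      ≡ a * (c * f + d * e + τ * (d * f)) + b * (c * e - ν * (d * f)) + τ * (b * (c * f + d * e + τ * (d * f)))
    assoc₂ = solve-∀
    idˡ₁ : ∀ τ ν a b → + 1 * a - ν * (+ 0 * b) ≡ a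
    idˡ₁ = solve-∀
    idˡ₂ : ∀ τ a b → + 1 * b + + 0 * a + τ * (+ 0 * b) ≡ b
    idˡ₂ = solve-∀
    idʳ₁ : ∀ ν a b → a * + 1 - ν * (b * + 0) ≡ a
    idʳ₁ = solve-∀
    idʳ₂ : ∀ τ a b → a * + 0 + b * + 1 + τ * (b * + 0) ≡ b
    idʳ₂ = solve-∀
    distˡ₁ : ∀ ν a b c d e f → a * (c + e) - ν * (b * (d + f)) ≡ (a * c - ν * (b * d)) + (a * e - ν * (b * f))
    distˡ₁ = solve-∀
    distˡ₂ : ∀ τ a b c d e f → a * (d + f) + b * (c + e) + τ * (b * (d + f))
             ≡ (a * d + b * c + τ * (b * d)) + (a * f + b * e + τ * (b * f))
    distˡ₂ = solve-∀
    distʳ₁ : ∀ ν a b c d e f → (c + e) * a - ν * ((d + f) * b) ≡ (c * a - ν * (d * b)) + (e * a - ν * (f * b))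
    distʳ₁ = solve-∀
    distʳ₂ : ∀ τ a b c d e f → (c + e) * b + (d + f) * a + τ * ((d + f) * b)
             ≡ (c * b + d * a + τ * (d * b)) + (e * b + f * a + τ * (f * b))
    distʳ₂ = solve-∀
    comm₁ : ∀ ν a b c d → a * c - ν * (b * d) ≡ c * a - ν * (d * b)
    comm₁ = solve-∀
    comm₂ : ∀ τ a b c d → a * d + b * c + τ * (b * d) ≡ c * b + d * a + τ * (d * b)
    comm₂ = solve-∀
    hom₁ : ∀ ν m n → m * n ≡ m * n - ν * (+ 0 * + 0)
    hom₁ = solve-∀
    hom₂ : ∀ τ m n → + 0 ≡ m * + 0 + + 0 * n + τ * (+ 0 * + 0)
    hom₂ = solve-∀

  open ℤAlgebra ring public hiding (Carrier; isCommutativeRing; commutativeRing)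
  open Identities ring public

  re im norm trace : Order → ℤ
  re (m ∔ n ω) = m
  im (m ∔ n ω) = n
  norm (m ∔ n ω) = m * m + τ * (m * n) + ν * (n * n)
  trace (m ∔ n ω) = + 2 * m + τ * n

  conj : Order → Order
  conj (m ∔ n ω) = m + τ * n ∔ - n ω

  conj-⊗ : ∀ x y → conj (x ⊗ y) ≡ conj x ⊗ conj y
  conj-⊗ (a ∔ b ω) (c ∔ d ω) = cong₂ _∔_ω (lemma₁ τ ν a b c d) (lemma₂ τ a b c d)
    where
    lemma₁ : ∀ τ ν a b c d → (a * c - ν * (b * d)) + τ * (a * d + b * c + τ * (b * d)) ≡ (a + τ * b) * (c + τ * d) - ν * (- b * - d)
    lemma₁ = solve-∀
    lemma₂ : ∀ τ a b c d → - (a * d + b * c + τ * (b * d)) ≡ (a + τ * b) * - d + - b * (c + τ * d) + τ * (- b * - d)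
    lemma₂ = solve-∀

  conj-⊕ : ∀ x y → conj (x ⊕ y) ≡ conj x ⊕ conj y
  conj-⊕ (a ∔ b ω) (c ∔ d ω) = cong₂ _∔_ω (lemma₁ τ a b c d) (ℤP.neg-distrib-+ b d)
    where
    lemma₁ : ∀ τ a b c d → (a + c) + τ * (b + d) ≡ (a + τ * b) + (c + τ * d)
    lemma₁ = solve-∀

  conj-involutive : ∀ x → conj (conj x) ≡ x
  conj-involutive (a ∔ b ω) = cong₂ _∔_ω (lemma₁ τ a b) (ℤP.neg-involutive b)
    where
    lemma₁ : ∀ τ a b → (a + τ * b) + τ * - b ≡ a
    lemma₁ = solve-∀

  conj-ι : ∀ z → conj (ι z) ≡ ι z
  conj-ι z = cong₂ _∔_ω (trans (cong (λ w → z + w) (ℤP.*-zeroʳ τ)) (ℤP.+-identityʳ z)) refl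

  x⊗conj : ∀ x → x ⊗ conj x ≡ ι (norm x)
  x⊗conj (a ∔ b ω) = cong₂ _∔_ω (lemma₁ τ ν a b) (lemma₂ τ a b)
    where
    lemma₁ : ∀ τ ν a b → a * (a + τ * b) - ν * (b * - b) ≡ a * a + τ * (a * b) + ν * (b * b)
    lemma₁ = solve-∀
    lemma₂ : ∀ τ a b → a * - b + b * (a + τ * b) + τ * (b * - b) ≡ + 0
    lemma₂ = solve-∀

  x⊕conj : ∀ x → x ⊕ conj x ≡ ι (trace x)
  x⊕conj (a ∔ b ω) = cong₂ _∔_ω (lemma₁ τ a b) (ℤP.+-inverseʳ b)
    where
    lemma₁ : ∀ τ a b → a + (a + τ * b) ≡ + 2 * a + τ * b
    lemma₁ = solve-∀

  ι-injective : ∀ {m n} → ι m ≡ ι n → m ≡ n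
  ι-injective refl = refl

  norm-⊗ : ∀ x y → norm (x ⊗ y) ≡ norm x * norm y
  norm-⊗ x y = ι-injective (trans (sym (x⊗conj (x ⊗ y))) (trans (cong (x ⊗ y ⊗_) (conj-⊗ x y))
    (trans (solve 4 (λ x y x′ y′ → x :* y :* (x′ :* y′) := x :* x′ :* (y :* y′)) refl x y (conj x) (conj y))
      (trans (cong₂ _⊗_ (x⊗conj x) (x⊗conj y)) (sym (ι-* (norm x) (norm y)))))))

  norm-ι : ∀ z → norm (ι z) ≡ z * z
  norm-ι z = lemma τ ν z
    where
    lemma : ∀ τ ν z → z * z + τ * (z * + 0) + ν * (+ 0 * + 0) ≡ z * z
    lemma = solve-∀

  norm-conj : ∀ x → norm (conj x) ≡ norm x
  norm-conj x = ι-injective (trans (sym (x⊗conj (conj x))) (trans (cong (conj x ⊗_) (conj-involutive x))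
    (trans (*-comm (conj x) x) (x⊗conj x))))

  ι⊗ : ∀ z x → ι z ⊗ x ≡ z * re x ∔ z * im x ω
  ι⊗ z (a ∔ b ω) = cong₂ _∔_ω (lemma₁ ν z a b) (lemma₂ τ z a b)
    where
    lemma₁ : ∀ ν z a b → z * a - ν * (+ 0 * b) ≡ z * a
    lemma₁ = solve-∀
    lemma₂ : ∀ τ z a b → z * b + + 0 * a + τ * (+ 0 * b) ≡ z * b
    lemma₂ = solve-∀

-- Prime ideals above a rational prime

module PrimeIdeals (τ ν : ℤ) where
  open import Data.Nat.GCD using (module Bézout)
  open import Data.Fin as Fin using (Fin; toℕ; fromℕ<)
  open import Data.Fin.Properties using (any?; toℕ-fromℕ<)
  open import Data.Integer using (_+_; _*_; -_; _-_)
  open import Data.Integer.Divisibility.Signed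
  open IntegerLemmas
  open QuadraticOrder τ ν

  disc : ℤ
  disc = τ * τ - + 4 * ν

  charPoly : ℤ → ℤ
  charPoly ρ = ρ * ρ - τ * ρ + ν

  record IsPrimeIdeal (P : Order → Set) : Set where
    field
      zero∈    : P 𝟘
      +-closed : ∀ x y → P x → P y → P (x ⊕ y)
      absorb   : ∀ r x → P x → P (r ⊗ x)
      proper   : ¬ P 𝟙
      prime    : ∀ x y → P (x ⊗ y) → P x ⊎ P y

    ∉-⊗ : ∀ {x y} → ¬ P x → ¬ P y → ¬ P (x ⊗ y)
    ∉-⊗ {x} {y} x∉ y∉ xy∈ with prime x y xy∈
    ... | inj₁ x∈ = x∉ x∈
    ... | inj₂ y∈ = y∉ y∈

    ∉-sq : ∀ {x} → ¬ P x → ¬ P (sq x)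
    ∉-sq x∉ = ∉-⊗ x∉ x∉

    ∉-pow6 : ∀ {x} → ¬ P x → ¬ P (pow6 x)
    ∉-pow6 x∉ = ∉-⊗ (∉-sq x∉) (∉-sq (∉-sq x∉))

    ∉-pow12 : ∀ {x} → ¬ P x → ¬ P (pow12 x)
    ∉-pow12 x∉ = ∉-sq (∉-pow6 x∉)

  Conj : (Order → Set) → Order → Set
  Conj P x = P (conj x)

  -- The first condition places P ∩ P̄ inside (ℓ) and so covers split and inert primes at once. In
  -- the second P equals its conjugate, and the divisibility of the discriminant will restrict ℓ to
  -- 2 and p.
  Unramified Ramified : ℕ → (Order → Set) → Set
  Unramified ℓ P = ∀ x → P x → P (conj x) → ∃ λ y → x ≡ ι (+ ℓ) ⊗ y
  Ramified ℓ P = (∀ x → P x → P (conj x)) × + ℓ ∣ disc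

  record PrimeAbove (ℓ : ℕ) : Set₁ where
    field
      P     : Order → Set
      isPrimeIdeal : IsPrimeIdeal P
      P?    : ∀ x → Dec (P x)
      ℓ∈P   : P (ι (+ ℓ))
      ι∈P⇒∣ : ∀ {z} → P (ι z) → + ℓ ∣ z
      ramification : Unramified ℓ P ⊎ Ramified ℓ P
    open IsPrimeIdeal isPrimeIdeal public

  conj-isPrimeIdeal : ∀ {P} → IsPrimeIdeal P → IsPrimeIdeal (Conj P)
  conj-isPrimeIdeal {P} isP = record
    { zero∈ = subst P (sym (conj-ι (+ 0))) zero∈
    ; +-closed = λ x y x∈ y∈ → subst P (sym (conj-⊕ x y)) (+-closed _ _ x∈ y∈)
    ; absorb = λ r x x∈ → subst P (sym (conj-⊗ r x)) (absorb _ _ x∈)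
    ; proper = λ 1∈ → proper (subst P (conj-ι (+ 1)) 1∈)
    ; prime = λ x y xy∈ → prime _ _ (subst P (conj-⊗ x y) xy∈)
    }
    where open IsPrimeIdeal isP

  divide-components : ∀ {ℓ a b} → + ℓ ∣ a → + ℓ ∣ b → ∃ λ y → a ∔ b ω ≡ ι (+ ℓ) ⊗ y
  divide-components {ℓ} (divides q eq) (divides q′ eq′) =
    q ∔ q′ ω , sym (trans (ι⊗ (+ ℓ) (q ∔ q′ ω)) (cong₂ _∔_ω (trans (ℤP.*-comm (+ ℓ) q) (sym eq))
        (trans (ℤP.*-comm (+ ℓ) q′) (sym eq′))))

  -- For a root ρ of the characteristic polynomial of ω modulo ℓ, P is the kernel of the reduction ω
  -- ↦ ρ onto the field with ℓ elements. `φ` lifts this map to ℤ, where it is multiplicative up to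
  -- multiples of `charPoly ρ`.
  module DegreeOne {ℓ} (pr : Prime ℓ) (ρ : ℤ) (root : + ℓ ∣ charPoly ρ) where
    φ : Order → ℤ
    φ x = re x + im x * ρ

    P : Order → Set
    P x = + ℓ ∣ φ x

    φ-⊗ : ∀ x y → φ (x ⊗ y) ≡ φ x * φ y - im x * im y * charPoly ρ
    φ-⊗ (a ∔ b ω) (c ∔ d ω) = lemma τ ν ρ a b c d
      where
      lemma : ∀ τ ν ρ a b c d → (a * c - ν * (b * d)) + (a * d + b * c + τ * (b * d)) * ρ
              ≡ (a + b * ρ) * (c + d * ρ) - b * d * (ρ * ρ - τ * ρ + ν)
      lemma = solve-∀

    φ-⊕ : ∀ x y → φ (x ⊕ y) ≡ φ x + φ y
    φ-⊕ (a ∔ b ω) (c ∔ d ω) = lemma ρ a b c d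
      where
      lemma : ∀ ρ a b c d → (a + c) + (b + d) * ρ ≡ (a + b * ρ) + (c + d * ρ)
      lemma = solve-∀

    φ-ι : ∀ z → φ (ι z) ≡ z
    φ-ι z = lemma z ρ
      where
      lemma : ∀ z ρ → z + + 0 * ρ ≡ z
      lemma = solve-∀

    -- The factor 2ρ - τ is the derivative of `charPoly` at ρ. If ℓ divides it, the root is double
    -- and P is stable under conjugation; otherwise x and its conjugate lie in P together only if ℓ
    -- divides the coefficient of ω.
    φ-conj : ∀ x → φ x - φ (conj x) ≡ (+ 2 * ρ - τ) * im x
    φ-conj (a ∔ b ω) = lemma τ ρ a b
      where
      lemma : ∀ τ ρ a b → (a + b * ρ) - ((a + τ * b) + - b * ρ) ≡ (+ 2 * ρ - τ) * b
      lemma = solve-∀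

    isPrimeIdeal : IsPrimeIdeal P
    isPrimeIdeal = record
      { zero∈ = divides (+ 0) refl
      ; +-closed = λ x y x∈ y∈ → subst (+ ℓ ∣_) (sym (φ-⊕ x y)) (∣m∣n⇒∣m+n x∈ y∈)
      ; absorb = λ r x x∈ → subst (+ ℓ ∣_) (sym (φ-⊗ r x)) (∣m∣n⇒∣m-n (∣n⇒∣m*n (φ r) x∈) (∣n⇒∣m*n (im r * im x) root))
      ; proper = λ 1∈ → prime∤1 pr (subst (+ ℓ ∣_) (φ-ι (+ 1)) 1∈)
      ; prime = λ x y xy∈ → euclid pr (φ x) (φ y)
          (∣m+n∣n⇒∣m (subst (+ ℓ ∣_) (φ-⊗ x y) xy∈) (∣m⇒∣-m (∣n⇒∣m*n (im x * im y) root)))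
      }

    ramified : + ℓ ∣ + 2 * ρ - τ → Ramified ℓ P
    ramified d = (λ x x∈ → subst (+ ℓ ∣_) (lemma (φ x) (φ (conj x)))
                     (∣m∣n⇒∣m-n x∈ (subst (+ ℓ ∣_) (sym (φ-conj x)) (∣m⇒∣m*n (im x) d))))
               , subst (+ ℓ ∣_) (disc-lemma τ ν ρ) (∣m∣n⇒∣m-n (∣m⇒∣m*n (+ 2 * ρ - τ) d) (∣n⇒∣m*n (+ 4) root))
      where
      lemma : ∀ x y → x - (x - y) ≡ y
      lemma = solve-∀
      disc-lemma : ∀ τ ν ρ → (+ 2 * ρ - τ) * (+ 2 * ρ - τ) - + 4 * (ρ * ρ - τ * ρ + ν) ≡ τ * τ - + 4 * ν
      disc-lemma = solve-∀

    unramified : ¬ + ℓ ∣ + 2 * ρ - τ → Unramified ℓ P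
    unramified ∤ (a ∔ b ω) x∈ x̄∈ = divide-components (∣m+n∣n⇒∣m x∈ (∣m⇒∣m*n ρ ℓ∣b)) ℓ∣b
      where
      ℓ∣b : + ℓ ∣ b
      ℓ∣b = [ (λ d → ⊥-elim (∤ d)) , (λ d → d) ]′
              (euclid pr (+ 2 * ρ - τ) b (subst (+ ℓ ∣_) (φ-conj (a ∔ b ω)) (∣m∣n⇒∣m-n x∈ x̄∈)))

    primeAbove : PrimeAbove ℓ
    primeAbove = record
      { P = P ; isPrimeIdeal = isPrimeIdeal ; P? = λ x → + ℓ ∣? φ x
      ; ℓ∈P = subst (+ ℓ ∣_) (sym (φ-ι (+ ℓ))) ∣-refl
      ; ι∈P⇒∣ = λ {z} → subst (+ ℓ ∣_) (φ-ι z)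
      ; ramification = ram }
      where
      ram : Unramified ℓ P ⊎ Ramified ℓ P
      ram with + ℓ ∣? + 2 * ρ - τ
      ... | yes d = inj₂ (ramified d)
      ... | no ∤ = inj₁ (unramified ∤)

  coprime-to-prime : ∀ {ℓ} → Prime ℓ → ∀ {n} → ¬ ℓ ℕD.∣ n → Coprimality.Coprime ℓ n
  coprime-to-prime pr ∤ (d∣ℓ , d∣n) with prime⇒irreducible pr d∣ℓ
  ... | inj₁ d≡1 = d≡1
  ... | inj₂ refl = ⊥-elim (∤ d∣n)

  inverse-mod-abs : ∀ {ℓ} → Prime ℓ → ∀ n → ¬ ℓ ℕD.∣ n → ∃ λ v → + ℓ ∣ + n * v - + 1
  inverse-mod-abs {ℓ} pr n ∤ with Coprimality.coprime-Bézout (coprime-to-prime pr ∤)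
  ... | Bézout.+- x y eq = - + y , divides (- + x) (trans (lemma₁ (+ n) (+ y)) (trans (cong -_ (identity eq))
      (ℤP.neg-distribˡ-* (+ x) (+ ℓ))))
    where
    lemma₁ : ∀ n y → n * - y - + 1 ≡ - (+ 1 + y * n)
    lemma₁ = solve-∀
    identity : 1 ℕ.+ y ℕ.* n ≡ x ℕ.* ℓ → + 1 + + y * + n ≡ + x * + ℓ
    identity eq = trans (cong (λ z → + 1 + z) (sym (ℤP.pos-* y n))) (trans (cong +_ eq) (ℤP.pos-* x ℓ))
  ... | Bézout.-+ x y eq = + y , divides (+ x)
      (trans (cong (_- + 1) (trans (ℤP.*-comm (+ n) (+ y)) (sym (identity eq)))) (lemma₁ (+ x * + ℓ)))
    where
    lemma₁ : ∀ z → + 1 + z - + 1 ≡ z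
    lemma₁ = solve-∀
    identity : 1 ℕ.+ x ℕ.* ℓ ≡ y ℕ.* n → + 1 + + x * + ℓ ≡ + y * + n
    identity eq = trans (cong (λ z → + 1 + z) (sym (ℤP.pos-* x ℓ))) (trans (cong +_ eq) (ℤP.pos-* y n))

  inverse-mod : ∀ {ℓ} → Prime ℓ → ∀ n → ¬ + ℓ ∣ n → ∃ λ v → + ℓ ∣ n * v - + 1
  inverse-mod {ℓ} pr n ∤ with inverse-mod-abs pr ∣ n ∣ (λ d → ∤ (∣ᵤ⇒∣ d)) | ℤP.+∣i∣≡i⊎+∣i∣≡-i n
  ... | v , d | inj₁ eq = v , subst (λ z → + ℓ ∣ z * v - + 1) eq d
  ... | v , d | inj₂ eq = - v , subst (λ z → + ℓ ∣ z - + 1) (trans (cong (_* v) eq) (lemma n v)) d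
    where
    lemma : ∀ n v → - n * v ≡ n * - v
    lemma = solve-∀

  -- Without a root modulo ℓ the ideal (ℓ) is itself prime: membership amounts to ℓ dividing the
  -- norm, and the norm is multiplicative.
  module Inert {ℓ} (pr : Prime ℓ) (noRoot : ∀ ρ → ¬ + ℓ ∣ charPoly ρ) where
    P : Order → Set
    P x = (+ ℓ ∣ re x) × (+ ℓ ∣ im x)

    -- The norm of m + nω is n² times `charPoly` at -m/n. With v an inverse of n modulo ℓ, a norm
    -- divisible by ℓ therefore makes -m v a root unless ℓ divides n.
    root-of-norm : ∀ m n v → + ℓ ∣ norm (m ∔ n ω) → + ℓ ∣ n * v - + 1 → + ℓ ∣ n * (n * charPoly (- m * v))
    root-of-norm m n v d e = subst (+ ℓ ∣_) (sym (lemma τ ν m n v)) (∣m∣n⇒∣m+n d (∣m⇒∣m*n _ e))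
      where
      lemma : ∀ τ ν m n v → n * (n * (- m * v * (- m * v) - τ * (- m * v) + ν))
        ≡ m * m + τ * (m * n) + ν * (n * n) + (n * v - + 1) * (m * m * (n * v + + 1) + τ * (m * n))
      lemma = solve-∀

    ∣norm⇒∣im : ∀ m n → + ℓ ∣ norm (m ∔ n ω) → Dec (+ ℓ ∣ n) → + ℓ ∣ n
    ∣norm⇒∣im m n d (yes ℓ∣n) = ℓ∣n
    ∣norm⇒∣im m n d (no ∤n) = [ (λ e → e) , [ (λ e → e) , (λ e → ⊥-elim (noRoot (- m * v) e)) ]′ ∘ euclid pr n (charPoly (- m * v)) ]′
      (euclid pr n (n * charPoly (- m * v)) (root-of-norm m n v d (proj₂ (inverse-mod pr n ∤n))))
      where
      v = proj₁ (inverse-mod pr n ∤n)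

    ∣norm⇒∈ : ∀ x → + ℓ ∣ norm x → P x
    ∣norm⇒∈ (m ∔ n ω) d = euclid-square pr m ∣m² , ℓ∣n
      where
      ℓ∣n : + ℓ ∣ n
      ℓ∣n = ∣norm⇒∣im m n d (+ ℓ ∣? n)
      ∣m² : + ℓ ∣ m * m
      ∣m² = ∣m+n∣n⇒∣m (∣m+n∣n⇒∣m d (∣n⇒∣m*n ν (∣n⇒∣m*n n ℓ∣n))) (∣n⇒∣m*n τ (∣n⇒∣m*n m ℓ∣n))

    ∈⇒∣norm : ∀ x → P x → + ℓ ∣ norm x
    ∈⇒∣norm (m ∔ n ω) (d , e) = ∣m∣n⇒∣m+n (∣m∣n⇒∣m+n (∣m⇒∣m*n m d) (∣n⇒∣m*n τ (∣m⇒∣m*n n d))) (∣n⇒∣m*n ν (∣m⇒∣m*n n e))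

    isPrimeIdeal : IsPrimeIdeal P
    isPrimeIdeal = record
      { zero∈ = divides (+ 0) refl , divides (+ 0) refl
      ; +-closed = λ { (a ∔ b ω) (c ∔ d ω) (x , y) (z , w) → ∣m∣n⇒∣m+n x z , ∣m∣n⇒∣m+n y w }
      ; absorb = λ { (a ∔ b ω) (c ∔ d ω) (z , w) →
            ∣m∣n⇒∣m-n (∣n⇒∣m*n a z) (∣n⇒∣m*n ν (∣n⇒∣m*n b w))
          , ∣m∣n⇒∣m+n (∣m∣n⇒∣m+n (∣n⇒∣m*n a w) (∣n⇒∣m*n b z)) (∣n⇒∣m*n τ (∣n⇒∣m*n b w)) }
      ; proper = λ { (d , _) → prime∤1 pr d }
      ; prime = prime
      }
      where
      prime : ∀ x y → P (x ⊗ y) → P x ⊎ P y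
      prime x y xy∈ = [ inj₁ ∘ ∣norm⇒∈ x , inj₂ ∘ ∣norm⇒∈ y ]′
        (euclid pr (norm x) (norm y) (subst (+ ℓ ∣_) (norm-⊗ x y) (∈⇒∣norm (x ⊗ y) xy∈)))

    unramified : Unramified ℓ P
    unramified (_ ∔ _ ω) (d , e) _ = divide-components d e

    primeAbove : PrimeAbove ℓ
    primeAbove = record
      { P = P ; isPrimeIdeal = isPrimeIdeal ; P? = λ x → (+ ℓ ∣? re x) ×-dec (+ ℓ ∣? im x)
      ; ℓ∈P = ∣-refl , divides (+ 0) refl
      ; ι∈P⇒∣ = proj₁
      ; ramification = inj₁ unramified }

  -- The two kinds of primes are separated by trying the residues 0, ..., ℓ - 1 as roots; an
  -- arbitrary root reduces to one of these.
  primeAbove : ∀ {ℓ} → Prime ℓ → PrimeAbove ℓ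
  primeAbove {ℓ} pr with any? (λ (i : Fin ℓ) → + ℓ ∣? charPoly (+ toℕ i))
  ... | yes (i , root) = DegreeOne.primeAbove pr (+ toℕ i) root
  ... | no none = Inert.primeAbove pr noRoot
    where
    instance _ = prime⇒nonZero pr
    noRoot : ∀ ρ → ¬ + ℓ ∣ charPoly ρ
    noRoot ρ d = none (fromℕ< r<ℓ , subst (λ r → + ℓ ∣ charPoly (+ r)) (sym (toℕ-fromℕ< r<ℓ))
                   (∣m+n∣n⇒∣m (subst (+ ℓ ∣_) (trans (cong charPoly (ℤDM.a≡a%ℕn+[a/ℕn]*n ρ ℓ)) (lemma τ ν (+ r) q (+ ℓ))) d)
                     (∣m⇒∣m*n _ ∣-refl)))
      where
      r = ρ ℤDM.%ℕ ℓ
      q = ρ ℤDM./ℕ ℓ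
      r<ℓ : r ℕ.< ℓ
      r<ℓ = ℤDM.n%ℕd<d ρ ℓ
      lemma : ∀ τ ν r q l → (r + q * l) * (r + q * l) - τ * (r + q * l) + ν
              ≡ (r * r - τ * r + ν) + l * (+ 2 * r * q + q * q * l - τ * q)
      lemma = solve-∀

-- Valuations at a prime of the order

module Valuations (τ ν : ℤ) (anisotropic : ∀ x → QuadraticOrder.norm τ ν x ≡ + 0 → x ≡ + 0 QuadraticOrders.∔ + 0 ω) where
  open import Data.Integer using (_+_; _*_; -_; _-_)
  open import Data.Integer.Divisibility.Signed
  open NaturalValuations
  open IntegerLemmas
  open QuadraticOrder τ ν
  open PrimeIdeals τ ν

  norm-sq : ∀ x → norm (sq x) ≡ norm x ²
  norm-sq x = norm-⊗ x x

  norm-pow12 : ∀ x → norm (pow12 x) ≡ norm x ¹²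
  norm-pow12 x = trans (norm-sq (pow6 x)) (cong _² (trans (norm-⊗ (sq x) (pow4 x))
    (cong₂ _*_ (norm-sq x) (trans (norm-sq (sq x)) (cong _² (norm-sq x))))))

  ι-sq : ∀ z → ι (z ²) ≡ sq (ι z)
  ι-sq z = ι-* z z

  ι-pow12 : ∀ z → ι (z ¹²) ≡ pow12 (ι z)
  ι-pow12 z = trans (ι-sq (z ⁶)) (cong sq (trans (ι-* (z ²) (z ⁴)) (cong₂ _⊗_ (ι-sq z) (trans (ι-sq (z ²)) (cong sq (ι-sq z))))))

  norm≢0 : ∀ {x} → x ≢ 𝟘 → norm x ≢ + 0
  norm≢0 x≢ eq = x≢ (anisotropic _ eq)

  norm-𝟘 : norm 𝟘 ≡ + 0
  norm-𝟘 = norm-ι (+ 0)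

  norm≢0⇒≢𝟘 : ∀ {x} → norm x ≢ + 0 → x ≢ 𝟘
  norm≢0⇒≢𝟘 n≢ refl = n≢ norm-𝟘

  ⊗-≢𝟘 : ∀ {x y} → x ≢ 𝟘 → y ≢ 𝟘 → x ⊗ y ≢ 𝟘
  ⊗-≢𝟘 {x} {y} x≢ y≢ eq = *-≢0 (norm≢0 x≢) (norm≢0 y≢) (trans (sym (norm-⊗ x y)) (trans (cong norm eq) norm-𝟘))

  sq-≢𝟘 : ∀ {x} → x ≢ 𝟘 → sq x ≢ 𝟘
  sq-≢𝟘 x≢ = ⊗-≢𝟘 x≢ x≢

  pow12-≢𝟘 : ∀ {x} → x ≢ 𝟘 → pow12 x ≢ 𝟘
  pow12-≢𝟘 x≢ = sq-≢𝟘 (⊗-≢𝟘 (sq-≢𝟘 x≢) (sq-≢𝟘 (sq-≢𝟘 x≢)))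

  pow12-⊗ : ∀ x y → pow12 (x ⊗ y) ≡ pow12 x ⊗ pow12 y
  pow12-⊗ = solve 2 (λ x y → pow12′ (x :* y) := pow12′ x :* pow12′ y) refl

  conj-sq : ∀ x → conj (sq x) ≡ sq (conj x)
  conj-sq x = conj-⊗ x x

  conj-pow12 : ∀ x → conj (pow12 x) ≡ pow12 (conj x)
  conj-pow12 x = trans (conj-sq (pow6 x)) (cong sq (trans (conj-⊗ (sq x) (pow4 x))
    (cong₂ _⊗_ (conj-sq x) (trans (conj-sq (sq x)) (cong sq (conj-sq x))))))

  ι-≢𝟘 : ∀ {z} → z ≢ + 0 → ι z ≢ 𝟘
  ι-≢𝟘 z≢ eq = z≢ (ι-injective eq)

  conj-≢𝟘 : ∀ {x} → x ≢ 𝟘 → conj x ≢ 𝟘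
  conj-≢𝟘 {x} x≢ = norm≢0⇒≢𝟘 (subst (_≢ + 0) (sym (norm-conj x)) (norm≢0 x≢))

  ⊗-cancelˡ : ∀ {x} y z → x ≢ 𝟘 → x ⊗ y ≡ x ⊗ z → y ≡ z
  ⊗-cancelˡ {x} y z x≢ eq = from-difference (anisotropic _ (norm-difference (ℤP.i*j≡0⇒i≡0∨j≡0 (norm x) norm-product)))
    where
    product≡𝟘 : x ⊗ (y ⊖ z) ≡ 𝟘
    product≡𝟘 = trans (solve 3 (λ x y z → x :* (y :+ :- z) := x :* y :+ :- (x :* z)) refl x y z)
      (trans (cong (_⊖ x ⊗ z) eq) (-‿inverseʳ (x ⊗ z)))
    norm-product : norm x * norm (y ⊖ z) ≡ + 0
    norm-product = trans (sym (norm-⊗ x (y ⊖ z))) (trans (cong norm product≡𝟘) norm-𝟘)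
    norm-difference : norm x ≡ + 0 ⊎ norm (y ⊖ z) ≡ + 0 → norm (y ⊖ z) ≡ + 0
    norm-difference (inj₁ e) = ⊥-elim (norm≢0 x≢ e)
    norm-difference (inj₂ e) = e
    from-difference : y ⊖ z ≡ 𝟘 → y ≡ z
    from-difference e = trans (solve 2 (λ y z → y := (y :+ :- z) :+ z) refl y z)
      (trans (cong (_⊕ z) e) (+-identityˡ z))

  module At {ℓ} (pr : Prime ℓ) (above : PrimeAbove ℓ) where
    open PrimeAbove above

    ℓ≢0 : + ℓ ≢ + 0
    ℓ≢0 refl with prime⇒nonZero pr
    ... | ()

    power : ℕ → Order
    power k = ι (+ (ℓ ℕ.^ k))

    power-suc : ∀ k → power (suc k) ≡ ι (+ ℓ) ⊗ power k
    power-suc k = trans (cong ι (ℤP.pos-* ℓ (ℓ ℕ.^ k))) (ι-* (+ ℓ) (+ (ℓ ℕ.^ k)))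

    power-+ : ∀ k h → power (k ℕ.+ h) ≡ power k ⊗ power h
    power-+ k h = trans (cong (ι ∘ +_) (ℕP.^-distribˡ-+-* ℓ k h))
      (trans (cong ι (ℤP.pos-* (ℓ ℕ.^ k) (ℓ ℕ.^ h))) (ι-* (+ (ℓ ℕ.^ k)) (+ (ℓ ℕ.^ h))))

    ∉⇒≢𝟘 : ∀ {x} → ¬ P x → x ≢ 𝟘
    ∉⇒≢𝟘 x∉ refl = x∉ zero∈

    ∉-ι : ∀ {z} → ¬ + ℓ ∣ z → ¬ P (ι z)
    ∉-ι ∤ z∈ = ∤ (ι∈P⇒∣ z∈)

    -- In the localisation at P, x is ℓᵏ times a unit. Since exponents count powers of ℓ, no
    -- generator of P is required; the price is that at a ramified prime only elements of even
    -- P-adic order, such as nonzero rational integers, have a valuation in this sense.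
    record HasValuation (x : Order) (k : ℕ) : Set where
      constructor valuation
      field
        s t   : Order
        s∉    : ¬ P s
        t∉    : ¬ P t
        s⊗x≡ : s ⊗ x ≡ power k ⊗ t

    power-unique : ∀ k h {s t} → ¬ P s → ¬ P t → power k ⊗ s ≡ power h ⊗ t → k ≡ h
    power-unique zero zero _ _ _ = refl
    power-unique zero (suc h) {s} {t} s∉ t∉ eq = ⊥-elim (s∉ (subst P (trans (sym eq) (*-identityˡ s))
      (subst P (trans (solve 3 (λ a b c → b :* c :* a := a :* b :* c) refl (ι (+ ℓ)) (power h) t)
                  (cong (_⊗ t) (sym (power-suc h)))) (absorb (power h ⊗ t) _ ℓ∈P))))
    power-unique (suc k) zero s∉ t∉ eq = sym (power-unique zero (suc k) t∉ s∉ (sym eq))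
    power-unique (suc k) (suc h) {s} {t} s∉ t∉ eq = cong suc (power-unique k h s∉ t∉
      (⊗-cancelˡ _ _ (ι-≢𝟘 ℓ≢0) (trans (lemma k s) (trans eq (sym (lemma h t))))))
      where
      lemma : ∀ k s → ι (+ ℓ) ⊗ (power k ⊗ s) ≡ power (suc k) ⊗ s
      lemma k s = trans (sym (*-assoc (ι (+ ℓ)) (power k) s)) (cong (_⊗ s) (sym (power-suc k)))

    valuation-unique : ∀ {x k h} → HasValuation x k → HasValuation x h → k ≡ h
    valuation-unique {x} {k} {h} (valuation s t s∉ t∉ eq) (valuation s′ t′ s′∉ t′∉ eq′) =
      power-unique k h (∉-⊗ s′∉ t∉) (∉-⊗ s∉ t′∉)
        (trans (swap s′ (power k) t) (trans (cong (s′ ⊗_) (sym eq))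
            (trans (swap s s′ x) (trans (cong (s ⊗_) eq′) (swap (power h) s t′)))))
      where
      swap : ∀ a b c → b ⊗ (a ⊗ c) ≡ a ⊗ (b ⊗ c)
      swap = solve 3 (λ a b c → b :* (a :* c) := a :* (b :* c)) refl

    valuation-⊗ : ∀ {x y k h} → HasValuation x k → HasValuation y h → HasValuation (x ⊗ y) (k ℕ.+ h)
    valuation-⊗ {x} {y} {k} {h} (valuation s t s∉ t∉ eq) (valuation s′ t′ s′∉ t′∉ eq′) =
      valuation (s ⊗ s′) (t ⊗ t′) (∉-⊗ s∉ s′∉) (∉-⊗ t∉ t′∉)
        (trans (interchange s s′ x y) (trans (cong₂ _⊗_ eq eq′)
          (trans (interchange (power k) t (power h) t′) (cong (_⊗ (t ⊗ t′)) (sym (power-+ k h))))))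
      where
      interchange : ∀ a b c d → a ⊗ b ⊗ (c ⊗ d) ≡ a ⊗ c ⊗ (b ⊗ d)
      interchange = solve 4 (λ a b c d → a :* b :* (c :* d) := a :* c :* (b :* d)) refl

    valuation-pow12 : ∀ {x k} → HasValuation x k → HasValuation (pow12 x) (k ℕ.* 12)
    valuation-pow12 {x} {k} v = subst (HasValuation (pow12 x)) (lemma k) (valuation-⊗ v6 v6)
      where
      v2 = valuation-⊗ v v
      v6 = valuation-⊗ v2 (valuation-⊗ v2 v2)
      lemma : ∀ k → (k ℕ.+ k ℕ.+ (k ℕ.+ k ℕ.+ (k ℕ.+ k))) ℕ.+ (k ℕ.+ k ℕ.+ (k ℕ.+ k ℕ.+ (k ℕ.+ k))) ≡ k ℕ.* 12
      lemma = ℕ-solve-∀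

    valuation-∉ : ∀ {x} → ¬ P x → HasValuation x 0
    valuation-∉ {x} x∉ = valuation 𝟙 x proper x∉ refl

    valuation-ι : ∀ {z k w} → z ≡ + (ℓ ℕ.^ k) * w → ¬ + ℓ ∣ w → HasValuation (ι z) k
    valuation-ι {z} {k} {w} eq ∤ = valuation 𝟙 (ι w) proper (∉-ι ∤)
      (trans (*-identityˡ (ι z)) (trans (cong ι eq) (ι-* (+ (ℓ ℕ.^ k)) w)))

    ι-valuation : ∀ z → z ≢ + 0 → ∃ (HasValuation (ι z))
    ι-valuation z z≢ with factor-outℤ pr z z≢
    ... | k , w , eq , ∤ = k , valuation-ι {z} {k} {w} eq ∤

    -- Dividing both components by ℓ divides the norm by ℓ², so the process stops.
    primitive-part : ∀ x → x ≢ 𝟘 → ∃₂ λ k y → x ≡ power k ⊗ y × ¬ ((+ ℓ ∣ re y) × (+ ℓ ∣ im y))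
    primitive-part x x≢ = <-rec (λ N → ∀ x → ∣ norm x ∣ ≡ N → x ≢ 𝟘 →
        ∃₂ λ k y → x ≡ power k ⊗ y × ¬ ((+ ℓ ∣ re y) × (+ ℓ ∣ im y))) step ∣ norm x ∣ x refl x≢
      where
      step : ∀ N → (∀ {M} → M ℕ.< N → ∀ x → ∣ norm x ∣ ≡ M → x ≢ 𝟘 →
               ∃₂ λ k y → x ≡ power k ⊗ y × ¬ ((+ ℓ ∣ re y) × (+ ℓ ∣ im y))) →
             ∀ x → ∣ norm x ∣ ≡ N → x ≢ 𝟘 → ∃₂ λ k y → x ≡ power k ⊗ y × ¬ ((+ ℓ ∣ re y) × (+ ℓ ∣ im y))
      step _ rec x refl x≢ = go ((+ ℓ ∣? re x) ×-dec (+ ℓ ∣? im x))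
        where
        go : Dec ((+ ℓ ∣ re x) × (+ ℓ ∣ im x)) → ∃₂ λ k y → x ≡ power k ⊗ y × ¬ ((+ ℓ ∣ re y) × (+ ℓ ∣ im y))
        go (no ∤) = 0 , x , sym (*-identityˡ x) , ∤
        go (yes (d , e)) = suc (proj₁ inner) , proj₁ (proj₂ inner) ,
            trans x≡ (trans (cong (ι (+ ℓ) ⊗_) (proj₁ (proj₂ (proj₂ inner))))
              (trans (sym (*-assoc (ι (+ ℓ)) (power (proj₁ inner)) (proj₁ (proj₂ inner))))
                  (cong (_⊗ proj₁ (proj₂ inner)) (sym (power-suc (proj₁ inner)))))) ,
            proj₂ (proj₂ (proj₂ inner))
          where
          divided : ∀ x → + ℓ ∣ re x → + ℓ ∣ im x → ∃ λ y → x ≡ ι (+ ℓ) ⊗ y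
          divided (_ ∔ _ ω) d e = divide-components d e
          y : Order
          y = proj₁ (divided x d e)
          x≡ : x ≡ ι (+ ℓ) ⊗ y
          x≡ = proj₂ (divided x d e)
          y≢ : y ≢ 𝟘
          y≢ y≡ = x≢ (trans x≡ (trans (cong (ι (+ ℓ) ⊗_) y≡) (zeroʳ (ι (+ ℓ)))))
          abs-norm : ∣ norm x ∣ ≡ ℓ ℕ.* (ℓ ℕ.* ∣ norm y ∣)
          abs-norm = trans (cong (∣_∣ ∘ norm) x≡) (trans (cong ∣_∣ (norm-⊗ (ι (+ ℓ)) y))
            (trans (ℤP.abs-* (norm (ι (+ ℓ))) (norm y)) (trans (cong (λ z → ∣ z ∣ ℕ.* ∣ norm y ∣) (norm-ι (+ ℓ)))
              (trans (cong (ℕ._* ∣ norm y ∣) (ℤP.abs-* (+ ℓ) (+ ℓ))) (ℕP.*-assoc ℓ ℓ ∣ norm y ∣)))))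
          instance
            nz : ℕ.NonZero ∣ norm y ∣
            nz = ℤ.≢-nonZero (norm≢0 y≢)
            nzℓ : ℕ.NonZero ℓ
            nzℓ = prime⇒nonZero pr
          smaller : ∣ norm y ∣ ℕ.< ∣ norm x ∣
          smaller = subst (∣ norm y ∣ ℕ.<_) (sym abs-norm)
            (ℕP.<-≤-trans (factor-< pr ∣ norm y ∣) (ℕP.m≤n*m (ℓ ℕ.* ∣ norm y ∣) ℓ))
          inner = rec smaller y refl y≢

    -- Let y be the primitive part of x. It cannot lie in P together with its conjugate ȳ, since ℓ
    -- would divide it. So if y lies in P, then ȳ is a unit at P, and y ȳ = N(y) reduces the
    -- question to a rational integer.
    unramified-valuation : Unramified ℓ P → ∀ x → x ≢ 𝟘 → ∃ (HasValuation x)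
    unramified-valuation unram x x≢ with primitive-part x x≢
    ... | i , y , x≡ , ∤ = go (P? y)
      where
      y≢ : y ≢ 𝟘
      y≢ y≡ = x≢ (trans x≡ (trans (cong (power i ⊗_) y≡) (zeroʳ (power i))))
      go : Dec (P y) → ∃ (HasValuation x)
      go (no y∉) = i , valuation 𝟙 y proper y∉ (trans (*-identityˡ x) x≡)
      go (yes y∈) = go′ (factor-outℤ pr (norm y) (norm≢0 y≢))
        where
        ȳ∉ : ¬ P (conj y)
        ȳ∉ ȳ∈ = ∤ (components (proj₂ (unram y y∈ ȳ∈)))
          where
          components : ∀ {y z} → y ≡ ι (+ ℓ) ⊗ z → (+ ℓ ∣ re y) × (+ ℓ ∣ im y)
          components {z = z} refl = subst (λ w → (+ ℓ ∣ re w) × (+ ℓ ∣ im w)) (sym (ι⊗ (+ ℓ) z))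
            (∣m⇒∣m*n (re z) ∣-refl , ∣m⇒∣m*n (im z) ∣-refl)
        go′ : (∃₂ λ j w → norm y ≡ + (ℓ ℕ.^ j) * w × ¬ + ℓ ∣ w) → ∃ (HasValuation x)
        go′ (j , w , eq , w∤) = i ℕ.+ j , valuation (conj y) (ι w) ȳ∉ (∉-ι w∤)
          (trans (cong (conj y ⊗_) x≡) (trans (solve 3 (λ ȳ p y → ȳ :* (p :* y) := p :* (y :* ȳ)) refl (conj y) (power i) y)
            (trans (cong (power i ⊗_) (trans (x⊗conj y) (trans (cong ι eq) (ι-* (+ (ℓ ℕ.^ j)) w))))
              (trans (sym (*-assoc (power i) (power j) (ι w))) (cong (_⊗ ι w) (sym (power-+ i j)))))))

    -- Every nonzero x has a valuation at an unramified prime, and that of x² is its double. At a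
    -- ramified prime this fails: the square of a uniformiser has valuation 1.
    square-valuation : Unramified ℓ P → ∀ {x k} → HasValuation (sq x) k → 2 ℕD.∣ k
    square-valuation unram {x} {k} v@(valuation s t s∉ t∉ eq) =
      go (unramified-valuation unram x x≢)
      where
      power-≢𝟘 : power k ≢ 𝟘
      power-≢𝟘 e = ℕ.≢-nonZero⁻¹ (ℓ ℕ.^ k) {{ℕP.m^n≢0 ℓ k {{prime⇒nonZero pr}}}} (ℤP.+-injective (ι-injective e))
      x≢ : x ≢ 𝟘
      x≢ refl = ⊗-≢𝟘 power-≢𝟘 (∉⇒≢𝟘 t∉) (trans (sym eq) (trans (cong (s ⊗_) (zeroˡ 𝟘)) (zeroʳ s)))
      go : ∃ (HasValuation x) → 2 ℕD.∣ k
      go (i , v′) = ℕD.divides i (trans (valuation-unique v (valuation-⊗ v′ v′)) (lemma i))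
        where
        lemma : ∀ i → i ℕ.+ i ≡ i ℕ.* 2
        lemma = ℕ-solve-∀

-- Good models and the norm of the discriminant

module GoodModels (τ ν : ℤ) (anisotropic : ∀ x → QuadraticOrder.norm τ ν x ≡ + 0 → x ≡ + 0 QuadraticOrders.∔ + 0 ω) where
  open import Data.Integer using (_+_; _*_; -_; _-_)
  open import Data.Integer.Divisibility.Signed
  open NaturalValuations
  open IntegerLemmas
  open QuadraticOrder τ ν
  open PrimeIdeals τ ν
  open Valuations τ ν anisotropic

  -- The condition that x is a nonzero rational number times a square of the field, with
  -- denominators cleared into g and γ; x = 0 satisfies it with γ = 0.
  RationalSquareClass : Order → Set
  RationalSquareClass x = ∃₂ λ g γ → g ≢ + 0 × ι g ⊗ x ≡ sq γ

  -- Hilbert 90 for x/r, made explicit: (x + r)² = x (x + x̄ + 2r).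
  square-norm⇒rationalSquareClass : ∀ x r → r ≢ + 0 → norm x ≡ r ² → RationalSquareClass x
  square-norm⇒rationalSquareClass x r r≢ N≡ = [ (λ e → degenerate e) , (λ g≢ → g , x ⊕ ι r , g≢ , g⊗x≡) ]′ (zero-or-not g)
    where
    g : ℤ
    g = trace x + + 2 * r
    zero-or-not : ∀ z → z ≡ + 0 ⊎ z ≢ + 0
    zero-or-not z with z ℤ.≟ + 0
    ... | yes e = inj₁ e
    ... | no ¬e = inj₂ ¬e
    g⊗x≡ : ι g ⊗ x ≡ sq (x ⊕ ι r)
    g⊗x≡ = trans (cong (_⊗ x) (trans (ι-+ (trace x) (+ 2 * r)) (cong₂ _⊕_ (sym (x⊕conj x)) (ι-* (+ 2) r))))
      (trans (solve 3 (λ x x̄ r → (x :+ x̄ :+ # 2 :* r) :* x := x :* x :+ x :* x̄ :+ # 2 :* r :* x) refl x (conj x) (ι r))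
        (trans (cong (λ z → x ⊗ x ⊕ z ⊕ ι (+ 2) ⊗ ι r ⊗ x) (trans (x⊗conj x) (trans (cong ι N≡) (ι-* r r))))
          (solve 2 (λ x r → x :* x :+ r :* r :+ # 2 :* r :* x := (x :+ r) :* (x :+ r)) refl x (ι r))))
    -- Here (x + r)² = 0, hence x = -r, and -r · x = r² is already a square.
    degenerate : g ≡ + 0 → RationalSquareClass x
    degenerate e = - r , ι r , (λ e′ → r≢ (trans (sym (ℤP.neg-involutive r)) (cong -_ e′))) , eq
      where
      x+r≡𝟘 : norm (x ⊕ ι r) ≡ + 0
      x+r≡𝟘 = [ (λ e → e) , (λ e → e) ]′ (ℤP.i*j≡0⇒i≡0∨j≡0 (norm (x ⊕ ι r)) (trans (sym (norm-sq (x ⊕ ι r)))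
        (trans (cong norm (trans (sym g⊗x≡) (trans (cong (λ z → ι z ⊗ x) e) (zeroˡ x)))) norm-𝟘)))
      eq : ι (- r) ⊗ x ≡ sq (ι r)
      eq = trans (cong (_⊗ x) (ι-neg r))
        (trans (solve 2 (λ x r → (:- r) :* x := r :* r :+ :- (r :* (x :+ r))) refl x (ι r))
          (trans (cong (λ z → sq (ι r) ⊖ ι r ⊗ z) (anisotropic _ x+r≡𝟘))
            (trans (cong (λ z → sq (ι r) ⊖ z) (zeroʳ (ι r))) (solve 1 (λ x → x :+ :- # 0 := x) refl (sq (ι r))))))

  rationalSquareClass-sq : ∀ {x} B → RationalSquareClass x → RationalSquareClass (sq B ⊗ x)
  rationalSquareClass-sq {x} B (g , γ , g≢ , eq) = g , B ⊗ γ , g≢ ,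
    trans (solve 3 (λ g b x → g :* (b :* b :* x) := b :* b :* (g :* x)) refl (ι g) B x)
      (trans (cong (sq B ⊗_) eq) (solve 2 (λ b c → b :* b :* (c :* c) := (b :* c) :* (b :* c)) refl B γ))

  -- The square factor A² is removed by multiplying with the square of the conjugate of A, which
  -- turns it into the rational integer N(A)².
  rationalSquareClass-cancel : ∀ {x y} f A → f ≢ + 0 → A ≢ 𝟘 → ι f ⊗ x ⊗ sq A ≡ y →
    RationalSquareClass y → RationalSquareClass x
  rationalSquareClass-cancel {x} {y} f A f≢ A≢ eq (g , γ , g≢ , gy≡) =
    g * f * norm A ² , γ ⊗ conj A , *-≢0 (*-≢0 g≢ f≢) (²-≢0 (norm≢0 A≢)) ,
    trans (cong (_⊗ x) (trans (ι-* (g * f) (norm A ²)) (cong₂ _⊗_ (ι-* g f) (trans (ι-* (norm A) (norm A))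
        (cong sq (sym (x⊗conj A)))))))
      (trans (solve 5 (λ g f a ā x → g :* f :* ((a :* ā) :* (a :* ā)) :* x := g :* (f :* x :* (a :* a)) :* (ā :* ā))
          refl (ι g) (ι f) A (conj A) x)
        (trans (cong (λ z → z ⊗ sq (conj A)) (trans (cong (ι g ⊗_) eq) gy≡))
          (solve 2 (λ b c → b :* b :* (c :* c) := (b :* c) :* (b :* c)) refl γ (conj A))))

  rationalSquareClass-𝟘 : RationalSquareClass 𝟘
  rationalSquareClass-𝟘 = + 1 , 𝟘 , (λ ()) , trans (*-identityˡ 𝟘) (sym (zeroˡ 𝟘))

  ι-scaling : ∀ n o d δ → n ¹² * d ≡ o ¹² * δ → pow12 (ι n) ⊗ ι d ≡ pow12 (ι o) ⊗ ι δ
  ι-scaling n o d δ eq = begin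
    pow12 (ι n) ⊗ ι d  ≡⟨ cong (_⊗ ι d) (sym (ι-pow12 n)) ⟩
    ι (n ¹²) ⊗ ι d     ≡⟨ sym (ι-* (n ¹²) d) ⟩
    ι (n ¹² * d)       ≡⟨ cong ι eq ⟩
    ι (o ¹² * δ)       ≡⟨ ι-* (o ¹²) δ ⟩
    ι (o ¹²) ⊗ ι δ     ≡⟨ cong (_⊗ ι δ) (ι-pow12 o) ⟩
    pow12 (ι o) ⊗ ι δ  ∎
    where open ≡-Reasoning

  -- At P, D is a unit times the twelfth power of o/n: this is how a change of variables with u =
  -- o/n acts on a discriminant. The denominator n is a rational integer and so is unaffected by
  -- conjugation.
  record ScaledUnit (D : Order) (P : Order → Set) : Set where
    field
      n : ℤ
      o δ : Order
      n≢0 : n ≢ + 0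
      scaling : pow12 (ι n) ⊗ D ≡ pow12 o ⊗ δ
      δ∉P : ¬ P δ

    o≢𝟘 : D ≢ 𝟘 → o ≢ 𝟘
    o≢𝟘 D≢ o≡𝟘 = ⊗-≢𝟘 (pow12-≢𝟘 (ι-≢𝟘 n≢0)) D≢ (trans scaling (trans (cong (λ z → pow12 z ⊗ δ) o≡𝟘)
      (solve 1 (λ δ → pow12′ (# 0) :* δ := # 0) refl δ)))

    norm-scaling : (n ²) ¹² * norm D ≡ norm o ¹² * norm δ
    norm-scaling = trans (cong (_* norm D) (trans (cong _¹² (sym (norm-ι n))) (sym (norm-pow12 (ι n)))))
      (trans (sym (norm-⊗ (pow12 (ι n)) D)) (trans (cong norm scaling)
        (trans (norm-⊗ (pow12 o) δ) (cong (_* norm δ) (norm-pow12 o)))))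

  module NormOfDiscriminant (D : Order) (D≢ : D ≢ 𝟘)
    (unit : ∀ {P} → IsPrimeIdeal P → (∃ λ x → P x × x ≢ 𝟘) → ScaledUnit D P) where

    module _ {ℓ} (pr : Prime ℓ) {k w} (N≡ : norm D ≡ + (ℓ ℕ.^ k) * w) (w∤ : ¬ + ℓ ∣ w) where
      open PrimeAbove (primeAbove pr)
      open At pr (primeAbove pr)
      open ScaledUnit

      ℓ-nonzero : ι (+ ℓ) ≢ 𝟘
      ℓ-nonzero = ι-≢𝟘 ℓ≢0

      -- Comparing exponents of ℓ at P gives 12 v(N) + k = 12 v(o) + 0.
      12∣valuation : ∀ N {o δ} → N ≢ + 0 → ¬ P δ → pow12 (ι N) ⊗ ι (norm D) ≡ pow12 o ⊗ δ → ∃ (HasValuation o) → 12 ℕD.∣ k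
      12∣valuation N {o} {δ} N≢ δ∉ eq (i , v) = from-ι (ι-valuation N N≢)
        where
        from-ι : ∃ (HasValuation (ι N)) → 12 ℕD.∣ k
        from-ι (h , u) = ℕD.∣m+n∣m⇒∣n (ℕD.divides i (trans
            (valuation-unique (valuation-⊗ (valuation-pow12 u) (valuation-ι {norm D} {k} {w} N≡ w∤))
              (subst (λ z → HasValuation z (i ℕ.* 12 ℕ.+ 0)) (sym eq) (valuation-⊗ (valuation-pow12 v) (valuation-∉ δ∉))))
            (ℕP.+-identityʳ (i ℕ.* 12)))) (ℕD.divides h refl)

      at-P : ScaledUnit D P
      at-P = unit isPrimeIdeal (ι (+ ℓ) , ℓ∈P , ℓ-nonzero)

      at-P̄ : ScaledUnit D (Conj P)
      at-P̄ = unit (conj-isPrimeIdeal isPrimeIdeal) (ι (+ ℓ) , subst P (sym (conj-ι (+ ℓ))) ℓ∈P , ℓ-nonzero)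

      -- The model at P describes D there but not its conjugate D̄. Conjugating the scaled unit at
      -- P̄ describes D̄ at P, and the product displays N(D) = D D̄ as a twelfth power times a unit
      -- at P.
      12∣-unramified : Unramified ℓ P → 12 ℕD.∣ k
      12∣-unramified unram = 12∣valuation (n at-P * n at-P̄) (*-≢0 (n≢0 at-P) (n≢0 at-P̄)) (∉-⊗ (δ∉P at-P) (δ∉P at-P̄)) eq
        (unramified-valuation unram (o at-P ⊗ conj (o at-P̄)) (⊗-≢𝟘 (o≢𝟘 at-P D≢) (conj-≢𝟘 (o≢𝟘 at-P̄ D≢))))
        where
        conj-scaling : pow12 (ι (n at-P̄)) ⊗ conj D ≡ pow12 (conj (o at-P̄)) ⊗ conj (δ at-P̄)
        conj-scaling = trans (cong (_⊗ conj D) (trans (cong pow12 (sym (conj-ι (n at-P̄)))) (sym (conj-pow12 (ι (n at-P̄))))))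
          (trans (sym (conj-⊗ (pow12 (ι (n at-P̄))) D)) (trans (cong conj (scaling at-P̄))
            (trans (conj-⊗ (pow12 (o at-P̄)) (δ at-P̄)) (cong (_⊗ conj (δ at-P̄)) (conj-pow12 (o at-P̄))))))
        interchange : ∀ a b c d → a ⊗ b ⊗ (c ⊗ d) ≡ a ⊗ c ⊗ (b ⊗ d)
        interchange = solve 4 (λ a b c d → a :* b :* (c :* d) := a :* c :* (b :* d)) refl
        eq : pow12 (ι (n at-P * n at-P̄)) ⊗ ι (norm D) ≡ pow12 (o at-P ⊗ conj (o at-P̄)) ⊗ (δ at-P ⊗ conj (δ at-P̄))
        eq = trans (cong₂ _⊗_ (trans (cong pow12 (ι-* (n at-P) (n at-P̄))) (pow12-⊗ (ι (n at-P)) (ι (n at-P̄)))) (sym (x⊗conj D)))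
          (trans (interchange (pow12 (ι (n at-P))) (pow12 (ι (n at-P̄))) D (conj D)) (trans (cong₂ _⊗_ (scaling at-P) conj-scaling)
            (trans (interchange (pow12 (o at-P)) (δ at-P) (pow12 (conj (o at-P̄))) (conj (δ at-P̄)))
              (cong (_⊗ (δ at-P ⊗ conj (δ at-P̄))) (sym (pow12-⊗ (o at-P) (conj (o at-P̄))))))))

      -- As P equals its conjugate, norms of elements outside P stay outside P. Taking norms in the
      -- scaled unit leaves only rational integers, which have a valuation although P is ramified,
      -- while o itself may have none.
      12∣-ramified : Ramified ℓ P → 12 ℕD.∣ k
      12∣-ramified (conj∈ , _) = 12∣valuation (n at-P ²) {ι (norm (o at-P))} {ι (norm (δ at-P))} (²-≢0 (n≢0 at-P)) norm-δ∉
          (ι-scaling (n at-P ²) (norm (o at-P)) (norm D) (norm (δ at-P)) (norm-scaling at-P))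
          (ι-valuation (norm (o at-P)) (norm≢0 (o≢𝟘 at-P D≢)))
        where
        norm-δ∉ : ¬ P (ι (norm (δ at-P)))
        norm-δ∉ = subst (λ z → ¬ P z) (x⊗conj (δ at-P))
          (∉-⊗ (δ∉P at-P) (λ δ̄∈ → δ∉P at-P (subst P (conj-involutive (δ at-P)) (conj∈ _ δ̄∈))))

      12∣exponent : 12 ℕD.∣ k
      12∣exponent = [ 12∣-unramified , 12∣-ramified ]′ ramification

    abs-norm-12th-power : ∃ λ R → ∣ norm D ∣ ≡ R ℕ.^ 12
    abs-norm-12th-power = valuation-induction (λ _ k → 12 ℕD.∣ k) (λ _ → 12 ℕD.∣0) (λ n → ∃ λ R → n ≡ R ℕ.^ 12) (1 , refl)
      (λ { {ℓ} _ (ℕD.divides q refl) (R , refl) → ℓ ℕ.^ q ℕ.* R ,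
             trans (cong (ℕ._* R ℕ.^ 12) (sym (ℕP.^-*-assoc ℓ q 12))) (sym (*-distrib-^ (ℓ ℕ.^ q) R 12)) })
      ∣ norm D ∣ {{ℤ.≢-nonZero (norm≢0 D≢)}}
      (λ ℓ k w pr eq ∤ → let w′ , eq′ , ∤′ = signed-factor (norm D) k w eq ∤ in 12∣exponent pr {k} {w′} eq′ ∤′)

    -- The sign is decided by -R¹² = -(R⁶)², which cannot be a norm when R ≠ 0.
    norm-12th-power : (∀ x t → norm x ≡ - (t ²) → t ≡ + 0) → ∃ λ R → R ≢ + 0 × norm D ≡ R ¹²
    norm-12th-power not-neg-square = + R , R≢0 , [ (λ e → trans e (pos-¹² R)) ,
        (λ e → ⊥-elim (impossible (trans e (cong -_ (pos-¹² R))))) ]′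
                                       (abs-cases (norm D) (proj₂ abs-norm-12th-power))
      where
      R : ℕ
      R = proj₁ abs-norm-12th-power
      R≢0 : + R ≢ + 0
      R≢0 e = norm≢0 D≢ (ℤP.∣i∣≡0⇒i≡0 (trans (proj₂ abs-norm-12th-power) (cong (ℕ._^ 12) (ℤP.+-injective e))))
      impossible : norm D ≡ - ((+ R) ¹²) → ⊥
      impossible e = ⁶-≢0 R≢0 (not-neg-square D ((+ R) ⁶) e)

  cube : Order → Order
  cube x = x ⊗ x ⊗ x

  record Equation : Set where
    constructor equation
    field
      a1 a2 a3 a4 a6 : Order
    c₄ c₆ D : Order
    c₄ = c4 a1 a2 a3 a4 a6
    c₆ = c6 a1 a2 a3 a4 a6
    D  = Δ a1 a2 a3 a4 a6

  -- J₁/J₂ is the j-invariant and Δ₀ the discriminant of the given curve, scaled into the order by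
  -- a twelfth power.
  record GoodModel (Δ₀ : Order) (J₁ J₂ : ℤ) (P : Order → Set) : Set where
    field
      E : Equation
    open Equation E public
    field
      scaled : ScaledUnit Δ₀ P
      δ≡D : ScaledUnit.δ scaled ≡ D
      j-relation : ι J₂ ⊗ cube c₄ ≡ ι J₁ ⊗ D
    open ScaledUnit scaled public hiding (δ)

    D∉P : ¬ P D
    D∉P = subst (λ z → ¬ P z) δ≡D δ∉P

    scaling-D : pow12 (ι n) ⊗ Δ₀ ≡ pow12 o ⊗ D
    scaling-D = trans scaling (cong (pow12 o ⊗_) δ≡D)

    c₆-relation : ι J₂ ⊗ sq c₆ ≡ ι (J₁ - + 1728 * J₂) ⊗ D
    c₆-relation = begin
      ι J₂ ⊗ sq c₆
        ≡⟨ solve 3 (λ j c c′ → j :* (c′ :* c′) := j :* (c :* c :* c) :+ :- (j :* (c :* c :* c :+ :- (c′ :* c′)))) refl (ι J₂) c₄ c₆ ⟩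
      ι J₂ ⊗ cube c₄ ⊖ ι J₂ ⊗ (cube c₄ ⊖ sq c₆)
        ≡⟨ cong₂ (λ x y → x ⊖ ι J₂ ⊗ y) j-relation (c4³-c6²≡1728Δ a1 a2 a3 a4 a6) ⟩
      ι J₁ ⊗ D ⊖ ι J₂ ⊗ (ι (+ 1728) ⊗ D)
        ≡⟨ solve 3 (λ j₁ j₂ d → j₁ :* d :+ :- (j₂ :* (# 1728 :* d)) := (j₁ :+ :- (# 1728 :* j₂)) :* d) refl (ι J₁) (ι J₂) D ⟩
      (ι J₁ ⊖ ι (+ 1728) ⊗ ι J₂) ⊗ D
        ≡⟨ cong (λ z → (ι J₁ ⊖ z) ⊗ D) (sym (ι-* (+ 1728) J₂)) ⟩
      (ι J₁ ⊖ ι (+ 1728 * J₂)) ⊗ D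
        ≡⟨ cong (λ z → (ι J₁ ⊕ z) ⊗ D) (sym (ι-neg (+ 1728 * J₂))) ⟩
      (ι J₁ ⊕ ι (- (+ 1728 * J₂))) ⊗ D
        ≡⟨ cong (_⊗ D) (sym (ι-+ J₁ (- (+ 1728 * J₂)))) ⟩
      ι (J₁ - + 1728 * J₂) ⊗ D ∎
      where open ≡-Reasoning

    j-norm : J₂ ² * (norm c₄ * norm c₄ * norm c₄) ≡ J₁ ² * norm D
    j-norm = trans (cong₂ _*_ (sym (norm-ι J₂)) (trans (cong (_* norm c₄) (sym (norm-⊗ c₄ c₄))) (sym (norm-⊗ (sq c₄) c₄))))
      (trans (sym (norm-⊗ (ι J₂) (cube c₄))) (trans (cong norm j-relation) (trans (norm-⊗ (ι J₁) D) (cong (_* norm D) (norm-ι J₁)))))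

    norm-scaling-D : (n ²) ¹² * norm Δ₀ ≡ norm o ¹² * norm D
    norm-scaling-D = trans norm-scaling (cong (λ z → norm o ¹² * norm z) δ≡D)

  record ModelSystem (J₁ J₂ : ℤ) : Set₁ where
    field
      Δ₀ : Order
      Δ₀≢𝟘 : Δ₀ ≢ 𝟘
      model : ∀ {P} → IsPrimeIdeal P → (∃ λ x → P x × x ≢ 𝟘) → GoodModel Δ₀ J₁ J₂ P

-- The ring ℤ and identities between twelfth powers

module IntegerRing where
  open import Data.Integer using (_+_; _*_; -_; _-_)
  ℤ-algebra : ℤAlgebra
  ℤ-algebra = record
    { isCommutativeRing = ℤP.+-*-isCommutativeRing ; ι = λ z → z ; ι-+ = λ _ _ → refl ; ι-* = λ _ _ → refl
    ; ι-neg = λ _ → refl ; ι-0 = refl ; ι-1 = refl }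

  open Identities ℤ-algebra public using (solve; _:+_; _:*_; :-_; con; #_; _:=_)

module PowerIdentities (R : ℤAlgebra) where
  open ℤAlgebra R
  open Identities R

  -- With j = J₁/J₂ the first hypothesis says j² = N³/D, and by the second D is a ratio of twelfth
  -- powers. So j² is a cube, and hence so is j = j³/j²; `α` and `β` are numerator and denominator
  -- of the cube root.
  cube-ratio : ∀ N o J₁ J₂ m r D → sq J₂ ⊗ (N ⊗ N ⊗ N) ≡ sq J₁ ⊗ D → pow12 m ⊗ pow12 r ≡ pow12 o ⊗ D →
    let β = J₂ ⊗ (N ⊗ pow4 o) ; α = J₁ ⊗ pow4 (m ⊗ r) in J₁ ⊗ (β ⊗ β ⊗ β) ≡ J₂ ⊗ (α ⊗ α ⊗ α)
  cube-ratio N o J₁ J₂ m r D eq eq′ = begin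
    J₁ ⊗ (β ⊗ β ⊗ β)
      ≡⟨ solve 4 (λ N o J₁ J₂ → let β = J₂ :* (N :* pow4′ o) in J₁ :* (β :* β :* β) := J₁ :* J₂ :* (pow12′ o :* (sq′ J₂ :* (N :* N :* N)))) refl N o J₁ J₂ ⟩
    J₁ ⊗ J₂ ⊗ (pow12 o ⊗ (sq J₂ ⊗ (N ⊗ N ⊗ N)))
      ≡⟨ cong (λ z → J₁ ⊗ J₂ ⊗ (pow12 o ⊗ z)) eq ⟩
    J₁ ⊗ J₂ ⊗ (pow12 o ⊗ (sq J₁ ⊗ D))
      ≡⟨ solve 5 (λ x y z w d → x :* y :* (z :* (w :* d)) := x :* y :* (w :* (z :* d))) refl J₁ J₂ (pow12 o) (sq J₁) D ⟩
    J₁ ⊗ J₂ ⊗ (sq J₁ ⊗ (pow12 o ⊗ D))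
      ≡⟨ cong (λ z → J₁ ⊗ J₂ ⊗ (sq J₁ ⊗ z)) (sym eq′) ⟩
    J₁ ⊗ J₂ ⊗ (sq J₁ ⊗ (pow12 m ⊗ pow12 r))
      ≡⟨ solve 4 (λ J₁ J₂ m r → let α = J₁ :* pow4′ (m :* r) in J₁ :* J₂ :* (sq′ J₁ :* (pow12′ m :* pow12′ r)) := J₂ :* (α :* α :* α)) refl J₁ J₂ m r ⟩
    J₂ ⊗ (α ⊗ α ⊗ α) ∎
    where
    open ≡-Reasoning
    β = J₂ ⊗ (N ⊗ pow4 o)
    α = J₁ ⊗ pow4 (m ⊗ r)

  scaled-square : ∀ p m n r → sq (⊝ (p ⊗ sq m)) ⊗ (pow12 (sq n) ⊗ pow12 r) ≡ sq (p ⊗ sq (m ⊗ pow6 n ⊗ (sq r ⊗ r)))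
  scaled-square = solve 4 (λ p m n r → sq′ (:- (p :* sq′ m)) :* (pow12′ (sq′ n) :* pow12′ r)
      := sq′ (p :* sq′ (m :* pow6′ n :* (sq′ r :* r)))) refl

-- Residues modulo 8 and square classes of integers

module Residues where
  open import Data.Nat.DivMod using (_/_; m/n*n≡m)
  open import Data.Nat.GCD using (gcd; gcd[m,n]∣m; gcd[m,n]∣n; gcd[m,n]≢0)
  open import Data.Integer using (_+_; _*_; -_; _-_)
  open import Data.Integer.Divisibility.Signed
  open NaturalValuations
  open IntegerLemmas
  open IntegerRing

  open PowerIdentities ℤ-algebra using () renaming (cube-ratio to ℤ-cube-ratio; scaled-square to ℤ-scaled-square) public

  parity-clash : ∀ {x y} → (∃ λ k → x ≡ + 2 * k) → x ≡ y → Odd y → ⊥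
  parity-clash (k , e) x≡y o = ¬even-and-odd {k = k} (trans (sym x≡y) e) o

  odd-neg : ∀ {x} → Odd x → Odd (- x)
  odd-neg (k , refl) = - + 1 - k , solve 1 (λ k → :- (# 1 :+ # 2 :* k) := # 1 :+ # 2 :* (:- # 1 :+ :- k)) refl k

  odd-+ : ∀ {u v} → Odd u → Odd v → ∃ λ k → u + v ≡ + 2 * k
  odd-+ (i , refl) (k , refl) = + 1 + i + k , solve 2 (λ i k → # 1 :+ # 2 :* i :+ (# 1 :+ # 2 :* k) := # 2 :* (# 1 :+ i :+ k)) refl i k

  odd+even : ∀ {u v} → Odd u → (∃ λ k → v ≡ + 2 * k) → Odd (u + v)
  odd+even (i , refl) (k , refl) = i + k , solve 2 (λ i k → # 1 :+ # 2 :* i :+ # 2 :* k := # 1 :+ # 2 :* (i :+ k)) refl i k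

  even+odd : ∀ {u v} → (∃ λ k → u ≡ + 2 * k) → Odd v → Odd (u + v)
  even+odd {u} {v} e o = subst Odd (ℤP.+-comm v u) (odd+even o e)

  even-* : ∀ {u} v → (∃ λ k → u ≡ + 2 * k) → ∃ λ k → u * v ≡ + 2 * k
  even-* v (k , e) = k * v , trans (cong (_* v) e) (ℤP.*-assoc (+ 2) k v)

  *-even : ∀ u {v} → (∃ λ k → v ≡ + 2 * k) → ∃ λ k → u * v ≡ + 2 * k
  *-even u {v} e = let k , e′ = even-* u e in k , trans (ℤP.*-comm u v) e′

  ≡_[8] : ℤ → ℤ → Set
  ≡_[8] r z = ∃ λ q → z ≡ r + + 8 * q

  -- The subgroup {1, 3} of the units modulo 8, which is the kernel of the character (-2/·). It
  -- contains the odd squares, 3 and p, but neither 5 nor -1.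
  OneOrThree : ℤ → Set
  OneOrThree z = ≡ + 1 [8] z ⊎ ≡ + 3 [8] z

  oneOrThree-* : ∀ {x y} → OneOrThree x → OneOrThree y → OneOrThree (x * y)
  oneOrThree-* (inj₁ (q , refl)) (inj₁ (r , refl)) = inj₁ (q + r + + 8 * (q * r) ,
    solve 2 (λ q r → (# 1 :+ # 8 :* q) :* (# 1 :+ # 8 :* r) := # 1 :+ # 8 :* (q :+ r :+ # 8 :* (q :* r))) refl q r)
  oneOrThree-* (inj₁ (q , refl)) (inj₂ (r , refl)) = inj₂ (+ 3 * q + r + + 8 * (q * r) ,
    solve 2 (λ q r → (# 1 :+ # 8 :* q) :* (# 3 :+ # 8 :* r) := # 3 :+ # 8 :* (# 3 :* q :+ r :+ # 8 :* (q :* r))) refl q r)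
  oneOrThree-* (inj₂ (q , refl)) (inj₁ (r , refl)) = inj₂ (q + + 3 * r + + 8 * (q * r) ,
    solve 2 (λ q r → (# 3 :+ # 8 :* q) :* (# 1 :+ # 8 :* r) := # 3 :+ # 8 :* (q :+ # 3 :* r :+ # 8 :* (q :* r))) refl q r)
  oneOrThree-* (inj₂ (q , refl)) (inj₂ (r , refl)) = inj₁ (+ 1 + + 3 * q + + 3 * r + + 8 * (q * r) ,
    solve 2 (λ q r → (# 3 :+ # 8 :* q) :* (# 3 :+ # 8 :* r) := # 1 :+ # 8 :* (# 1 :+ # 3 :* q :+ # 3 :* r :+ # 8 :*
        (q :* r))) refl q r)

  oneOrThree-^ : ∀ {n} → OneOrThree (+ n) → ∀ k → OneOrThree (+ (n ℕ.^ k))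
  oneOrThree-^ o zero = inj₁ (+ 0 , refl)
  oneOrThree-^ {n} o (suc k) = subst OneOrThree (sym (ℤP.pos-* n (n ℕ.^ k))) (oneOrThree-* o (oneOrThree-^ o k))

  distinct-residues : ∀ r s {z} {∤ : False (8 ℕD.∣? ∣ r - s ∣)} → ≡ r [8] z → ≡ s [8] z → ⊥
  distinct-residues r s {z} {∤} (q , e) (q′ , e′) = toWitnessFalse ∤ (∣⇒∣ᵤ {+ 8} {r - s} (divides (q′ - q)
    (trans (solve 4 (λ r s q q′ → r :+ :- s := (r :+ # 8 :* q) :+ :- (s :+ # 8 :* q′) :+ (q′ :+ :- q) :* # 8) refl r s q q′)
      (trans (cong₂ (λ x y → x - y + (q′ - q) * + 8) (sym e) (sym e′))
          (trans (cong (λ w → w + (q′ - q) * + 8) (ℤP.+-inverseʳ z)) (ℤP.+-identityˡ _))))))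

  5mod8⇒odd : ∀ {z} → ≡ + 5 [8] z → Odd z
  5mod8⇒odd (q , e) = + 2 + + 4 * q , trans e
    (solve 1 (λ q → # 5 :+ # 8 :* q := # 1 :+ # 2 :* (# 2 :+ # 4 :* q)) refl q)

  even-abs : ∀ {z k} → z ≡ + 2 * k → 2 ℕD.∣ ∣ z ∣
  even-abs {z} {k} e = ∣⇒∣ᵤ {+ 2} {z} (divides k (trans e (ℤP.*-comm (+ 2) k)))

  odd-prime-power : ∀ {ℓ} → Prime ℓ → ℓ ≢ 2 → ∀ k → Odd (+ (ℓ ℕ.^ k))
  odd-prime-power {ℓ} pr ℓ≢2 k with even-or-odd (+ (ℓ ℕ.^ k))
  ... | inj₂ o = o
  ... | inj₁ (j , e) = ⊥-elim (ℓ≢2 (sym (prime∣prime prime[2] pr (prime∣power prime[2] ℓ k (even-abs {+ (ℓ ℕ.^ k)} {j} e)))))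

  even-power : ∀ {ℓ} → Prime ℓ → ℓ ≢ 2 → ∀ {k} → 2 ℕD.∣ k → OneOrThree (+ (ℓ ℕ.^ k))
  even-power {ℓ} pr ℓ≢2 (ℕD.divides j refl) = inj₁ (proj₁ o , trans (trans (cong +_ square) (ℤP.pos-* (ℓ ℕ.^ j) (ℓ ℕ.^ j))) (proj₂ o))
    where
    square : ℓ ℕ.^ (j ℕ.* 2) ≡ ℓ ℕ.^ j ℕ.* ℓ ℕ.^ j
    square = trans (sym (ℕP.^-*-assoc ℓ j 2)) (cong (ℓ ℕ.^ j ℕ.*_) (ℕP.*-identityʳ (ℓ ℕ.^ j)))
    o = odd-² (odd-prime-power pr ℓ≢2 j)

  no-factor-2 : ∀ {n} k w → Odd (+ n) → n ≡ 2 ℕ.^ k ℕ.* w → k ≡ 0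
  no-factor-2 zero w o e = refl
  no-factor-2 {n} (suc k) w o e = ⊥-elim (¬even-and-odd {+ n} {+ (2 ℕ.^ k ℕ.* w)}
    (trans (cong +_ (trans e (ℕP.*-assoc 2 (2 ℕ.^ k) w))) (ℤP.pos-* 2 (2 ℕ.^ k ℕ.* w))) o)

  reduce-fraction : ∀ α β → α ≢ + 0 → ∃₂ λ a b → ∃ λ d → α ≡ + d * a × β ≡ + d * b × Coprimality.Coprime ∣ a ∣ ∣ b ∣
  reduce-fraction α β α≢ = proj₁ α′ , proj₁ β′ , g , proj₁ (proj₂ α′) , proj₁ (proj₂ β′) ,
      subst₂ Coprimality.Coprime (sym (proj₂ (proj₂ α′))) (sym (proj₂ (proj₂ β′))) (Coprimality.coprime-/gcd ∣ α ∣ ∣ β ∣)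
    where
    g : ℕ
    g = gcd ∣ α ∣ ∣ β ∣
    instance
      g-nonZero : ℕ.NonZero g
      g-nonZero = ℕ.≢-nonZero (gcd[m,n]≢0 ∣ α ∣ ∣ β ∣ (inj₁ (λ e → α≢ (ℤP.∣i∣≡0⇒i≡0 e))))
    signed : ∀ z q → ∣ z ∣ ≡ q ℕ.* g → ∃ λ a → z ≡ + g * a × ∣ a ∣ ≡ q
    signed z q e = [ (λ e′ → + q , trans e′ q*g≡ , refl)
                   , (λ e′ → - + q , trans e′ (trans (cong -_ q*g≡) (ℤP.neg-distribʳ-* (+ g) (+ q))) , ℤP.∣-i∣≡∣i∣
                       (+ q)) ]′ (abs-cases z e)
      where
      q*g≡ : + (q ℕ.* g) ≡ + g * + q
      q*g≡ = trans (cong +_ (ℕP.*-comm q g)) (ℤP.pos-* g q)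
    α′ = signed α (∣ α ∣ / g) (sym (m/n*n≡m (gcd[m,n]∣m ∣ α ∣ ∣ β ∣)))
    β′ = signed β (∣ β ∣ / g) (sym (m/n*n≡m (gcd[m,n]∣n ∣ α ∣ ∣ β ∣)))

  coprime⇒no-common-prime : ∀ {ℓ a b} → Prime ℓ → Coprimality.Coprime ∣ a ∣ ∣ b ∣ → + ℓ ∣ a → + ℓ ∣ b → ⊥
  coprime⇒no-common-prime pr c d e = prime∤1 pr (∣ᵤ⇒∣ (ℕD.∣-reflexive (c (∣⇒∣ᵤ d , ∣⇒∣ᵤ e))))

  cofactor : ℤ → ℤ → ℤ
  cofactor a b = a * a + + 12 * (a * b) + + 144 * (b * b)

  -- Completing the square gives (a + 6b)² + 108 b². The sign matters, because -1 is neither 1 nor 3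
  -- modulo 8.
  cofactor-positive : ∀ a b → ∃ λ n → cofactor a b ≡ + n
  cofactor-positive a b = ∣ u ∣ ℕ.* ∣ u ∣ ℕ.+ 108 ℕ.* (∣ b ∣ ℕ.* ∣ b ∣) ,
    trans (solve 2 (λ a b → a :* a :+ # 12 :* (a :* b) :+ # 144 :* (b :* b) := (a :+ # 6 :* b) :* (a :+ # 6 :* b)
        :+ # 108 :* (b :* b)) refl a b)
      (cong₂ _+_ (square-abs u) (trans (cong (+ 108 *_) (square-abs b)) (sym (ℤP.pos-* 108 (∣ b ∣ ℕ.* ∣ b ∣)))))
    where u = a + + 6 * b

  cofactor-mod-8 : ∀ {a b} → Odd a → Odd b → ≡ + 5 [8] (cofactor a b)
  cofactor-mod-8 {a} {b} oa ob with odd-² oa | odd-* oa ob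
  ... | k , e | j , e′ = + 1 + k + + 3 * j + + 18 * (b * b) ,
    trans (cong₂ (λ x y → x + + 12 * y + + 144 * (b * b)) e e′)
      (solve 3 (λ k j c → (# 1 :+ # 8 :* k) :+ # 12 :* (# 1 :+ # 2 :* j) :+ # 144 :* c
        := # 5 :+ # 8 :* (# 1 :+ k :+ # 3 :* j :+ # 18 :* c)) refl k j (b * b))

  -- The cofactor takes the value 432 b² at a = 12b. A prime that divides both factors of a³ - 1728
  -- b³ therefore divides 432 = 16 · 27 or b.
  ∣432⇒2or3 : ∀ {ℓ} → Prime ℓ → + ℓ ∣ + 432 → ℓ ≡ 2 ⊎ ℓ ≡ 3
  ∣432⇒2or3 {ℓ} pr d = [ (λ e → inj₁ (prime∣prime pr prime[2] (prime∣power pr 2 4 e))) ,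
      (λ e → inj₂ (prime∣prime pr prime[3] (prime∣power pr 3 3 e))) ]′
    (euclidsLemma 16 27 pr (∣⇒∣ᵤ d))
    where
    prime[3] : Prime 3
    prime[3] = toWitness {a? = prime? 3} _

  -- a³ − 1728 b³ = (a − 12b)(a² + 12ab + 144b²); the second factor is ≡ 5 mod 8, so it cannot be
  -- a square up to primes ≡ 3 mod 8.
  cofactor-valuations : ∀ {a b p} → Odd a → Odd b → Coprimality.Coprime ∣ a ∣ ∣ b ∣ → OneOrThree (+ p) →
    (∀ {ℓ} → Prime ℓ → ℓ ≢ 2 → ℓ ≢ p → ¬ + ℓ ∣ b → ¬ + ℓ ∣ a - + 12 * b →
       ∀ k w → cofactor a b ≡ + (ℓ ℕ.^ k) * w → ¬ + ℓ ∣ w → 2 ℕD.∣ k) → ⊥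
  cofactor-valuations {a} {b} {p} oa ob c p≡ even-at = contradiction
    (valuation-induction (λ ℓ k → OneOrThree (+ (ℓ ℕ.^ k))) (λ _ → inj₁ (+ 0 , refl)) (λ n → OneOrThree (+ n)) (inj₁ (+ 0 , refl))
       (λ {ℓ} {k} {w} _ x y → subst OneOrThree (sym (ℤP.pos-* (ℓ ℕ.^ k) w)) (oneOrThree-* x y))
       n {{ℤ.≢-nonZero (odd-≢0 odd-n)}} local)
    where
    n = proj₁ (cofactor-positive a b)
    Q≡n : cofactor a b ≡ + n
    Q≡n = proj₂ (cofactor-positive a b)
    n≡5 : ≡ + 5 [8] (+ n)
    n≡5 = subst (≡ + 5 [8]) Q≡n (cofactor-mod-8 oa ob)
    odd-n : Odd (+ n)
    odd-n = 5mod8⇒odd n≡5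
    contradiction : OneOrThree (+ n) → ⊥
    contradiction (inj₁ e) = distinct-residues (+ 5) (+ 1) n≡5 e
    contradiction (inj₂ e) = distinct-residues (+ 5) (+ 3) n≡5 e
    local : ∀ ℓ k w → Prime ℓ → n ≡ ℓ ℕ.^ k ℕ.* w → ¬ ℓ ℕD.∣ w → OneOrThree (+ (ℓ ℕ.^ k))
    local ℓ zero w pr e ∤ = inj₁ (+ 0 , refl)
    local ℓ k@(suc k′) w pr e ∤ with ℓ ℕ.≟ 2 | ℓ ℕ.≟ 3 | ℓ ℕ.≟ p
    ... | yes refl | _ | _ = ⊥-elim (ℕP.1+n≢0 (no-factor-2 k w odd-n e))
    ... | no _ | yes refl | _ = oneOrThree-^ (inj₂ (+ 0 , refl)) k
    ... | no _ | no _ | yes refl = oneOrThree-^ p≡ k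
    ... | no ℓ≢2 | no ℓ≢3 | no ℓ≢p = even-power pr ℓ≢2 {k} (even-at pr ℓ≢2 ℓ≢p ℓ∤b ℓ∤a-12b k (+ w)
            (trans Q≡n (trans (cong +_ e) (ℤP.pos-* (ℓ ℕ.^ k) w))) (λ d → ∤ (∣⇒∣ᵤ d)))
      where
      ℓ∣Q : + ℓ ∣ cofactor a b
      ℓ∣Q = subst (+ ℓ ∣_) (sym Q≡n) (∣ᵤ⇒∣ (subst (ℓ ℕD.∣_) (sym e) (ℕD.∣m⇒∣m*n w (ℕD.m∣m*n (ℓ ℕ.^ k′)))))
      ℓ∤b : ¬ + ℓ ∣ b
      ℓ∤b d = coprime⇒no-common-prime {ℓ} {a} {b} pr c (euclid-square pr a
        (∣m+n∣n⇒∣m (∣m+n∣n⇒∣m ℓ∣Q (∣n⇒∣m*n (+ 144) (∣n⇒∣m*n b d))) (∣n⇒∣m*n (+ 12) (∣n⇒∣m*n a d)))) d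
      ℓ∤a-12b : ¬ + ℓ ∣ a - + 12 * b
      ℓ∤a-12b d = [ (λ x → [ ℓ≢2 , ℓ≢3 ]′ (∣432⇒2or3 pr x)) , (λ x → [ ℓ∤b , ℓ∤b ]′ (euclid pr b b x)) ]′ (euclid pr (+ 432) (b * b)
        (∣m+n∣n⇒∣m (subst (+ ℓ ∣_) (solve 2 (λ a b → a :* a :+ # 12 :* (a :* b) :+ # 144 :* (b :* b) :=
            # 432 :* (b :* b) :+ (a :+ :- (# 12 :* b)) :* (a :+ # 24 :* b)) refl a b) ℓ∣Q) (∣m⇒∣m*n (a + + 24 * b) d)))

  odd-of-cube : ∀ {j j′ x y} → j * (x * x * x) ≡ j′ * (y * y * y) → Odd y → Odd j′ → Odd x
  odd-of-cube {j} {j′} {x} {y} e oy oj′ = odd-*⁻ʳ (x * x) x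
      (odd-*⁻ʳ j (x * x * x) (subst Odd (sym e) (odd-* oj′ (odd-* (odd-* oy oy) oy))))

  -- In lowest terms at least one of a and b is odd. Since J₁ and J₂ are odd, the cubic equation
  -- passes oddness from one to the other.
  odd-cube-ratio : ∀ {J₁ J₂} α β → Odd J₁ → Odd J₂ → α ≢ + 0 → J₁ * (β * β * β) ≡ J₂ * (α * α * α) →
    ∃₂ λ a b → Odd a × Odd b × Coprimality.Coprime ∣ a ∣ ∣ b ∣ × J₁ * (b * b * b) ≡ J₂ * (a * a * a)
  odd-cube-ratio {J₁} {J₂} α β o₁ o₂ α≢0 eq = reduce (reduce-fraction α β α≢0)
    where
    pull : ∀ j b d → d * d * d * (j * (b * b * b)) ≡ j * (d * b * (d * b) * (d * b))
    pull = solve 3 (λ j b d → d :* d :* d :* (j :* (b :* b :* b)) := j :* (d :* b :* (d :* b) :* (d :* b))) refl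
    reduce : (∃₂ λ a b → ∃ λ d → α ≡ + d * a × β ≡ + d * b × Coprimality.Coprime ∣ a ∣ ∣ b ∣) →
      ∃₂ λ a b → Odd a × Odd b × Coprimality.Coprime ∣ a ∣ ∣ b ∣ × J₁ * (b * b * b) ≡ J₂ * (a * a * a)
    reduce (a , b , d , α≡ , β≡ , c) = a , b , proj₁ odds , proj₂ odds , c , reduced
      where
      d≢0 : + d ≢ + 0
      d≢0 e = α≢0 (trans α≡ (cong (_* a) e))
      reduced : J₁ * (b * b * b) ≡ J₂ * (a * a * a)
      reduced = *-cancelˡ (J₁ * (b * b * b)) (J₂ * (a * a * a)) (*-≢0 (*-≢0 d≢0 d≢0) d≢0)
        (trans (pull J₁ b (+ d)) (trans (cong (λ z → J₁ * (z * z * z)) (sym β≡))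
          (trans eq (trans (cong (λ z → J₂ * (z * z * z)) α≡) (sym (pull J₂ a (+ d)))))))
      even⇒2∣ : ∀ {z} → (∃ λ k → z ≡ + 2 * k) → + 2 ∣ z
      even⇒2∣ (k , e) = divides k (trans e (ℤP.*-comm (+ 2) k))
      odds : Odd a × Odd b
      odds = [ (λ ea → [ (λ eb → ⊥-elim (coprime⇒no-common-prime {2} {a} {b} prime[2] c (even⇒2∣ ea) (even⇒2∣ eb)))
                       , (λ ob → odd-of-cube {J₂} {J₁} {a} {b} (sym reduced) ob o₁ , ob) ]′ (even-or-odd b))
             , (λ oa → oa , odd-of-cube {J₁} {J₂} {b} {a} reduced oa o₂) ]′ (even-or-odd a)

  SquareUpTo : ℕ → ℕ → Set
  SquareUpTo p n = ∃ λ m → n ≡ m ℕ.* m ⊎ n ≡ p ℕ.* (m ℕ.* m)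

  squareUpTo-* : ∀ {p x y} → SquareUpTo p x → SquareUpTo p y → SquareUpTo p (x ℕ.* y)
  squareUpTo-* {p} (m , c) (n , c′) = by-class c c′
    where
    l₁ : ∀ m n → m ℕ.* m ℕ.* (n ℕ.* n) ≡ m ℕ.* n ℕ.* (m ℕ.* n)
    l₁ = ℕ-solve-∀
    l₂ : ∀ p m n → m ℕ.* m ℕ.* (p ℕ.* (n ℕ.* n)) ≡ p ℕ.* (m ℕ.* n ℕ.* (m ℕ.* n))
    l₂ = ℕ-solve-∀
    l₃ : ∀ p m n → p ℕ.* (m ℕ.* m) ℕ.* (n ℕ.* n) ≡ p ℕ.* (m ℕ.* n ℕ.* (m ℕ.* n))
    l₃ = ℕ-solve-∀
    l₄ : ∀ p m n → p ℕ.* (m ℕ.* m) ℕ.* (p ℕ.* (n ℕ.* n)) ≡ p ℕ.* (m ℕ.* n) ℕ.* (p ℕ.* (m ℕ.* n))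
    l₄ = ℕ-solve-∀
    by-class : ∀ {x y} → x ≡ m ℕ.* m ⊎ x ≡ p ℕ.* (m ℕ.* m) → y ≡ n ℕ.* n ⊎ y ≡ p ℕ.* (n ℕ.* n) → SquareUpTo p (x ℕ.* y)
    by-class (inj₁ refl) (inj₁ refl) = m ℕ.* n , inj₁ (l₁ m n)
    by-class (inj₁ refl) (inj₂ refl) = m ℕ.* n , inj₂ (l₂ p m n)
    by-class (inj₂ refl) (inj₁ refl) = m ℕ.* n , inj₂ (l₃ p m n)
    by-class (inj₂ refl) (inj₂ refl) = p ℕ.* (m ℕ.* n) , inj₁ (l₄ p m n)

  squareUpTo-power : ∀ p ℓ k → ℓ ≡ p ⊎ 2 ℕD.∣ k → SquareUpTo p (ℓ ℕ.^ k)
  squareUpTo-power p ℓ k (inj₂ (ℕD.divides j refl)) = ℓ ℕ.^ j , inj₁ (trans (sym (ℕP.^-*-assoc ℓ j 2))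
      (cong (ℓ ℕ.^ j ℕ.*_) (ℕP.*-identityʳ (ℓ ℕ.^ j))))
  squareUpTo-power p _ zero (inj₁ refl) = 1 , inj₁ refl
  squareUpTo-power p _ (suc k) (inj₁ refl) = squareUpTo-* {p} (1 , inj₂ (sym (ℕP.*-identityʳ p))) (squareUpTo-power p p k (inj₁ refl))

  even-valuations⇒squareUpTo : ∀ p z → z ≢ + 0 →
    (∀ {ℓ} → Prime ℓ → ℓ ≢ p → ∀ k w → z ≡ + (ℓ ℕ.^ k) * w → ¬ + ℓ ∣ w → 2 ℕD.∣ k) → SquareUpTo p ∣ z ∣
  even-valuations⇒squareUpTo p z z≢ even-at = valuation-induction (λ ℓ k → ℓ ≡ p ⊎ 2 ℕD.∣ k) (λ _ → inj₂ (2 ℕD.∣0))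
      (SquareUpTo p) (1 , inj₁ refl)
    (λ {ℓ} {k} _ good w → squareUpTo-* {p} (squareUpTo-power p ℓ k good) w) ∣ z ∣ {{ℤ.≢-nonZero z≢}} local
    where
    local : ∀ ℓ k w → Prime ℓ → ∣ z ∣ ≡ ℓ ℕ.^ k ℕ.* w → ¬ ℓ ℕD.∣ w → ℓ ≡ p ⊎ 2 ℕD.∣ k
    local ℓ k w pr eq ∤ with ℓ ℕ.≟ p
    ... | yes ℓ≡p = inj₁ ℓ≡p
    ... | no ℓ≢p = let w′ , eq′ , ∤′ = signed-factor z k w eq ∤ in inj₂ (even-at pr ℓ≢p k w′ eq′ ∤′)

  residue-* : ∀ r s {x y} → ≡ r [8] x → ≡ s [8] y → ≡ r * s [8] (x * y)
  residue-* r s (i , refl) (j , refl) = r * j + s * i + + 8 * (i * j) ,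
    solve 4 (λ r s i j → (r :+ # 8 :* i) :* (s :+ # 8 :* j) := r :* s :+ # 8 :* (r :* j :+ s :* i :+ # 8 :* (i :* j))) refl r s i j

  residue-neg : ∀ r {x} → ≡ r [8] x → ≡ - r [8] (- x)
  residue-neg r (i , refl) = - i , solve 2 (λ r i → :- (r :+ # 8 :* i) := :- r :+ # 8 :* (:- i)) refl r i

  -- For odd m the numbers m², -m², p m² and -p m² are 1, 7, 3 and 5 modulo 8, so the residue 5
  -- selects both the sign and the factor p.
  5mod8⇒neg-p-square : ∀ {p z} → ≡ + 5 [8] z → ≡ + 3 [8] (+ p) → SquareUpTo p ∣ z ∣ → ∃ λ m → m ≢ + 0 × z ≡ - (+ p * m ²)
  5mod8⇒neg-p-square {p} {z} z≡5 p≡3 (m , up) = + m , odd-≢0 odd-m , conclude up (abs-cases z refl)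
    where
    odd-z : Odd z
    odd-z = 5mod8⇒odd z≡5
    odd-abs : Odd (+ ∣ z ∣)
    odd-abs = [ (λ e → subst Odd e odd-z) , (λ e → subst Odd (trans (cong -_ e) (ℤP.neg-involutive (+ ∣ z ∣)))
        (odd-neg odd-z)) ]′ (abs-cases z refl)
    odd-m : Odd (+ m)
    odd-m = [ (λ e → odd-*⁻ˡ (+ m) (+ m) (subst Odd (trans (cong +_ e) (ℤP.pos-* m m)) odd-abs))
            , (λ e → odd-*⁻ˡ (+ m) (+ m) (odd-*⁻ʳ (+ p) (+ m * + m)
                (subst Odd (trans (cong +_ e) (trans (ℤP.pos-* p (m ℕ.* m)) (cong (+ p *_) (ℤP.pos-* m m)))) odd-abs)))
                ]′ up
    m²≡1 : ≡ + 1 [8] (+ (m ℕ.* m))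
    m²≡1 = subst (≡ + 1 [8]) (sym (ℤP.pos-* m m)) (odd-² odd-m)
    conclude : ∣ z ∣ ≡ m ℕ.* m ⊎ ∣ z ∣ ≡ p ℕ.* (m ℕ.* m) → z ≡ + ∣ z ∣ ⊎ z ≡ - + ∣ z ∣ → z ≡ - (+ p * (+ m) ²)
    conclude (inj₁ e) (inj₁ e′) = ⊥-elim (distinct-residues (+ 5) (+ 1) z≡5 (subst (≡ + 1 [8]) (sym (trans e′ (cong +_ e))) m²≡1))
    conclude (inj₁ e) (inj₂ e′) = ⊥-elim (distinct-residues (+ 5) (- + 1) z≡5
        (subst (≡ - + 1 [8]) (sym (trans e′ (cong (λ n → - + n) e))) (residue-neg (+ 1) m²≡1)))
    conclude (inj₂ e) (inj₁ e′) = ⊥-elim (distinct-residues (+ 5) (+ 3) z≡5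
        (subst (≡ + 3 [8]) (sym (trans e′ (trans (cong +_ e) (ℤP.pos-* p (m ℕ.* m)))))
        (residue-* (+ 3) (+ 1) p≡3 m²≡1)))
    conclude (inj₂ e) (inj₂ e′) = trans e′ (cong -_ (trans (cong +_ e) (trans (ℤP.pos-* p (m ℕ.* m)) (cong (+ p *_) (ℤP.pos-* m m)))))

  -- As u is odd, every factor 4 on the left must come from J². The induction halves J once for each
  -- of them.
  power-of-2-divides-root : ∀ k {M J u} → Odd u → (+ (2 ℕ.^ k)) ² * M ≡ J ² * u → ∃ λ J′ → J ≡ + (2 ℕ.^ k) * J′
  power-of-2-divides-root zero {M} {J} ou eq = J , sym (ℤP.*-identityˡ J)
  power-of-2-divides-root (suc k) {M} {J} {u} ou eq = [ halve ,
      (λ oj → ⊥-elim (¬even-and-odd {J ² * u} {+ 2 * (q ² * M)} even-side (odd-* (odd-* oj oj) ou))) ]′ (even-or-odd J)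
    where
    q = + (2 ℕ.^ k)
    split : + (2 ℕ.^ suc k) ≡ + 2 * q
    split = ℤP.pos-* 2 (2 ℕ.^ k)
    even-side : J ² * u ≡ + 2 * (+ 2 * (q ² * M))
    even-side = trans (sym eq) (trans (cong (λ z → z ² * M) split)
      (solve 2 (λ q m → # 2 :* q :* (# 2 :* q) :* m := # 2 :* (# 2 :* (q :* q :* m))) refl q M))
    halve : (∃ λ j → J ≡ + 2 * j) → ∃ λ J′ → J ≡ + (2 ℕ.^ suc k) * J′
    halve (j , J≡) = let J′ , j≡ = power-of-2-divides-root k {M} {j} {u} ou halved in
      J′ , trans J≡ (trans (cong (+ 2 *_) j≡) (trans (sym (ℤP.*-assoc (+ 2) q J′)) (cong (_* J′) (sym split))))
      where
      halved : q ² * M ≡ j ² * u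
      halved = *-cancelˡ {+ 4} (q ² * M) (j ² * u) (λ ()) (trans (solve 1 (λ x → # 4 :* x := # 2 :* (# 2 :* x)) refl (q ² * M))
        (trans (sym even-side) (trans (cong (λ z → z ² * u) J≡)
          (solve 2 (λ j u → # 2 :* j :* (# 2 :* j) :* u := # 4 :* (j :* j :* u)) refl j u))))

  signed-product : ∀ p t {x y} → x ≡ p ⊎ x ≡ - p → y ≡ p * t ² ⊎ y ≡ - (p * t ²) → x * y ≡ (p * t) ² ⊎ x * y ≡ - ((p * t) ²)
  signed-product p t (inj₁ refl) (inj₁ refl) = inj₁ (solve 2 (λ p t → p :* (p :* (t :* t)) := p :* t :* (p :* t)) refl p t)
  signed-product p t (inj₁ refl) (inj₂ refl) = inj₂ (solve 2 (λ p t → p :* (:- (p :* (t :* t))) := :- (p :* t :* (p :* t))) refl p t)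
  signed-product p t (inj₂ refl) (inj₁ refl) = inj₂ (solve 2 (λ p t → :- p :* (p :* (t :* t)) := :- (p :* t :* (p :* t))) refl p t)
  signed-product p t (inj₂ refl) (inj₂ refl) = inj₁ (solve 2 (λ p t → :- p :* (:- (p :* (t :* t))) := p :* t :* (p :* t)) refl p t)

  cofactor-relation : ∀ J₁ J₂ a b → J₁ * (b * b * b) ≡ J₂ * (a * a * a) →
    b * b * b * (J₁ - + 1728 * J₂) ≡ J₂ * (cofactor a b * (a - + 12 * b))
  cofactor-relation J₁ J₂ a b eq = trans
    (solve 3 (λ j j′ b³ → b³ :* (j :+ :- (# 1728 :* j′)) := j :* b³ :+ :- (# 1728 :* j′ :* b³)) refl J₁ J₂ (b * b * b))
    (trans (cong (λ z → z + - (+ 1728 * J₂ * (b * b * b))) eq)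
      (solve 3 (λ j a b → j :* (a :* a :* a) :+ :- (# 1728 :* j :* (b :* b :* b))
         := j :* ((a :* a :+ # 12 :* (a :* b) :+ # 144 :* (b :* b)) :* (a :+ :- (# 12 :* b)))) refl J₂ a b))

  cube-scaling : ∀ q j x → q * q * q * (j * (x * x * x)) ≡ j * (q * x * (q * x) * (q * x))
  cube-scaling = solve 3 (λ q j x → q :* q :* q :* (j :* (x :* x :* x)) := j :* (q :* x :* (q :* x) :* (q :* x))) refl

  -- For j = 2¹² x / y this is (j − 1728) y / 64.
  reduced : ℤ → ℤ → ℤ
  reduced x y = + 64 * x - + 27 * y

  64*reduced : ∀ x y → + 4096 * x - + 1728 * y ≡ + 64 * reduced x y
  64*reduced = solve 2 (λ x y → # 4096 :* x :+ :- (# 1728 :* y) := # 64 :* (# 64 :* x :+ :- (# 27 :* y))) refl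

  reduced-mod-8 : ∀ x {y} → Odd y → ≡ + 5 [8] (reduced x y * y)
  reduced-mod-8 x {y} o = from-square (odd-² o)
    where
    from-square : (∃ λ k → y ² ≡ + 1 + + 8 * k) → ≡ + 5 [8] (reduced x y * y)
    from-square (k , e) = + 8 * (x * y) - + 4 - + 27 * k ,
      trans (solve 2 (λ x y → (# 64 :* x :+ :- (# 27 :* y)) :* y := # 64 :* (x :* y) :+ :- (# 27 :* (y :* y))) refl x y)
        (trans (cong (λ z → + 64 * (x * y) - + 27 * z) e)
          (solve 2 (λ x k → # 64 :* x :+ :- (# 27 :* (# 1 :+ # 8 :* k))
             := # 5 :+ # 8 :* (# 8 :* x :+ :- # 4 :+ :- (# 27 :* k))) refl (x * y) k))

-- From a system of good models to a contradiction at 2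

module GlobalArgument
  (τ ν : ℤ)
  (anisotropic : ∀ x → QuadraticOrder.norm τ ν x ≡ + 0 → x ≡ + 0 QuadraticOrders.∔ + 0 ω)
  (not-neg-square : ∀ x t → QuadraticOrder.norm τ ν x ≡ ℤ.- (t ℤ.* t) → t ≡ + 0)
  (p : ℕ) (p≡3 : Residues.≡ + 3 [8] (+ p))
  (disc-primes : ∀ {ℓ} → Prime ℓ → + ℓ ℤD.∣ PrimeIdeals.disc τ ν → ℓ ≡ 2 ⊎ ℓ ≡ p)
  -- Stands for √p, of norm -p, or √-p, of norm p, so that one argument serves both fields.
  (s : QuadraticOrders.Order)
  (norm-s : QuadraticOrder.norm τ ν s ≡ + p ⊎ QuadraticOrder.norm τ ν s ≡ ℤ.- + p)
  where
  open import Data.Integer using (_+_; _*_; -_; _-_)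
  open import Data.Integer.Divisibility.Signed
  open NaturalValuations
  open IntegerLemmas
  open Residues
  open QuadraticOrder τ ν
  open PrimeIdeals τ ν
  open Valuations τ ν anisotropic
  open GoodModels τ ν anisotropic

  -- This leaves N(z) = ± p t² with t = r n⁶ R³. Multiplying z by s, whose norm is ± p, will then
  -- produce a norm that is ± a square.
  norm-of-square : ∀ z {x} S n r R → sq z ≡ ι S ⊗ (pow12 (ι n) ⊗ x) → norm x ≡ R ¹² → S ≡ - (+ p * r ²) →
    norm z ² ≡ (+ p * (r * n ⁶ * (R ² * R)) ²) ²
  norm-of-square z {x} S n r R z²≡ norm-x S≡ = begin
    norm z ²
      ≡⟨ sym (norm-sq z) ⟩
    norm (sq z)
      ≡⟨ cong norm z²≡ ⟩
    norm (ι S ⊗ (pow12 (ι n) ⊗ x))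
      ≡⟨ norm-⊗ (ι S) (pow12 (ι n) ⊗ x) ⟩
    norm (ι S) * norm (pow12 (ι n) ⊗ x)
      ≡⟨ cong₂ _*_ (norm-ι S) (norm-⊗ (pow12 (ι n)) x) ⟩
    S ² * (norm (pow12 (ι n)) * norm x)
      ≡⟨ cong₂ (λ u v → S ² * (u * v)) (trans (norm-pow12 (ι n)) (cong _¹² (norm-ι n))) norm-x ⟩
    S ² * ((n ²) ¹² * R ¹²)
      ≡⟨ cong (λ u → u ² * ((n ²) ¹² * R ¹²)) S≡ ⟩
    (- (+ p * r ²)) ² * ((n ²) ¹² * R ¹²)
      ≡⟨ ℤ-scaled-square (+ p) r n R ⟩
    (+ p * (r * n ⁶ * (R ² * R)) ²) ² ∎
    where open ≡-Reasoning

  -- The reduction behaviour at 2 of a model with discriminant prime to 2, according to whether a₁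
  -- has valuation 0, valuation strictly between 0 and that of 2, or is divisible by 2.
  data TwoAdicType (E : Equation) : Set where
    ordinary      : Odd (norm (Equation.c₄ E)) → Odd (norm (Equation.D E)) → TwoAdicType E
    intermediate  : ∀ C₄ → Equation.c₄ E ≡ ι (+ 4) ⊗ C₄ → ¬ RationalSquareClass C₄ → TwoAdicType E
    supersingular : ∀ X C₆ → Equation.c₄ E ≡ ι (+ 16) ⊗ X → Equation.c₆ E ≡ ι (+ 8) ⊗ C₆ →
                    ¬ RationalSquareClass (s ⊗ C₆) → Odd (norm (Equation.D E)) → TwoAdicType E

  module _ (Δ₀ : Order) (Δ₀≢ : Δ₀ ≢ 𝟘) (J₁ J₂ : ℤ) (J₂≢ : J₂ ≢ + 0) (odd-J : Odd J₁ ⊎ Odd J₂)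
    (model : ∀ {P} → IsPrimeIdeal P → (∃ λ x → P x × x ≢ 𝟘) → GoodModel Δ₀ J₁ J₂ P)
    where

    norm-Δ₀ : ∃ λ R → R ≢ + 0 × norm Δ₀ ≡ R ¹²
    norm-Δ₀ = NormOfDiscriminant.norm-12th-power Δ₀ Δ₀≢ (λ isP nz → GoodModel.scaled (model isP nz)) not-neg-square

    R : ℤ
    R = proj₁ norm-Δ₀

    R≢0 : R ≢ + 0
    R≢0 = proj₁ (proj₂ norm-Δ₀)

    norm≡R¹² : norm Δ₀ ≡ R ¹²
    norm≡R¹² = proj₂ (proj₂ norm-Δ₀)

    model-above : ∀ {ℓ} (pr : Prime ℓ) → GoodModel Δ₀ J₁ J₂ (PrimeAbove.P (primeAbove pr))
    model-above {ℓ} pr = model isPrimeIdeal (ι (+ ℓ) , ℓ∈P , ι-≢𝟘 (At.ℓ≢0 pr (primeAbove pr)))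
      where open PrimeAbove (primeAbove pr)

    -- The integers f and w and the discriminant of the model are units at P, so the equation gives
    -- x² the order k there. Primes other than 2 and p are unramified, hence k is even.
    even-valuation : ∀ {ℓ} (pr : Prime ℓ) → ℓ ≢ 2 → ℓ ≢ p → ∀ k {w f x} → ¬ + ℓ ∣ w → ¬ + ℓ ∣ f →
      ι f ⊗ sq x ≡ ι (+ (ℓ ℕ.^ k) * w) ⊗ GoodModel.D (model-above pr) → 2 ℕD.∣ k
    even-valuation {ℓ} pr ℓ≢2 ℓ≢p k {w} {f} {x} w∤ f∤ eq = square-valuation unramified {x}
      (valuation (ι f) (ι w ⊗ GoodModel.D (model-above pr)) (∉-ι f∤) (∉-⊗ (∉-ι w∤) (GoodModel.D∉P (model-above pr)))
        (trans eq (trans (cong (_⊗ GoodModel.D (model-above pr)) (ι-* (+ (ℓ ℕ.^ k)) w))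
          (*-assoc (power k) (ι w) (GoodModel.D (model-above pr))))))
      where
      open PrimeAbove (primeAbove pr)
      open At pr (primeAbove pr)
      unramified : Unramified ℓ P
      unramified = [ (λ u → u) , (λ r → ⊥-elim ([ ℓ≢2 , ℓ≢p ]′ (disc-primes pr (proj₂ r)))) ]′ ramification

    module Ordinary {P} (m : GoodModel Δ₀ J₁ J₂ P) (odd-c₄ : Odd (norm (GoodModel.c₄ m))) (odd-D : Odd (norm (GoodModel.D m))) where
      open GoodModel m

      -- One of the two is odd because the fraction is in lowest terms, and J₂² N(c₄)³ = J₁² N(D),
      -- with both norms odd, transfers oddness to the other.
      odd-J₁,J₂ : Odd J₁ × Odd J₂
      odd-J₁,J₂ = [ (λ o₁ → o₁ , odd-*⁻ˡ J₂ J₂ (odd-*⁻ˡ (J₂ ²) (norm c₄ * norm c₄ * norm c₄) (subst Odd (sym j-norm)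
          (odd-* (odd-* o₁ o₁) odd-D))))
                  , (λ o₂ → odd-*⁻ˡ J₁ J₁ (odd-*⁻ˡ (J₁ ²) (norm D)
                      (subst Odd j-norm (odd-* (odd-* o₂ o₂) (odd-* (odd-* odd-c₄ odd-c₄) odd-c₄)))) , o₂) ]′ odd-J

      odd-fraction : ∃₂ λ a b → Odd a × Odd b × Coprimality.Coprime ∣ a ∣ ∣ b ∣ × J₁ * (b * b * b) ≡ J₂ * (a * a * a)
      odd-fraction = odd-cube-ratio (J₁ * (n ² * R) ⁴) (J₂ * (norm c₄ * norm o ⁴)) (proj₁ odd-J₁,J₂) (proj₂ odd-J₁,J₂)
        (*-≢0 (odd-≢0 (proj₁ odd-J₁,J₂)) (²-≢0 (²-≢0 (*-≢0 (²-≢0 n≢0) R≢0))))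
        (ℤ-cube-ratio (norm c₄) (norm o) J₁ J₂ (n ²) R (norm D) j-norm
          (trans (cong ((n ²) ¹² *_) (sym norm≡R¹²)) norm-scaling-D))

    module Reduced {a b : ℤ} (odd-a : Odd a) (odd-b : Odd b) (coprime : Coprimality.Coprime ∣ a ∣ ∣ b ∣)
                   (J₁b³≡J₂a³ : J₁ * (b * b * b) ≡ J₂ * (a * a * a)) where

      -- With j = (a/b)³ the number j - 1728 becomes (a³ - 1728 b³)/b³, and the numerator is in the
      -- factored form that `cofactor-valuations` needs. The common factor J₂ cancels because the
      -- order is a domain.
      c₆-relation-reduced : ∀ {P} (m : GoodModel Δ₀ J₁ J₂ P) →
        ι (b * b * b) ⊗ sq (GoodModel.c₆ m) ≡ ι (cofactor a b * (a - + 12 * b)) ⊗ GoodModel.D m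
      c₆-relation-reduced m = ⊗-cancelˡ (ι (b * b * b) ⊗ sq m.c₆) (ι (cofactor a b * (a - + 12 * b)) ⊗ m.D) (ι-≢𝟘 J₂≢) (begin
        ι J₂ ⊗ (ι (b * b * b) ⊗ sq m.c₆)
          ≡⟨ solve 3 (λ x y z → x :* (y :* z) := y :* (x :* z)) refl (ι J₂) (ι (b * b * b)) (sq m.c₆) ⟩
        ι (b * b * b) ⊗ (ι J₂ ⊗ sq m.c₆)
          ≡⟨ cong (ι (b * b * b) ⊗_) m.c₆-relation ⟩
        ι (b * b * b) ⊗ (ι (J₁ - + 1728 * J₂) ⊗ m.D)
          ≡⟨ ι-assoc (b * b * b) (J₁ - + 1728 * J₂) m.D ⟩
        ι (b * b * b * (J₁ - + 1728 * J₂)) ⊗ m.D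
          ≡⟨ cong (λ z → ι z ⊗ m.D) (cofactor-relation J₁ J₂ a b J₁b³≡J₂a³) ⟩
        ι (J₂ * (cofactor a b * (a - + 12 * b))) ⊗ m.D
          ≡⟨ sym (ι-assoc J₂ (cofactor a b * (a - + 12 * b)) m.D) ⟩
        ι J₂ ⊗ (ι (cofactor a b * (a - + 12 * b)) ⊗ m.D) ∎)
        where
        open ≡-Reasoning
        module m = GoodModel m
        ι-assoc : ∀ x y z → ι x ⊗ (ι y ⊗ z) ≡ ι (x * y) ⊗ z
        ι-assoc x y z = trans (sym (*-assoc (ι x) (ι y) z)) (cong (_⊗ z) (sym (ι-* x y)))

      impossible : ⊥
      impossible = cofactor-valuations odd-a odd-b coprime (inj₂ p≡3)
        (λ {ℓ} pr ℓ≢2 ℓ≢p b∤ a-12b∤ k w Q≡ w∤ →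
          even-valuation pr ℓ≢2 ℓ≢p k {w * (a - + 12 * b)} {b * b * b} {GoodModel.c₆ (model-above pr)}
            (prime∤* pr w∤ a-12b∤) (prime∤* pr (prime∤* pr b∤ b∤) b∤)
            (trans (c₆-relation-reduced (model-above pr)) (cong (λ z → ι z ⊗ GoodModel.D (model-above pr))
              (trans (cong (_* (a - + 12 * b)) Q≡) (ℤP.*-assoc (+ (ℓ ℕ.^ k)) w (a - + 12 * b))))))
        where
        prime∤* : ∀ {ℓ} → Prime ℓ → ∀ {x y} → ¬ + ℓ ∣ x → ¬ + ℓ ∣ y → ¬ + ℓ ∣ x * y
        prime∤* pr {x} {y} x∤ y∤ d = [ x∤ , y∤ ]′ (euclid pr x y d)

    module Intermediate {P} (m : GoodModel Δ₀ J₁ J₂ P) {C₄} (c₄≡ : GoodModel.c₄ m ≡ ι (+ 4) ⊗ C₄)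
        (C₄∉ : ¬ RationalSquareClass C₄) where
      open GoodModel m

      C₄≢𝟘 : C₄ ≢ 𝟘
      C₄≢𝟘 e = C₄∉ (subst RationalSquareClass (sym e) rationalSquareClass-𝟘)

      J₁≢0 : J₁ ≢ + 0
      J₁≢0 e = ⊗-≢𝟘 (ι-≢𝟘 J₂≢) (⊗-≢𝟘 (sq-≢𝟘 c₄≢𝟘) c₄≢𝟘) (trans j-relation (trans (cong (λ z → ι z ⊗ D) e) (zeroˡ D)))
        where
        c₄≢𝟘 : c₄ ≢ 𝟘
        c₄≢𝟘 = subst (_≢ 𝟘) (sym c₄≡) (⊗-≢𝟘 (ι-≢𝟘 (λ ())) C₄≢𝟘)

      -- The relation J₂ c₄³ = J₁ D, with 64 = 4³ from c₄ = 4 C₄, makes C₄ equal to J₁ J₂ D up to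
      -- squares, and D agrees with Δ₀ up to a twelfth power. So C₄ inherits the rational square
      -- class of Δ₀, whose norm is a square.
      twist : ι (+ 64 * J₂ * J₁) ⊗ C₄ ⊗ sq (C₄ ⊗ pow6 o) ≡ sq (ι J₁ ⊗ pow6 (ι n)) ⊗ Δ₀
      twist = begin
        ι (+ 64 * J₂ * J₁) ⊗ C₄ ⊗ sq (C₄ ⊗ pow6 o)
          ≡⟨ cong (λ z → z ⊗ C₄ ⊗ sq (C₄ ⊗ pow6 o)) (trans (ι-* (+ 64 * J₂) J₁) (cong (_⊗ ι J₁) (ι-* (+ 64) J₂))) ⟩
        ι (+ 64) ⊗ ι J₂ ⊗ ι J₁ ⊗ C₄ ⊗ sq (C₄ ⊗ pow6 o)
          ≡⟨ solve 4 (λ j₂ j₁ c o → # 64 :* j₂ :* j₁ :* c :* sq′ (c :* pow6′ o)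
               := let c₄ = # 4 :* c in j₁ :* (j₂ :* (c₄ :* c₄ :* c₄)) :* pow12′ o) refl (ι J₂) (ι J₁) C₄ o ⟩
        ι J₁ ⊗ (ι J₂ ⊗ cube (ι (+ 4) ⊗ C₄)) ⊗ pow12 o
          ≡⟨ cong (λ z → ι J₁ ⊗ z ⊗ pow12 o) (trans (cong (λ z → ι J₂ ⊗ cube z) (sym c₄≡)) j-relation) ⟩
        ι J₁ ⊗ (ι J₁ ⊗ D) ⊗ pow12 o
          ≡⟨ solve 3 (λ j d o → j :* (j :* d) :* o := sq′ j :* (o :* d)) refl (ι J₁) D (pow12 o) ⟩
        sq (ι J₁) ⊗ (pow12 o ⊗ D)
          ≡⟨ cong (sq (ι J₁) ⊗_) (sym scaling-D) ⟩
        sq (ι J₁) ⊗ (pow12 (ι n) ⊗ Δ₀)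
          ≡⟨ solve 3 (λ j n d → sq′ j :* (pow12′ n :* d) := sq′ (j :* pow6′ n) :* d) refl (ι J₁) (ι n) Δ₀ ⟩
        sq (ι J₁ ⊗ pow6 (ι n)) ⊗ Δ₀ ∎
        where open ≡-Reasoning

      impossible : ⊥
      impossible = C₄∉ (rationalSquareClass-cancel (+ 64 * J₂ * J₁) (C₄ ⊗ pow6 o) (*-≢0 (*-≢0 {+ 64} (λ ()) J₂≢) J₁≢0)
        (⊗-≢𝟘 C₄≢𝟘 (⊗-≢𝟘 (sq-≢𝟘 o≢) (sq-≢𝟘 (sq-≢𝟘 o≢)))) twist
        (rationalSquareClass-sq (ι J₁ ⊗ pow6 (ι n)) (square-norm⇒rationalSquareClass Δ₀ (R ⁶) (⁶-≢0 R≢0) norm≡R¹²)))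
        where
        o≢ : o ≢ 𝟘
        o≢ = o≢𝟘 Δ₀≢

    module Supersingular {P} (m : GoodModel Δ₀ J₁ J₂ P) {X C₆} (c₄≡ : GoodModel.c₄ m ≡ ι (+ 16) ⊗ X)
        (c₆≡ : GoodModel.c₆ m ≡ ι (+ 8) ⊗ C₆)
      (sC₆∉ : ¬ RationalSquareClass (s ⊗ C₆)) (odd-D : Odd (norm (GoodModel.D m))) where
      open GoodModel m

      norm-c₄≡ : norm c₄ ≡ + 256 * norm X
      norm-c₄≡ = trans (cong norm c₄≡) (trans (norm-⊗ (ι (+ 16)) X) (cong (_* norm X) (norm-ι (+ 16))))

      4096∣J₁ : ∃ λ J′ → J₁ ≡ + 4096 * J′
      -- The exponent 12 comes from 256³ = (2¹²)².
      4096∣J₁ = power-of-2-divides-root 12 {J₂ ² * (norm X * norm X * norm X)} {J₁} {norm D} odd-D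
        (trans (cube-scaling (+ 256) (J₂ ²) (norm X))
          (trans (cong (λ z → J₂ ² * (z * z * z)) (sym norm-c₄≡)) j-norm))

      J′ : ℤ
      J′ = proj₁ 4096∣J₁

      odd-J₂ : Odd J₂
      odd-J₂ = [ (λ o₁ → ⊥-elim (¬even-and-odd {J₁} {+ 2048 * J′} (trans (proj₂ 4096∣J₁) (ℤP.*-assoc (+ 2) (+ 2048) J′))
          o₁)) , (λ o₂ → o₂) ]′ odd-J

      T : ℤ
      T = reduced J′ J₂

      J₁-1728J₂≡ : J₁ - + 1728 * J₂ ≡ + 64 * T
      J₁-1728J₂≡ = trans (cong (_- + 1728 * J₂) (proj₂ 4096∣J₁)) (64*reduced J′ J₂)

      T*J₂≡5 : ≡ + 5 [8] (T * J₂)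
      T*J₂≡5 = reduced-mod-8 J′ odd-J₂

      odd-T*J₂ : Odd (T * J₂)
      odd-T*J₂ = 5mod8⇒odd T*J₂≡5

      -- The factor J₂ replaces the quotient T/J₂ = (j - 1728)/64 by the product T J₂ in the same
      -- square class, so no denominator remains.
      c₆J₂-square : ∀ {P} (m : GoodModel Δ₀ J₁ J₂ P) → ι (+ 1) ⊗ sq (GoodModel.c₆ m ⊗ ι J₂) ≡ ι (T * J₂ * + 64) ⊗ GoodModel.D m
      c₆J₂-square m = begin
        ι (+ 1) ⊗ sq (m.c₆ ⊗ ι J₂)
          ≡⟨ solve 2 (λ c j → # 1 :* sq′ (c :* j) := j :* (j :* sq′ c)) refl m.c₆ (ι J₂) ⟩
        ι J₂ ⊗ (ι J₂ ⊗ sq m.c₆)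
          ≡⟨ cong (ι J₂ ⊗_) (trans m.c₆-relation (cong (λ z → ι z ⊗ m.D) J₁-1728J₂≡)) ⟩
        ι J₂ ⊗ (ι (+ 64 * T) ⊗ m.D)
          ≡⟨ sym (*-assoc (ι J₂) (ι (+ 64 * T)) m.D) ⟩
        ι J₂ ⊗ ι (+ 64 * T) ⊗ m.D
          ≡⟨ cong (_⊗ m.D) (sym (ι-* J₂ (+ 64 * T))) ⟩
        ι (J₂ * (+ 64 * T)) ⊗ m.D
          ≡⟨ cong (λ z → ι z ⊗ m.D) (trans (cong (J₂ *_) (ℤP.*-comm (+ 64) T)) (trans (sym (ℤP.*-assoc J₂ T (+ 64)))
              (cong (_* + 64) (ℤP.*-comm J₂ T)))) ⟩
        ι (T * J₂ * + 64) ⊗ m.D ∎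
        where
        open ≡-Reasoning
        module m = GoodModel m

      -- The square of c₆ J₂ shows that T J₂ has even order at each ℓ other than 2 and p, where 64
      -- is a unit. At 2 its order is 0, since it is odd.
      T*J₂≡neg-p-square : ∃ λ r → r ≢ + 0 × T * J₂ ≡ - (+ p * r ²)
      T*J₂≡neg-p-square = 5mod8⇒neg-p-square T*J₂≡5 p≡3 (even-valuations⇒squareUpTo p (T * J₂) (odd-≢0 odd-T*J₂) even-at)
        where
        even-at : ∀ {ℓ} → Prime ℓ → ℓ ≢ p → ∀ k w → T * J₂ ≡ + (ℓ ℕ.^ k) * w → ¬ + ℓ ∣ w → 2 ℕD.∣ k
        even-at {ℓ} pr ℓ≢p zero w eq ∤ = 2 ℕD.∣0
        even-at {ℓ} pr ℓ≢p k@(suc k′) w eq ∤ = even-valuation pr ℓ≢2 ℓ≢p k {w * + 64} {+ 1} {GoodModel.c₆ (model-above pr) ⊗ ι J₂}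
          (λ d → [ ∤ , (λ d′ → ℓ≢2 (prime∣prime pr prime[2] (prime∣power pr 2 6 (∣⇒∣ᵤ d′)))) ]′ (euclid pr w (+ 64) d)) (prime∤1 pr)
          (trans (c₆J₂-square (model-above pr)) (cong (λ z → ι z ⊗ GoodModel.D (model-above pr))
              (trans (cong (_* + 64) eq) (ℤP.*-assoc (+ (ℓ ℕ.^ k)) w (+ 64)))))
          where
          ℓ≢2 : ℓ ≢ 2
          ℓ≢2 refl = ¬even-and-odd {T * J₂} {+ (2 ℕ.^ k′) * w} (trans eq (trans (cong (_* w) (ℤP.pos-* 2 (2 ℕ.^ k′)))
              (ℤP.*-assoc (+ 2) (+ (2 ℕ.^ k′)) w))) odd-T*J₂

      z : Order
      z = C₆ ⊗ ι J₂ ⊗ pow6 o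

      z-square : sq z ≡ ι (T * J₂) ⊗ (pow12 (ι n) ⊗ Δ₀)
      z-square = ⊗-cancelˡ (sq z) (ι (T * J₂) ⊗ (pow12 (ι n) ⊗ Δ₀)) (ι-≢𝟘 {+ 64} (λ ())) (begin
        ι (+ 64) ⊗ sq z
          ≡⟨ solve 3 (λ c j o → # 64 :* sq′ (c :* j :* pow6′ o) := # 1 :* sq′ (# 8 :* c :* j) :* pow12′ o) refl C₆ (ι J₂) o ⟩
        ι (+ 1) ⊗ sq (ι (+ 8) ⊗ C₆ ⊗ ι J₂) ⊗ pow12 o
          ≡⟨ cong (_⊗ pow12 o) (trans (cong (λ x → ι (+ 1) ⊗ sq (x ⊗ ι J₂)) (sym c₆≡)) (c₆J₂-square m)) ⟩
        ι (T * J₂ * + 64) ⊗ D ⊗ pow12 o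
          ≡⟨ cong (λ x → x ⊗ D ⊗ pow12 o) (ι-* (T * J₂) (+ 64)) ⟩
        ι (T * J₂) ⊗ ι (+ 64) ⊗ D ⊗ pow12 o
          ≡⟨ solve 3 (λ t d o → t :* # 64 :* d :* o := # 64 :* (t :* (o :* d))) refl (ι (T * J₂)) D (pow12 o) ⟩
        ι (+ 64) ⊗ (ι (T * J₂) ⊗ (pow12 o ⊗ D))
          ≡⟨ cong (λ x → ι (+ 64) ⊗ (ι (T * J₂) ⊗ x)) (sym scaling-D) ⟩
        ι (+ 64) ⊗ (ι (T * J₂) ⊗ (pow12 (ι n) ⊗ Δ₀)) ∎)
        where open ≡-Reasoning

      p≢0 : + p ≢ + 0
      p≢0 e = distinct-residues (+ 3) (+ 0) (subst (≡ + 3 [8]) e p≡3) (+ 0 , refl)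

      -- The norms ± p of s and ± p t² of z multiply to ± (p t)², and the minus sign is excluded
      -- because p t ≠ 0.
      norm-sz : ∀ t → t ≢ + 0 → norm z ² ≡ (+ p * t ²) ² → norm (s ⊗ z) ≡ (+ p * t) ²
      norm-sz t t≢0 norm-z² = [ (λ e → e) , (λ e → ⊥-elim (*-≢0 p≢0 t≢0 (not-neg-square (s ⊗ z) (+ p * t) e))) ]′
        ([ (λ e → inj₁ (trans (norm-⊗ s z) e)) , (λ e → inj₂ (trans (norm-⊗ s z) e)) ]′
          (signed-product (+ p) t norm-s (square-roots (norm z) (+ p * t ²) norm-z²)))

      -- The identity J₂ (s C₆) (o³)² = s z puts s C₆ into the rational square class of s z, whose
      -- norm is a square.
      impossible-from : ∀ t → t ≢ + 0 → norm z ² ≡ (+ p * t ²) ² → ⊥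
      impossible-from t t≢0 norm-z² = sC₆∉ (rationalSquareClass-cancel J₂ (o ⊗ sq o) J₂≢ (⊗-≢𝟘 (o≢𝟘 Δ₀≢) (sq-≢𝟘 (o≢𝟘 Δ₀≢)))
        (solve 4 (λ j s c o → j :* (s :* c) :* sq′ (o :* sq′ o) := s :* (c :* j :* pow6′ o)) refl (ι J₂) s C₆ o)
        (square-norm⇒rationalSquareClass (s ⊗ z) (+ p * t) (*-≢0 p≢0 t≢0) (norm-sz t t≢0 norm-z²)))

      impossible : ⊥
      impossible = finish T*J₂≡neg-p-square
        where
        finish : (∃ λ r → r ≢ + 0 × T * J₂ ≡ - (+ p * r ²)) → ⊥
        finish (r , r≢0 , eq) = impossible-from (r * n ⁶ * (R ² * R)) (*-≢0 (*-≢0 r≢0 (⁶-≢0 n≢0)) (*-≢0 (²-≢0 R≢0) R≢0))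
          (norm-of-square z {Δ₀} (T * J₂) n r R z-square norm≡R¹² eq)

    no-good-models : ∀ {P} → IsPrimeIdeal P → (∃ λ x → P x × x ≢ 𝟘) → (∀ E → ¬ P (Equation.D E) → TwoAdicType E) → ⊥
    no-good-models {P} isP nz classify = conclude (classify (GoodModel.E m) (GoodModel.D∉P m))
      where
      m : GoodModel Δ₀ J₁ J₂ P
      m = model isP nz
      conclude : TwoAdicType (GoodModel.E m) → ⊥
      conclude (ordinary odd-c₄ odd-D) = let a , b , oa , ob , c , e = Ordinary.odd-fraction m odd-c₄ odd-D in Reduced.impossible {a} {b} oa ob c e
      conclude (intermediate C₄ c₄≡ C₄∉) = Intermediate.impossible m {C₄} c₄≡ C₄∉
      conclude (supersingular X C₆ c₄≡ c₆≡ sC₆∉ odd-D) = Supersingular.impossible m {X} {C₆} c₄≡ c₆≡ sC₆∉ odd-D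

  -- In both fields the prime above 2 is stable under conjugation. An element outside it then has
  -- its conjugate and its norm outside too, which lets conditions at P be read as parities of
  -- norms.
  module AtTwo (above : PrimeAbove 2) (conj∈ : ∀ x → PrimeAbove.P above x → PrimeAbove.P above (conj x)) where
    open PrimeAbove above

    2⊗∈ : ∀ x → P (ι (+ 2) ⊗ x)
    2⊗∈ x = subst P (*-comm x (ι (+ 2))) (absorb x (ι (+ 2)) ℓ∈P)

    ∈-⊗ʳ : ∀ {x} y → P x → P (x ⊗ y)
    ∈-⊗ʳ {x} y x∈ = subst P (*-comm y x) (absorb y x x∈)

    ∉⇒odd-norm : ∀ {x} → ¬ P x → Odd (norm x)
    ∉⇒odd-norm {x} x∉ = [ (λ { (k , e) → ⊥-elim (norm∉ (subst P (sym (trans (cong ι e) (ι-* (+ 2) k))) (2⊗∈ (ι k)))) })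
        , (λ o → o) ]′ (even-or-odd (norm x))
      where
      norm∉ : ¬ P (ι (norm x))
      norm∉ = subst (λ y → ¬ P y) (x⊗conj x) (∉-⊗ x∉ (λ x̄∈ → x∉ (subst P (conj-involutive x) (conj∈ (conj x) x̄∈))))

    ordinary-at-2 : ∀ E → ¬ P (Equation.a1 E) → ¬ P (Equation.D E) → TwoAdicType E
    ordinary-at-2 E a1∉ D∉ = ordinary (∉⇒odd-norm c₄∉) (∉⇒odd-norm D∉)
      where
      open Equation E
      c₄∉ : ¬ P c₄
      -- Modulo 2, c₄ ≡ b₂² ≡ a₁⁴.
      c₄∉ c₄∈ = ∉-sq (∉-sq a1∉) (subst P (sym (solve 4 (λ a1 a2 a3 a4 →
          sq′ (sq′ a1) := Poly.c4ᵇ (Poly.b2 a1 a2) (Poly.b4 a1 a3 a4) :+ # 2 :*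
            (# 12 :* Poly.b4 a1 a3 a4 :+ :- (# 4 :* (a1 :* a1 :* a2)) :+ :- (# 8 :* (a2 :* a2)))) refl a1 a2 a3 a4))
        (+-closed c₄ _ c₄∈ (2⊗∈ _)))

    -- Modulo P one has b₂ ≡ a₁² ≡ 0, and therefore Δ ≡ b₆² ≡ a₃⁴.
    a3∉ : ∀ E → P (Equation.a1 E) → ¬ P (Equation.D E) → ¬ P (Equation.a3 E)
    a3∉ E a1∈ D∉ a3∈ = D∉ (subst P (sym (solve 4 (λ b2 b4 b6 b8 →
          Poly.Δᵇ b2 b4 b6 b8 := b2 :* (:- (b2 :* b8) :+ # 9 :* (b4 :* b6)) :+ (# 2 :* (:- # 4 :* (b4 :* b4 :* b4))
              :+ b6 :* (:- # 27 :* b6)))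
          refl (b2 a1 a2) (b4 a1 a3 a4) (b6 a3 a6) (b8 a1 a2 a3 a4 a6)))
        (+-closed _ _ (∈-⊗ʳ _ b2∈) (+-closed _ _ (2⊗∈ _) (∈-⊗ʳ _ b6∈))))
      where
      open Equation E
      b2∈ : P (b2 a1 a2)
      b2∈ = subst P (sym (solve 2 (λ a1 a2 → Poly.b2 a1 a2 := a1 :* a1 :+ # 2 :* (# 2 :* a2)) refl a1 a2))
        (+-closed _ _ (absorb a1 a1 a1∈) (2⊗∈ _))
      b6∈ : P (b6 a3 a6)
      b6∈ = subst P (sym (solve 2 (λ a3 a6 → Poly.b6 a3 a6 := a3 :* a3 :+ # 2 :* (# 2 :* a6)) refl a3 a6))
        (+-closed _ _ (absorb a3 a3 a3∈) (2⊗∈ _))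

    -- c₆/8 ≡ a₃² mod 4, so multiplying by ā₃² leaves an odd integer modulo 4.
    supersingular-at-2 : (∀ c e → Odd c → ¬ RationalSquareClass (s ⊗ (c ∔ + 4 * e ω))) →
      ∀ E α → Equation.a1 E ≡ ι (+ 2) ⊗ α → ¬ P (Equation.D E) → TwoAdicType E
    supersingular-at-2 not-square E α a1≡ D∉ = supersingular X C₆ c₄≡ c₆≡ sC₆∉ (∉⇒odd-norm D∉)
      where
      open Equation E
      β γ X C₆ Y : Order
      β = sq α ⊕ a2
      γ = a4 ⊕ α ⊗ a3
      X = sq β ⊖ ι (+ 3) ⊗ γ
      C₆ = sq a3 ⊕ ι (+ 4) ⊗ Y
      -- The coefficient 7 arises from -27 a₃² = a₃² - 4 · 7 a₃², which separates the leading term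
      -- of c₆/8 from a multiple of 4.
      Y = ι (+ 9) ⊗ (β ⊗ γ) ⊖ ι (+ 2) ⊗ (β ⊗ β ⊗ β) ⊖ ι (+ 7) ⊗ sq a3 ⊖ ι (+ 27) ⊗ a6
      b2≡ : b2 a1 a2 ≡ ι (+ 4) ⊗ β
      b2≡ = trans (cong (λ a → b2 a a2) a1≡) (solve 2 (λ α a2 → Poly.b2 (# 2 :* α) a2 := # 4 :* (α :* α :+ a2)) refl α a2)
      b4≡ : b4 a1 a3 a4 ≡ ι (+ 2) ⊗ γ
      b4≡ = trans (cong (λ a → b4 a a3 a4) a1≡) (solve 3 (λ α a3 a4 → Poly.b4 (# 2 :* α) a3 a4 := # 2 :* (a4 :+ α :* a3)) refl α a3 a4)
      c₄≡ : c₄ ≡ ι (+ 16) ⊗ X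
      c₄≡ = trans (cong₂ c4ᵇ b2≡ b4≡) (solve 2 (λ β γ → Poly.c4ᵇ (# 4 :* β) (# 2 :* γ) := # 16 :* (β :* β :+ :- (# 3 :* γ))) refl β γ)
      c₆≡ : c₆ ≡ ι (+ 8) ⊗ C₆
      c₆≡ = trans (cong₂ (λ x y → c6ᵇ x y (b6 a3 a6)) b2≡ b4≡) (solve 4 (λ β γ a3 a6 →
        Poly.c6ᵇ (# 4 :* β) (# 2 :* γ) (Poly.b6 a3 a6) := # 8 :* (a3 :* a3 :+ # 4 :*
          (# 9 :* (β :* γ) :+ :- (# 2 :* (β :* β :* β)) :+ :- (# 7 :* (a3 :* a3)) :+ :- (# 27 :* a6)))) refl β γ a3 a6)
      N : ℤ
      N = norm a3
      Y′ : Order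
      Y′ = Y ⊗ sq (conj a3)
      rotated : sq (conj a3) ⊗ (s ⊗ C₆) ≡ s ⊗ (ι (N ²) ⊕ ι (+ 4) ⊗ Y′)
      rotated = trans (solve 4 (λ a ā s y → ā :* ā :* (s :* (a :* a :+ # 4 :* y))
          := s :* (sq′ (a :* ā) :+ # 4 :* (y :* (ā :* ā)))) refl a3 (conj a3) s Y)
        (cong (λ z → s ⊗ (z ⊕ ι (+ 4) ⊗ Y′)) (trans (cong sq (x⊗conj a3)) (sym (ι-sq N))))
      components : ∀ u y → ι u ⊕ ι (+ 4) ⊗ y ≡ (u + + 4 * re y ∔ + 4 * im y ω)
      components u y = trans (cong (ι u ⊕_) (ι⊗ (+ 4) y)) (cong (u + + 4 * re y ∔_ω) (ℤP.+-identityˡ (+ 4 * im y)))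
      odd-c : ∀ y → Odd (N ² + + 4 * y)
      odd-c y = odd+even (odd-* {N} {N} odd-N odd-N) (+ 2 * y , ℤP.*-assoc (+ 2) (+ 2) y)
        where
        odd-N : Odd N
        odd-N = ∉⇒odd-norm (a3∉ E (subst P (sym a1≡) (2⊗∈ α)) D∉)
      sC₆∉ : ¬ RationalSquareClass (s ⊗ C₆)
      sC₆∉ r = not-square (N ² + + 4 * re Y′) (im Y′) (odd-c (re Y′))
        (subst RationalSquareClass (trans rotated (cong (s ⊗_) (components (N ²) Y′))) (rationalSquareClass-sq (conj a3) r))

-- Quadratic forms without zeros, by descent at 2

module BinaryForms where
  open import Data.Integer using (_+_; _*_; -_; _-_)
  open IntegerLemmas
  open IntegerRing
  open Residues

  descent₂ : (Q : ℤ → ℤ → Set) → (∀ x y → Q x y → ∃₂ λ x′ y′ → x ≡ + 2 * x′ × y ≡ + 2 * y′ × Q x′ y′) →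
    ∀ x y → Q x y → x ≡ + 0 × y ≡ + 0
  descent₂ Q halve x y q =
      descent (λ x → ∃ (Q x)) (λ { x (y , q) → let x′ , y′ , e , _ , q′ = halve x y q in x′ , e , y′ , q′ }) x (y , q)
    , descent (λ y → ∃ λ x → Q x y) (λ { y (x , q) → let x′ , y′ , _ , e , q′ = halve x y q in y′ , e , x′ , q′ }) y (x , q)

  module SumOfSquares {p q : ℤ} (p≡ : p ≡ + 3 + + 8 * q) where
    Solution : ℤ → ℤ → ℤ → Set
    Solution m t n = m ² + t ² ≡ p * n ²

    odd-p : Odd p
    odd-p = + 1 + + 4 * q , trans p≡ (solve 1 (λ q → # 3 :+ # 8 :* q := # 1 :+ # 2 :* (# 1 :+ # 4 :* q)) refl q)

    square-mod-4 : ∀ x → (∃ λ y → x ≡ + 2 * y) ⊎ (∃ λ k → x ² ≡ + 1 + + 4 * k)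
    square-mod-4 x = [ inj₁ , (λ o → let k , e = odd-² o in inj₂ (+ 2 * k , trans e
      (solve 1 (λ k → # 1 :+ # 8 :* k := # 1 :+ # 4 :* (# 2 :* k)) refl k))) ]′ (even-or-odd x)

    even-square : ∀ {x} → (∃ λ y → x ≡ + 2 * y) → ∃ λ k → x ² ≡ + 0 + + 4 * k
    even-square (y , refl) = y * y , solve 1 (λ y → # 2 :* y :* (# 2 :* y) := # 0 :+ # 4 :* (y :* y)) refl y

    -- As -p ≡ 1 modulo 4, the equation m² + t² - p n² = 0 reads i + j + k ≡ 0 for the residues of
    -- the three squares. Each residue is 0 or 1, so the sum is a multiple of 4 only when all three
    -- vanish.
    mod-4 : ∀ i j k {m t n} → ¬ 4 ℕD.∣ i ℕ.+ j ℕ.+ k → (∃ λ a → m ² ≡ + i + + 4 * a) → (∃ λ b → t ² ≡ + j + + 4 * b)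
        → (∃ λ d → n ² ≡ + k + + 4 * d) →
      ¬ Solution m t n
    mod-4 i j k {m} {t} {n} ∤ (a , ea) (b , eb) (d , ed) sol = no-multiple {4} {i ℕ.+ j ℕ.+ k} ∤
        {a + b - + 3 * d - + 8 * (q * d) - + 2 * (q * + k) - + k}
      (trans (lemma (+ i) (+ j) (+ k) a b d q) (trans (cong₂ (λ x y → x - y) (sym (cong₂ _+_ ea eb))
          (sym (cong₂ _*_ p≡ ed))) (x≡y⇒x-y≡0 sol)))
      where
      lemma : ∀ i j k a b d q → i + j + k + + 4 * (a + b - + 3 * d - + 8 * (q * d) - + 2 * (q * k) - k) ≡
          (i + + 4 * a + (j + + 4 * b)) - (+ 3 + + 8 * q) * (k + + 4 * d)
      lemma = solve 7 (λ i j k a b d q → i :+ j :+ k :+ # 4 :* (a :+ b :+ :- (# 3 :* d) :+ :- (# 8 :* (q :* d))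
          :+ :- (# 2 :* (q :* k)) :+ :- k)
        := (i :+ # 4 :* a :+ (j :+ # 4 :* b)) :+ :- ((# 3 :+ # 8 :* q) :* (k :+ # 4 :* d))) refl

    Halves : ℤ → ℤ → ℤ → Set
    Halves m t n = ∃₂ λ m′ t′ → ∃ λ n′ → m ≡ + 2 * m′ × t ≡ + 2 * t′ × n ≡ + 2 * n′ × Solution m′ t′ n′

    halve : ∀ m t n → Solution m t n → Halves m t n
    halve m t n sol = cases (square-mod-4 m) (square-mod-4 t) (square-mod-4 n)
      where
      ∤1 : ¬ 4 ℕD.∣ 1
      ∤1 = ℕD.>⇒∤ (ℕ.s≤s (ℕ.s≤s ℕ.z≤n))
      ∤2 : ¬ 4 ℕD.∣ 2
      ∤2 = ℕD.>⇒∤ (ℕ.s≤s (ℕ.s≤s (ℕ.s≤s ℕ.z≤n)))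
      ∤3 : ¬ 4 ℕD.∣ 3
      ∤3 = ℕD.>⇒∤ (ℕ.s≤s (ℕ.s≤s (ℕ.s≤s (ℕ.s≤s ℕ.z≤n))))
      Class : ℤ → Set
      Class x = (∃ λ y → x ≡ + 2 * y) ⊎ (∃ λ k → x ² ≡ + 1 + + 4 * k)
      clash : ∀ i j k → ¬ 4 ℕD.∣ i ℕ.+ j ℕ.+ k → (∃ λ a → m ² ≡ + i + + 4 * a) → (∃ λ b → t ² ≡ + j + + 4 * b)
          → (∃ λ d → n ² ≡ + k + + 4 * d) → Halves m t n
      clash i j k ∤ a b d = ⊥-elim (mod-4 i j k {m} {t} {n} ∤ a b d sol)
      cases : Class m → Class t → Class n → Halves m t n
      cases (inj₁ (m′ , em)) (inj₁ (t′ , et)) (inj₁ (n′ , en)) = m′ , t′ , n′ , em , et , en ,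
        *-cancelˡ {+ 4} (m′ ² + t′ ²) (p * n′ ²) (λ ())
          (trans (solve 2 (λ m t → # 4 :* (m :* m :+ t :* t) := # 2 :* m :* (# 2 :* m) :+ # 2 :* t :* (# 2 :* t)) refl m′ t′)
            (trans (sym (cong₂ (λ x y → x ² + y ²) em et)) (trans sol (trans (cong (λ x → p * x ²) en)
              (solve 2 (λ p n → p :* (# 2 :* n :* (# 2 :* n)) := # 4 :* (p :* (n :* n))) refl p n′)))))
      cases (inj₁ m) (inj₁ t) (inj₂ n) = clash 0 0 1 ∤1 (even-square m) (even-square t) n
      cases (inj₁ m) (inj₂ t) (inj₁ n) = clash 0 1 0 ∤1 (even-square m) t (even-square n)
      cases (inj₁ m) (inj₂ t) (inj₂ n) = clash 0 1 1 ∤2 (even-square m) t n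
      cases (inj₂ m) (inj₁ t) (inj₁ n) = clash 1 0 0 ∤1 m (even-square t) (even-square n)
      cases (inj₂ m) (inj₁ t) (inj₂ n) = clash 1 0 1 ∤2 m (even-square t) n
      cases (inj₂ m) (inj₂ t) (inj₁ n) = clash 1 1 0 ∤2 m t (even-square n)
      cases (inj₂ m) (inj₂ t) (inj₂ n) = clash 1 1 1 ∤3 m t n

    only-zero : ∀ m t n → Solution m t n → m ≡ + 0 × t ≡ + 0 × n ≡ + 0
    only-zero m t n sol =
        descent (λ m → ∃₂ λ t n → Solution m t n) (λ { m (t , n , s) → let m′ , t′ , n′ , em , _ , _ , s′ = halve m t n s in m′ , em , t′ , n′ , s′ }) m (t , n , sol)
      , descent (λ t → ∃₂ λ m n → Solution m t n) (λ { t (m , n , s) → let m′ , t′ , n′ , _ , et , _ , s′ = halve m t n s in t′ , et , m′ , n′ , s′ }) t (m , n , sol)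
      , descent (λ n → ∃₂ λ m t → Solution m t n) (λ { n (m , t , s) → let m′ , t′ , n′ , _ , _ , en , s′ = halve m t n s in n′ , en , m′ , t′ , s′ }) n (m , t , sol)

  module _ {p : ℤ} (odd-p : Odd p) where

    -- Modulo 2 the form is x² + xy + y², which is anisotropic.
    intermediate-form : ∀ {c e} → Odd c → Odd e → ∀ x y → c * (x * y) ≡ e * (x * x + p * (y * y)) → x ≡ + 0 × y ≡ + 0
    intermediate-form {c} {e} oc oe = descent₂ (λ x y → c * (x * y) ≡ e * (x * x + p * (y * y))) halve
      where
      halve : ∀ x y → c * (x * y) ≡ e * (x * x + p * (y * y)) →
        ∃₂ λ x′ y′ → x ≡ + 2 * x′ × y ≡ + 2 * y′ × c * (x′ * y′) ≡ e * (x′ * x′ + p * (y′ * y′))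
      halve x y eq = cases (even-or-odd x) (even-or-odd y)
        where
        cases : (∃ λ k → x ≡ + 2 * k) ⊎ Odd x → (∃ λ k → y ≡ + 2 * k) ⊎ Odd y →
          ∃₂ λ x′ y′ → x ≡ + 2 * x′ × y ≡ + 2 * y′ × c * (x′ * y′) ≡ e * (x′ * x′ + p * (y′ * y′))
        cases (inj₁ (x′ , ex)) (inj₁ (y′ , ey)) = x′ , y′ , ex , ey , *-cancelˡ {+ 4} (c * (x′ * y′))
            (e * (x′ * x′ + p * (y′ * y′))) (λ ())
          (trans (solve 3 (λ c x y → # 4 :* (c :* (x :* y)) := c :* (# 2 :* x :* (# 2 :* y))) refl c x′ y′)
            (trans (sym (cong₂ (λ x y → c * (x * y)) ex ey)) (trans eq (trans (cong₂ (λ x y → e * (x * x + p * (y * y))) ex ey)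
              (solve 4 (λ e p x y → e :* (# 2 :* x :* (# 2 :* x) :+ p :* (# 2 :* y :* (# 2 :* y)))
                  := # 4 :* (e :* (x :* x :+ p :* (y :* y)))) refl e p x′ y′)))))
        cases (inj₁ ex) (inj₂ oy) = ⊥-elim (parity-clash (*-even c (even-* y ex)) eq
            (odd-* oe (even+odd (even-* x ex) (odd-* odd-p (odd-* oy oy)))))
        cases (inj₂ ox) (inj₁ ey) = ⊥-elim (parity-clash (*-even c (*-even x ey)) eq
            (odd-* oe (odd+even (odd-* ox ox) (*-even p (even-* y ey)))))
        cases (inj₂ ox) (inj₂ oy) = ⊥-elim (parity-clash (*-even e (odd-+ (odd-* ox ox) (odd-* odd-p (odd-* oy oy))))
            (sym eq) (odd-* oc (odd-* ox oy)))

  -- Comparing components in g √p (c + 4e√p) = (x + y√p)² and eliminating g gives this equation,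
  -- with z = p e.
  module RealSupersingularForm {p q : ℤ} (p≡ : p ≡ + 3 + + 8 * q) {c z : ℤ} (odd-c : Odd c) where
    Solution : ℤ → ℤ → Set
    Solution x y = + 8 * (z * (x * y)) ≡ c * (x * x + p * (y * y))

    open SumOfSquares {p} {q} p≡ using (odd-p)

    even-lhs : ∀ x y → ∃ λ k → + 8 * (z * (x * y)) ≡ + 2 * k
    even-lhs x y = + 4 * (z * (x * y)) , ℤP.*-assoc (+ 2) (+ 4) (z * (x * y))

    -- For odd x and y, x² + p y² ≡ 1 + 3 = 4 modulo 8, whereas the left side is divisible by 8.
    ¬both-odd : ∀ x y → Odd x → Odd y → ¬ Solution x y
    ¬both-odd x y ox oy eq = contradiction (odd-² ox) (odd-² oy)
      where
      contradiction : (∃ λ a → x ² ≡ + 1 + + 8 * a) → (∃ λ b → y ² ≡ + 1 + + 8 * b) → ⊥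
      contradiction (a , ea) (b , eb) = ¬even-and-odd {k = z * (x * y)} (sym halved) (odd-* odd-c (w , refl))
        where
        w = a + + 3 * b + q + + 8 * (q * b)
        halved : + 2 * (z * (x * y)) ≡ c * (+ 1 + + 2 * w)
        halved = *-cancelˡ {+ 4} (+ 2 * (z * (x * y))) (c * (+ 1 + + 2 * w)) (λ ())
          (trans (sym (ℤP.*-assoc (+ 4) (+ 2) (z * (x * y)))) (trans eq (trans (cong₂ (λ u v → c * (u + v)) ea (cong₂ _*_ p≡ eb))
            (solve 4 (λ c a b q → c :* (# 1 :+ # 8 :* a :+ (# 3 :+ # 8 :* q) :* (# 1 :+ # 8 :* b))
              := # 4 :* (c :* (# 1 :+ # 2 :* (a :+ # 3 :* b :+ q :+ # 8 :* (q :* b))))) refl c a b q))))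

    only-zero : ∀ x y → Solution x y → x ≡ + 0 × y ≡ + 0
    only-zero = descent₂ Solution halve
      where
      halve : ∀ x y → Solution x y → ∃₂ λ x′ y′ → x ≡ + 2 * x′ × y ≡ + 2 * y′ × Solution x′ y′
      halve x y eq = cases (even-or-odd x) (even-or-odd y)
        where
        clash : Odd (x * x + p * (y * y)) → ⊥
        clash o = parity-clash (even-lhs x y) eq (odd-* odd-c o)
        cases : (∃ λ k → x ≡ + 2 * k) ⊎ Odd x → (∃ λ k → y ≡ + 2 * k) ⊎ Odd y → ∃₂ λ x′ y′ → x ≡ + 2 * x′ × y ≡ + 2 * y′
            × Solution x′ y′
        cases (inj₁ (x′ , ex)) (inj₁ (y′ , ey)) = x′ , y′ , ex , ey , *-cancelˡ {+ 4} (+ 8 * (z * (x′ * y′)))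
            (c * (x′ * x′ + p * (y′ * y′))) (λ ())
          (trans (solve 3 (λ z x y → # 4 :* (# 8 :* (z :* (x :* y))) := # 8 :* (z :* (# 2 :* x :* (# 2 :* y)))) refl z x′ y′)
            (trans (sym (cong₂ (λ x y → + 8 * (z * (x * y))) ex ey)) (trans eq (trans (cong₂ (λ x y → c * (x * x + p * (y * y))) ex ey)
              (solve 4 (λ c p x y → c :* (# 2 :* x :* (# 2 :* x) :+ p :* (# 2 :* y :* (# 2 :* y)))
                  := # 4 :* (c :* (x :* x :+ p :* (y :* y)))) refl c p x′ y′)))))
        cases (inj₁ ex) (inj₂ oy) = ⊥-elim (clash (even+odd (even-* x ex) (odd-* odd-p (odd-* oy oy))))
        cases (inj₂ ox) (inj₁ ey) = ⊥-elim (clash (odd+even (odd-* ox ox) (*-even p (even-* y ey))))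
        cases (inj₂ ox) (inj₂ oy) = ⊥-elim (¬both-odd x y ox oy eq)

  -- The equation results from g (c + 2eω) = (x + yω)² by eliminating g between the two components.
  -- As c is odd, y² and hence y is even; after division by 2, e odd forces x to be even as well.
  module ImaginarySupersingularForm {ν c e : ℤ} (odd-c : Odd c) (odd-e : Odd e) where
    Solution : ℤ → ℤ → Set
    Solution x y = + 2 * (e * (x * x - ν * (y * y))) ≡ c * (x * y + y * x + y * y)

    only-zero : ∀ x y → Solution x y → x ≡ + 0 × y ≡ + 0
    only-zero = descent₂ Solution halve
      where
      halve : ∀ x y → Solution x y → ∃₂ λ x′ y′ → x ≡ + 2 * x′ × y ≡ + 2 * y′ × Solution x′ y′
      halve x y eq = y-cases (even-or-odd y)
        where
        y-cases : (∃ λ k → y ≡ + 2 * k) ⊎ Odd y → ∃₂ λ x′ y′ → x ≡ + 2 * x′ × y ≡ + 2 * y′ × Solution x′ y′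
        y-cases (inj₂ oy) = ⊥-elim (¬even-and-odd {k = e * (x * x - ν * (y * y))} (sym eq)
          (odd-* odd-c (even+odd (x * y , solve 2 (λ x y → x :* y :+ y :* x := # 2 :* (x :* y)) refl x y) (odd-* oy oy))))
        y-cases (inj₁ (y′ , ey)) = x-cases (even-or-odd x)
          where
          halved : e * (x * x + + 2 * (- (+ 2 * (ν * (y′ * y′))))) ≡ + 2 * (c * (x * y′ + y′ * y′))
          halved = *-cancelˡ {+ 2} (e * (x * x + + 2 * (- (+ 2 * (ν * (y′ * y′)))))) (+ 2 * (c * (x * y′ + y′ * y′))) (λ ())
            (trans (solve 4 (λ e x ν y → # 2 :* (e :* (x :* x :+ # 2 :* (:- (# 2 :* (ν :* (y :* y))))))
                := # 2 :* (e :* (x :* x :+ :- (ν :* (# 2 :* y :* (# 2 :* y)))))) refl e x ν y′)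
              (trans (cong (λ y → + 2 * (e * (x * x - ν * (y * y)))) (sym ey))
                  (trans eq (trans (cong (λ y → c * (x * y + y * x + y * y)) ey)
                (solve 3 (λ c x y → c :* (x :* (# 2 :* y) :+ # 2 :* y :* x :+ # 2 :* y :* (# 2 :* y))
                    := # 2 :* (# 2 :* (c :* (x :* y :+ y :* y)))) refl c x y′)))))
          x-cases : (∃ λ k → x ≡ + 2 * k) ⊎ Odd x → ∃₂ λ x′ y′ → x ≡ + 2 * x′ × y ≡ + 2 * y′ × Solution x′ y′
          x-cases (inj₂ ox) = ⊥-elim (¬even-and-odd {k = c * (x * y′ + y′ * y′)} halved
            (odd-* odd-e (odd+even (odd-* ox ox) (- (+ 2 * (ν * (y′ * y′))) , refl))))
          x-cases (inj₁ (x′ , ex)) = x′ , y′ , ex , ey , *-cancelˡ {+ 4} (+ 2 * (e * (x′ * x′ - ν * (y′ * y′))))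
              (c * (x′ * y′ + y′ * x′ + y′ * y′)) (λ ())
            (trans (solve 4 (λ e x ν y → # 4 :* (# 2 :* (e :* (x :* x :+ :- (ν :* (y :* y)))))
                := # 2 :* (e :* (# 2 :* x :* (# 2 :* x) :+ :- (ν :* (# 2 :* y :* (# 2 :* y)))))) refl e x′ ν y′)
              (trans (cong₂ (λ x y → + 2 * (e * (x * x - ν * (y * y)))) (sym ex) (sym ey))
                  (trans eq (trans (cong₂ (λ x y → c * (x * y + y * x + y * y)) ex ey)
                (solve 3 (λ c x y → c :* (# 2 :* x :* (# 2 :* y) :+ # 2 :* y :* (# 2 :* x) :+ # 2 :* y :* (# 2 :* y))
                    := # 4 :* (c :* (x :* y :+ y :* x :+ y :* y))) refl c x′ y′)))))

-- ℚ(√p), where ω = √p.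
module RealQuadratic (p : ℕ) (prime-p : Prime p) (p≡3 : Residues.≡ + 3 [8] (+ p)) where
  open import Data.Integer using (_+_; _*_; -_; _-_)
  open import Data.Integer.Divisibility.Signed
  open NaturalValuations using (prime∣prime)
  open IntegerLemmas
  open Residues
  open BinaryForms
  open IntegerRing
  open QuadraticOrder (+ 0) (- + p) hiding (solve; _:+_; _:*_; :-_; con; #_; _:=_)
  open PrimeIdeals (+ 0) (- + p)

  q : ℤ
  q = proj₁ p≡3

  open SumOfSquares {+ p} {q} (proj₂ p≡3) using (odd-p) renaming (only-zero to sum-of-squares)

  -- One ternary equation serves both properties of the norm: with t arbitrary it excludes the
  -- values -t², and with t = 0 it gives anisotropy.
  norm-equation : ∀ m n t → m * m + + 0 * (m * n) + - + p * (n * n) ≡ - (t * t) → m ² + t ² ≡ + p * n ²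
  norm-equation m n t eq = trans (solve 4 (λ m n t p → m :* m :+ t :* t := (m :* m :+ # 0 :* (m :* n) :+ (:- p) :*
      (n :* n)) :+ (p :* (n :* n) :+ t :* t)) refl m n t (+ p))
    (trans (cong (_+ (+ p * (n * n) + t * t)) eq) (solve 3 (λ n t p → :- (t :* t) :+ (p :* (n :* n) :+ t :* t)
        := p :* (n :* n)) refl n t (+ p)))

  not-neg-square : ∀ x t → norm x ≡ - (t * t) → t ≡ + 0
  not-neg-square (m ∔ n ω) t eq = proj₁ (proj₂ (sum-of-squares m t n (norm-equation m n t eq)))

  anisotropic : ∀ x → norm x ≡ + 0 → x ≡ + 0 ∔ + 0 ω
  anisotropic (m ∔ n ω) eq = let m≡0 , _ , n≡0 = sum-of-squares m (+ 0) n (norm-equation m n (+ 0) eq) in cong₂ _∔_ω m≡0 n≡0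

  disc-primes : ∀ {ℓ} → Prime ℓ → + ℓ ∣ disc → ℓ ≡ 2 ⊎ ℓ ≡ p
  disc-primes {ℓ} pr d = [ (λ e → inj₁ (prime∣prime pr prime[2] (∣⇒∣ᵤ (euclid-square pr (+ 2) e))))
                         , (λ e → inj₂ (prime∣prime pr prime-p (∣⇒∣ᵤ e))) ]′
    (euclid pr (+ 4) (+ p) (subst (+ ℓ ∣_) (solve 1 (λ p → # 0 :* # 0 :+ :- (# 4 :* (:- p)) := # 4 :* p) refl (+ p)) d))

  s : Order
  s = + 0 ∔ + 1 ω

  norm-s : norm s ≡ - + p
  norm-s = solve 1 (λ p → # 0 :* # 0 :+ # 0 :* (# 0 :* # 1) :+ (:- p) :* (# 1 :* # 1) := :- p) refl (+ p)

  open GoodModels (+ 0) (- + p) anisotropic using (RationalSquareClass; Equation; equation)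
  open GlobalArgument (+ 0) (- + p) anisotropic not-neg-square p p≡3 disc-primes s (inj₂ norm-s) public
    using (TwoAdicType; intermediate; no-good-models; module AtTwo)

  square-components : ∀ {g c e x y} → ι g ⊗ (c ∔ e ω) ≡ sq (x ∔ y ω) → g * c ≡ x * x + + p * (y * y) × g * e ≡ + 2 * (x * y)
  square-components {g} {c} {e} {x} {y} eq =
      trans (cong re eq′) (solve 3 (λ x y p → x :* x :+ :- ((:- p) :* (y :* y)) := x :* x :+ p :* (y :* y)) refl x y (+ p))
    , trans (cong im eq′) (solve 2 (λ x y → x :* y :+ y :* x :+ # 0 :* (y :* y) := # 2 :* (x :* y)) refl x y)
    where
    eq′ : g * c ∔ g * e ω ≡ sq (x ∔ y ω)
    eq′ = trans (sym (ι⊗ g (c ∔ e ω))) eq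

  vanishing : ∀ {g c x y} → g ≢ + 0 → Odd c → g * c ≡ x * x + + p * (y * y) → ¬ (x ≡ + 0 × y ≡ + 0)
  vanishing {g} {c} g≢ oc eq (refl , refl) = *-≢0 g≢ (odd-≢0 oc) (trans eq (trans (ℤP.+-identityˡ (+ p * + 0)) (ℤP.*-zeroʳ (+ p))))

  -- Eliminating g from the components of g (c + 2e√p) = (x + y√p)² leaves c x y = e (x² + p y²),
  -- which has only the zero solution.
  intermediate-not-square : ∀ c e → Odd c → Odd e → ¬ RationalSquareClass (c ∔ + 2 * e ω)
  intermediate-not-square c e oc oe (g , (x ∔ y ω) , g≢ , eq) = vanishing {g} {c} {x} {y} g≢ oc (proj₁ comps)
    (intermediate-form odd-p oc oe x y (trans (cong (c *_) (sym ge≡))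
        (trans (solve 3 (λ c g e → c :* (g :* e) := e :* (g :* c)) refl c g e) (cong (e *_) (proj₁ comps)))))
    where
    comps = square-components {g} {c} {+ 2 * e} {x} {y} eq
    ge≡ : g * e ≡ x * y
    ge≡ = *-cancelˡ {+ 2} (g * e) (x * y) (λ ()) (trans (solve 2 (λ g e → # 2 :* (g :* e) := g :* (# 2 :* e)) refl g e) (proj₂ comps))

  supersingular-not-square : ∀ c e → Odd c → ¬ RationalSquareClass (s ⊗ (c ∔ + 4 * e ω))
  supersingular-not-square c e oc (g , (x ∔ y ω) , g≢ , eq) = not-both-zero
      (RealSupersingularForm.only-zero {+ p} {q} (proj₂ p≡3) {c} {+ p * e} oc x y
        (trans (solve 4 (λ p e x y → # 8 :* (p :* e :* (x :* y)) := p :* (# 4 :* e) :* (# 2 :* (x :* y))) refl (+ p) e x y)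
          (trans (cong (+ p * (+ 4 * e) *_) (sym (proj₂ comps)))
              (trans (solve 3 (λ u g c → u :* (g :* c) := c :* (g :* u)) refl (+ p * (+ 4 * e)) g c)
              (cong (c *_) (proj₁ comps))))))
    where
    s⊗ : s ⊗ (c ∔ + 4 * e ω) ≡ (+ p * (+ 4 * e) ∔ c ω)
    s⊗ = cong₂ _∔_ω (solve 3 (λ p c e → # 0 :* c :+ :- ((:- p) :* (# 1 :* (# 4 :* e))) := p :* (# 4 :* e)) refl (+ p) c e)
                    (solve 2 (λ c e → # 0 :* (# 4 :* e) :+ # 1 :* c :+ # 0 :* (# 1 :* (# 4 :* e)) := c) refl c e)
    comps = square-components {g} {+ p * (+ 4 * e)} {c} {x} {y} (trans (cong (ι g ⊗_) (sym s⊗)) eq)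
    not-both-zero : ¬ (x ≡ + 0 × y ≡ + 0)
    not-both-zero (x≡0 , y≡0) = *-≢0 g≢ (odd-≢0 oc) (trans (proj₂ comps) (cong (λ x → + 2 * x) (trans (cong (_* y) x≡0) refl)))

  -- Modulo 2, X² - p has the double root 1, and (1 - p)/2 = -1 - 4q is the quotient supplied. The
  -- ideal consists of the m + n√p with m + n even.
  module D₁ = DegreeOne prime[2] (+ 1) (divides (- + 1 - + 4 * q) (trans (cong (λ p → + 1 * + 1 - + 0 * + 1 + - p) (proj₂ p≡3))
    (solve 1 (λ q → # 1 :* # 1 :+ :- (# 0 :* # 1) :+ :- (# 3 :+ # 8 :* q) := (:- # 1 :+ :- (# 4 :* q)) :* # 2) refl q)))
  open PrimeAbove D₁.primeAbove public using (P; isPrimeIdeal; P?; ℓ∈P)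
  open AtTwo D₁.primeAbove (proj₁ (D₁.ramified (divides (+ 1) refl)))

  ∉⇒odd-sum : ∀ {m n} → ¬ P (m ∔ n ω) → Odd (m + n)
  ∉⇒odd-sum {m} {n} ∉ = [ (λ { (k , e)
      → ⊥-elim (∉ (divides k (trans (cong (λ z → m + z) (ℤP.*-identityʳ n)) (trans e (ℤP.*-comm (+ 2) k))))) }) ,
      (λ o → o) ]′ (even-or-odd (m + n))

  -- In a₁² = m² + p n² + 2mn√p the rational part is ≡ 1 + 3 = 4 modulo 8 and mn is odd, so halving
  -- leaves an even and an odd component. Adding 4 a₂ does not disturb this.
  odd-odd-square : ∀ {m n} → Odd m → Odd n → ∀ a2 → ∃₂ λ u v → Odd v × b2 (m ∔ n ω) a2 ≡ ι (+ 2) ⊗ (+ 2 * u ∔ v ω)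
  odd-odd-square {m} {n} om on (c ∔ d ω) = from-squares (odd-² om) (odd-² on)
    where
    from-squares : (∃ λ i → m ² ≡ + 1 + + 8 * i) → (∃ λ j → n ² ≡ + 1 + + 8 * j) →
      ∃₂ λ u v → Odd v × b2 (m ∔ n ω) (c ∔ d ω) ≡ ι (+ 2) ⊗ (+ 2 * u ∔ v ω)
    from-squares (i , ei) (j , ej) = u , v , odd+even (odd-* om on) (d , refl) , trans
      (cong (λ z → (m ∔ n ω) ⊗ (m ∔ n ω) ⊕ z) (ι⊗ (+ 4) (c ∔ d ω)))
      (trans (cong₂ _∔_ω re≡ im≡) (sym (ι⊗ (+ 2) (+ 2 * u ∔ v ω))))
      where
      u = + 1 + + 2 * i + + 2 * q + + 6 * j + + 16 * (q * j) + c
      v = m * n + + 2 * d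
      re≡ : m * m - - + p * (n * n) + + 4 * c ≡ + 2 * (+ 2 * (+ 1 + + 2 * i + + 2 * q + + 6 * j + + 16 * (q * j) + c))
      re≡ = trans (solve 4 (λ m n p c → m :* m :+ :- ((:- p) :* (n :* n)) :+ # 4 :* c := m :* m :+ p :* (n :* n)
          :+ # 4 :* c) refl m n (+ p) c)
        (trans (cong₂ (λ x y → x + y + + 4 * c) ei (cong₂ _*_ (proj₂ p≡3) ej))
          (solve 4 (λ i j q c → # 1 :+ # 8 :* i :+ (# 3 :+ # 8 :* q) :* (# 1 :+ # 8 :* j) :+ # 4 :* c
            := # 2 :* (# 2 :* (# 1 :+ # 2 :* i :+ # 2 :* q :+ # 6 :* j :+ # 16 :* (q :* j) :+ c))) refl i j q c))
      im≡ : m * n + n * m + + 0 * (n * n) + + 4 * d ≡ + 2 * (m * n + + 2 * d)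
      im≡ = solve 3 (λ m n d → m :* n :+ n :* m :+ # 0 :* (n :* n) :+ # 4 :* d := # 2 :* (m :* n :+ # 2 :* d)) refl m n d

  -- With b₂ = 2β one gets c₄ = 4 (β² - 6 b₄). In b₄ = 2 a₄ + a₁ a₃ the coefficient of √p is odd,
  -- because a₁ ≡ 1 + √p modulo 2 and exactly one component of a₃ is odd. Hence C₄ = c + 2e√p with c
  -- and e odd.
  intermediate-at-2 : ∀ E → Odd (re (Equation.a1 E)) → Odd (im (Equation.a1 E)) → ¬ P (Equation.a3 E) → TwoAdicType E
  intermediate-at-2 (equation (m ∔ n ω) a2 (m₃ ∔ n₃ ω) (r ∔ r′ ω) a6) om on a3∉ = from-b2 (odd-odd-square om on a2)
    where
    a1 = m ∔ n ω
    a3 = m₃ ∔ n₃ ω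
    a4 = r ∔ r′ ω
    from-b2 : (∃₂ λ u v → Odd v × b2 a1 a2 ≡ ι (+ 2) ⊗ (+ 2 * u ∔ v ω)) → TwoAdicType (equation a1 a2 a3 a4 a6)
    from-b2 (u , v , ov , b2≡) = intermediate C₄ c₄≡ (λ rsc → intermediate-not-square c e odd-c odd-e
        (subst RationalSquareClass C₄≡ rsc))
      where
      β C₄ : Order
      β = + 2 * u ∔ v ω
      C₄ = sq β ⊖ ι (+ 6) ⊗ b4 a1 a3 a4
      c₄≡ : c4 a1 a2 a3 a4 a6 ≡ ι (+ 4) ⊗ C₄
      c₄≡ = trans (cong (λ z → c4ᵇ z (b4 a1 a3 a4)) b2≡) (rescale β (b4 a1 a3 a4))
        where
        rescale : ∀ β b → c4ᵇ (ι (+ 2) ⊗ β) b ≡ ι (+ 4) ⊗ (sq β ⊖ ι (+ 6) ⊗ b)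
        rescale = O.solve 2 (λ β b → O.Poly.c4ᵇ (O.# 2 O.:* β) b O.:= O.# 4 O.:* (β O.:* β O.:+ O.:- (O.# 6 O.:* b))) refl
          where module O = QuadraticOrder (+ 0) (- + p)
      w e c : ℤ
      w = + 2 * r′ + (m * n₃ + n * m₃)
      c = + p * (v * v) + + 2 * (+ 2 * (u * u) - + 3 * re (b4 a1 a3 a4))
      e = - (+ 3 * w) + + 2 * (u * v)
      im-b4 : im (b4 a1 a3 a4) ≡ w
      im-b4 = solve 6 (λ m n m₃ n₃ r r′ → # 2 :* r′ :+ # 0 :* r :+ # 0 :* (# 0 :* r′) :+ (m :* n₃ :+ n :* m₃ :+ # 0 :* (n :* n₃))
        := # 2 :* r′ :+ (m :* n₃ :+ n :* m₃)) refl m n m₃ n₃ r r′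
      odd-w : Odd w
      odd-w = even+odd (r′ , refl) (mixed (even-or-odd m₃) (even-or-odd n₃) (∉⇒odd-sum {m₃} {n₃} a3∉))
        where
        mixed : (∃ λ k → m₃ ≡ + 2 * k) ⊎ Odd m₃ → (∃ λ k → n₃ ≡ + 2 * k) ⊎ Odd n₃ → Odd (m₃ + n₃) → Odd (m * n₃ + n * m₃)
        mixed (inj₁ (k , ek)) (inj₁ (j , ej)) o = ⊥-elim (¬even-and-odd {k = k + j} (trans (cong₂ _+_ ek ej)
            (sym (ℤP.*-distribˡ-+ (+ 2) k j))) o)
        mixed (inj₁ ek) (inj₂ on₃) o = odd+even (odd-* om on₃) (*-even n ek)
        mixed (inj₂ om₃) (inj₁ ej) o = even+odd (*-even m ej) (odd-* on om₃)
        mixed (inj₂ om₃) (inj₂ on₃) o = ⊥-elim (parity-clash (odd-+ om₃ on₃) refl o)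
      odd-c : Odd c
      odd-c = odd+even (odd-* odd-p (odd-* ov ov)) (+ 2 * (u * u) - + 3 * re (b4 a1 a3 a4) , refl)
      odd-e : Odd e
      odd-e = odd+even (odd-neg (odd-* (+ 1 , refl) odd-w)) (u * v , refl)
      C₄≡ : C₄ ≡ (c ∔ + 2 * e ω)
      C₄≡ = trans (expand (b4 a1 a3 a4)) (cong (λ w → c ∔ + 2 * (- (+ 3 * w) + + 2 * (u * v)) ω) im-b4)
        where
        expand : ∀ b → sq β ⊖ ι (+ 6) ⊗ b ≡ (+ p * (v * v) + + 2 * (+ 2 * (u * u) - + 3 * re b) ∔ + 2 *
            (- (+ 3 * im b) + + 2 * (u * v)) ω)
        expand (x ∔ y ω) = trans (cong (λ z → sq β ⊖ z) (ι⊗ (+ 6) (x ∔ y ω))) (cong₂ _∔_ω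
          (solve 4 (λ u v p x → # 2 :* u :* (# 2 :* u) :+ :- ((:- p) :* (v :* v)) :+ :- (# 6 :* x) := p :* (v :* v)
              :+ # 2 :* (# 2 :* (u :* u) :+ :- (# 3 :* x))) refl u v (+ p) x)
          (solve 3 (λ u v y → # 2 :* u :* v :+ v :* (# 2 :* u) :+ # 0 :* (v :* v) :+ :- (# 6 :* y)
              := # 2 :* (:- (# 3 :* y) :+ # 2 :* (u :* v))) refl u v y))

  classify : ∀ E → ¬ P (Equation.D E) → TwoAdicType E
  classify E D∉ = by-a1 (P? (Equation.a1 E))
    where
    open Equation E
    by-a1 : Dec (P a1) → TwoAdicType E
    by-a1 (no a1∉) = ordinary-at-2 E a1∉ D∉
    by-a1 (yes a1∈) = by-parity (even-or-odd (re a1)) (even-or-odd (im a1)) even-sum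
      where
      even-sum : ∃ λ k → re a1 + im a1 ≡ + 2 * k
      even-sum = quotient a1∈ , trans (sym (cong (λ z → re a1 + z) (ℤP.*-identityʳ (im a1)))) (trans (_∣_.equality a1∈)
          (ℤP.*-comm (quotient a1∈) (+ 2)))
        where open _∣_ using (quotient)
      by-parity : (∃ λ k → re a1 ≡ + 2 * k) ⊎ Odd (re a1) → (∃ λ k → im a1 ≡ + 2 * k) ⊎ Odd (im a1)
          → (∃ λ k → re a1 + im a1 ≡ + 2 * k) → TwoAdicType E
      by-parity (inj₁ (i , ei)) (inj₁ (j , ej)) _ = supersingular-at-2 supersingular-not-square E (i ∔ j ω)
        (trans (split a1) (trans (cong₂ _∔_ω ei ej) (sym (ι⊗ (+ 2) (i ∔ j ω))))) D∉
        where
        split : ∀ x → x ≡ re x ∔ im x ω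
        split (_ ∔ _ ω) = refl
      by-parity (inj₁ ei) (inj₂ oj) sum-even = ⊥-elim (parity-clash sum-even refl (even+odd ei oj))
      by-parity (inj₂ oi) (inj₁ ej) sum-even = ⊥-elim (parity-clash sum-even refl (odd+even oi ej))
      by-parity (inj₂ oi) (inj₂ oj) _ = intermediate-at-2 E oi oj (a3∉ E a1∈ D∉)

  2∈P : ∃ λ x → P x × x ≢ 𝟘
  2∈P = ι (+ 2) , ℓ∈P , λ ()

-- ℚ(√−p), where ω = (1 + √−p)/2.
module ImaginaryQuadratic (p : ℕ) (prime-p : Prime p) (p≡3 : Residues.≡ + 3 [8] (+ p)) where
  open import Data.Integer using (_+_; _*_; -_; _-_)
  open import Data.Integer.Divisibility.Signed
  open NaturalValuations using (prime∣prime)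
  open IntegerLemmas
  open Residues
  open BinaryForms
  open IntegerRing

  q : ℤ
  q = proj₁ p≡3

  ν : ℤ
  ν = + 1 + + 2 * q

  4ν-1≡p : + 4 * ν - + 1 ≡ + p
  4ν-1≡p = trans (solve 1 (λ q → # 4 :* (# 1 :+ # 2 :* q) :+ :- # 1 := # 3 :+ # 8 :* q) refl q) (sym (proj₂ p≡3))

  open QuadraticOrder (+ 1) ν hiding (solve; _:+_; _:*_; :-_; con; #_; _:=_)
  open PrimeIdeals (+ 1) ν

  p≢0 : p ≢ 0
  p≢0 e = ℕ.≢-nonZero⁻¹ p {{prime⇒nonZero prime-p}} e

  sum-of-squares : ∀ u n v → u * u + + p * (n * n) + v * v ≡ + 0 → u ≡ + 0 × n ≡ + 0 × v ≡ + 0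
  sum-of-squares u n v eq = root u (ℕP.m+n≡0⇒m≡0 _ un≡0) , n≡0 (ℕP.m*n≡0⇒m≡0∨n≡0 p (ℕP.m+n≡0⇒n≡0 (∣ u ∣ ℕ.* ∣ u ∣)
      un≡0)) , root v (ℕP.m+n≡0⇒n≡0 _ abs-eq)
    where
    abs-eq : ∣ u ∣ ℕ.* ∣ u ∣ ℕ.+ p ℕ.* (∣ n ∣ ℕ.* ∣ n ∣) ℕ.+ ∣ v ∣ ℕ.* ∣ v ∣ ≡ 0
    abs-eq = ℤP.+-injective (trans
        (sym (cong₂ _+_ (cong₂ _+_ (square-abs u) (trans (cong (+ p *_) (square-abs n)) (sym (ℤP.pos-* p _))))
        (square-abs v))) eq)
    un≡0 : ∣ u ∣ ℕ.* ∣ u ∣ ℕ.+ p ℕ.* (∣ n ∣ ℕ.* ∣ n ∣) ≡ 0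
    un≡0 = ℕP.m+n≡0⇒m≡0 _ abs-eq
    root : ∀ z → ∣ z ∣ ℕ.* ∣ z ∣ ≡ 0 → z ≡ + 0
    root z e = ℤP.∣i∣≡0⇒i≡0 ([ (λ x → x) , (λ x → x) ]′ (ℕP.m*n≡0⇒m≡0∨n≡0 ∣ z ∣ e))
    n≡0 : p ≡ 0 ⊎ ∣ n ∣ ℕ.* ∣ n ∣ ≡ 0 → n ≡ + 0
    n≡0 (inj₁ e) = ⊥-elim (p≢0 e)
    n≡0 (inj₂ e) = root n e

  -- Completing the square gives 4 N(m + nω) = (2m + n)² + p n², so that definiteness can be used
  -- over ℤ.
  norm-equation : ∀ m n t → m * m + + 1 * (m * n) + ν * (n * n) ≡ - (t * t) → (+ 2 * m + n) * (+ 2 * m + n) + + p *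
      (n * n) + + 2 * t * (+ 2 * t) ≡ + 0
  norm-equation m n t eq = trans (cong (λ z → (+ 2 * m + n) * (+ 2 * m + n) + z * (n * n) + + 2 * t * (+ 2 * t)) (sym 4ν-1≡p))
    (trans (solve 4 (λ m n ν t → (# 2 :* m :+ n) :* (# 2 :* m :+ n) :+ (# 4 :* ν :+ :- # 1) :* (n :* n) :+ # 2 :* t :* (# 2 :* t)
        := # 4 :* (m :* m :+ # 1 :* (m :* n) :+ ν :* (n :* n)) :+ # 4 :* (t :* t)) refl m n ν t)
      (trans (cong (λ z → + 4 * z + + 4 * (t * t)) eq) (solve 1 (λ t → # 4 :* (:- (t :* t)) :+ # 4 :* (t :* t) := # 0) refl t)))

  not-neg-square : ∀ x t → norm x ≡ - (t * t) → t ≡ + 0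
  not-neg-square (m ∔ n ω) t eq = *-cancelˡ {+ 2} t (+ 0) (λ ())
      (proj₂ (proj₂ (sum-of-squares (+ 2 * m + n) n (+ 2 * t) (norm-equation m n t eq))))

  anisotropic : ∀ x → norm x ≡ + 0 → x ≡ + 0 ∔ + 0 ω
  anisotropic (m ∔ n ω) eq = vanish (sum-of-squares (+ 2 * m + n) n (+ 2 * + 0) (norm-equation m n (+ 0) eq))
    where
    vanish : + 2 * m + n ≡ + 0 × n ≡ + 0 × + 2 * + 0 ≡ + 0 → m ∔ n ω ≡ + 0 ∔ + 0 ω
    vanish (e , n≡0 , _) = cong₂ _∔_ω (*-cancelˡ {+ 2} m (+ 0) (λ ())
      (trans (sym (trans (cong (λ z → + 2 * m + z) n≡0) (ℤP.+-identityʳ (+ 2 * m)))) e)) n≡0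

  disc-primes : ∀ {ℓ} → Prime ℓ → + ℓ ∣ disc → ℓ ≡ 2 ⊎ ℓ ≡ p
  disc-primes {ℓ} pr d = inj₂ (prime∣prime pr prime-p (∣⇒∣ᵤ {+ ℓ} {+ p} (subst (+ ℓ ∣_)
    (trans (solve 1 (λ ν → :- (# 1 :* # 1 :+ :- (# 4 :* ν)) := # 4 :* ν :+ :- # 1) refl ν) 4ν-1≡p) (∣m⇒∣-m d))))

  s : Order
  s = - + 1 ∔ + 2 ω

  norm-s : norm s ≡ + p
  norm-s = trans (solve 1 (λ ν → :- # 1 :* :- # 1 :+ # 1 :* (:- # 1 :* # 2) :+ ν :* (# 2 :* # 2) := # 4 :* ν :+ :- # 1) refl ν) 4ν-1≡p

  open GoodModels (+ 1) ν anisotropic using (RationalSquareClass; Equation)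
  open GlobalArgument (+ 1) ν anisotropic not-neg-square p p≡3 disc-primes s (inj₁ norm-s) public
    using (TwoAdicType; no-good-models; module AtTwo)

  supersingular-not-square : ∀ c e → Odd c → ¬ RationalSquareClass (s ⊗ (c ∔ + 4 * e ω))
  supersingular-not-square c e oc (g , (x ∔ y ω) , g≢ , eq) = not-both-zero
      (ImaginarySupersingularForm.only-zero {ν} {c′} {e′} odd-c′ odd-e′ x y
        (trans (cong (λ z → + 2 * (e′ * z)) (sym (cong re eq′)))
            (trans (solve 3 (λ g c e → # 2 :* (e :* (g :* c)) := c :* (g :* (# 2 :* e))) refl g c′ e′)
          (cong (c′ *_) (trans (cong im eq′) (cong (λ z → x * y + y * x + z) (ℤP.*-identityˡ (y * y))))))))
    where
    c′ e′ : ℤ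
    -- Since √-p = -1 + 2ω, the product of √-p and c + 4eω has components -c - 8νe and 2 (c + 2e);
    -- both c′ and e′ are odd with c.
    c′ = - c + + 2 * (- (+ 4 * (ν * e)))
    e′ = c + + 2 * e
    s⊗ : s ⊗ (c ∔ + 4 * e ω) ≡ (c′ ∔ + 2 * e′ ω)
    s⊗ = cong₂ _∔_ω (solve 3 (λ ν c e → :- # 1 :* c :+ :- (ν :* (# 2 :* (# 4 :* e))) := :- c :+ # 2 :*
        (:- (# 4 :* (ν :* e)))) refl ν c e)
                    (solve 2 (λ c e → :- # 1 :* (# 4 :* e) :+ # 2 :* c :+ # 1 :* (# 2 :* (# 4 :* e))
                        := # 2 :* (c :+ # 2 :* e)) refl c e)
    eq′ : g * c′ ∔ g * (+ 2 * e′) ω ≡ sq (x ∔ y ω)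
    eq′ = trans (sym (ι⊗ g (c′ ∔ + 2 * e′ ω))) (trans (cong (ι g ⊗_) (sym s⊗)) eq)
    odd-c′ : Odd c′
    odd-c′ = odd+even (odd-neg oc) (- (+ 4 * (ν * e)) , refl)
    odd-e′ : Odd e′
    odd-e′ = odd+even oc (e , refl)
    not-both-zero : ¬ (x ≡ + 0 × y ≡ + 0)
    not-both-zero (refl , refl) = *-≢0 g≢ (odd-≢0 odd-c′) (trans (cong re eq′) (trans (ℤP.+-identityˡ (- (ν * + 0)))
        (cong -_ (ℤP.*-zeroʳ ν))))

  -- X² - X + ν takes only odd values, because ν = (p + 1)/4 is odd for p ≡ 3 modulo 8. Hence 2 is
  -- inert.
  noRoot : ∀ ρ → ¬ + 2 ∣ charPoly ρ
  noRoot ρ (divides k e) = ¬even-and-odd {k = k} (trans e (ℤP.*-comm k (+ 2))) (odd-value (even-or-odd ρ))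
    where
    odd-value : (∃ λ k → ρ ≡ + 2 * k) ⊎ Odd ρ → Odd (charPoly ρ)
    odd-value (inj₁ (k , refl)) = + 2 * (k * k) - k + q , solve 2 (λ k q → # 2 :* k :* (# 2 :* k)
        :+ :- (# 1 :* (# 2 :* k)) :+ (# 1 :+ # 2 :* q)
      := # 1 :+ # 2 :* (# 2 :* (k :* k) :+ :- k :+ q)) refl k q
    odd-value (inj₂ (k , refl)) = + 2 * (k * k) + k + q , solve 2 (λ k q → (# 1 :+ # 2 :* k) :* (# 1 :+ # 2 :* k)
        :+ :- (# 1 :* (# 1 :+ # 2 :* k)) :+ (# 1 :+ # 2 :* q)
      := # 1 :+ # 2 :* (# 2 :* (k :* k) :+ k :+ q)) refl k q

  module I₂ = Inert prime[2] noRoot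
  open PrimeAbove I₂.primeAbove public using (P; isPrimeIdeal; P?; ℓ∈P)

  conj∈ : ∀ x → P x → P (conj x)
  conj∈ (m ∔ n ω) (d , e) = ∣m∣n⇒∣m+n d (∣n⇒∣m*n (+ 1) e) , ∣m⇒∣-m e

  open AtTwo I₂.primeAbove conj∈

  classify : ∀ E → ¬ P (Equation.D E) → TwoAdicType E
  classify E D∉ = by-a1 (P? (Equation.a1 E))
    where
    by-a1 : Dec (P (Equation.a1 E)) → TwoAdicType E
    by-a1 (no a1∉) = ordinary-at-2 E a1∉ D∉
    by-a1 (yes a1∈) = supersingular-at-2 supersingular-not-square E (proj₁ half) (proj₂ half) D∉
      where
      half : ∃ λ α → Equation.a1 E ≡ ι (+ 2) ⊗ α
      half = I₂.unramified (Equation.a1 E) a1∈ (conj∈ (Equation.a1 E) a1∈)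

  2∈P : ∃ λ x → P x × x ≢ 𝟘
  2∈P = ι (+ 2) , ℓ∈P , λ ()

-- Integers and denominators in ℚ

module RationalLemmas where
  open import Data.Rational
  open import Data.Rational.Unnormalised as ℚᵘ using (mkℚᵘ; *≡*)
  import Data.Rational.Unnormalised.Properties as ℚᵘP
  open import Data.Rational.Properties

  -- As `_/_` reduces its result by a gcd, the ring laws for `z / 1` are checked on unnormalised
  -- fractions, where they become equations between integers.
  toℚᵘ-integer : ∀ z → toℚᵘ (z / 1) ℚᵘ.≃ mkℚᵘ z 0
  toℚᵘ-integer z = toℚᵘ-fromℚᵘ (mkℚᵘ z 0)

  /1-+ : ∀ m n → (m ℤ.+ n) / 1 ≡ m / 1 + n / 1
  /1-+ m n = toℚᵘ-injective (ℚᵘP.≃-trans (toℚᵘ-integer (m ℤ.+ n)) (ℚᵘP.≃-trans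
    (*≡* (cong (ℤ._* + 1) (sym (cong₂ ℤ._+_ (ℤP.*-identityʳ m) (ℤP.*-identityʳ n)))))
    (ℚᵘP.≃-sym (ℚᵘP.≃-trans (toℚᵘ-homo-+ (m / 1) (n / 1)) (ℚᵘP.+-cong (toℚᵘ-integer m) (toℚᵘ-integer n))))))

  /1-* : ∀ m n → (m ℤ.* n) / 1 ≡ m / 1 * (n / 1)
  /1-* m n = toℚᵘ-injective (ℚᵘP.≃-trans (toℚᵘ-integer (m ℤ.* n))
    (ℚᵘP.≃-sym (ℚᵘP.≃-trans (toℚᵘ-homo-* (m / 1) (n / 1)) (ℚᵘP.*-cong (toℚᵘ-integer m) (toℚᵘ-integer n)))))

  /1-neg : ∀ m → (ℤ.- m) / 1 ≡ - (m / 1)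
  /1-neg m = toℚᵘ-injective (ℚᵘP.≃-trans (toℚᵘ-integer (ℤ.- m))
    (ℚᵘP.≃-sym (ℚᵘP.≃-trans (toℚᵘ-homo‿- (m / 1)) (ℚᵘP.-‿cong (toℚᵘ-integer m)))))

  /1-injective : ∀ {m n} → m / 1 ≡ n / 1 → m ≡ n
  /1-injective {m} {n} eq with ℚᵘP.≃-trans (ℚᵘP.≃-sym (toℚᵘ-integer m)) (ℚᵘP.≃-trans (ℚᵘP.≃-reflexive (cong toℚᵘ eq)) (toℚᵘ-integer n))
  ... | *≡* e = trans (sym (ℤP.*-identityʳ m)) (trans e (ℤP.*-identityʳ n))

  denominator-* : ∀ q → ↧ q / 1 * q ≡ ↥ q / 1
  denominator-* q = toℚᵘ-injective (ℚᵘP.≃-trans (toℚᵘ-homo-* (↧ q / 1) q)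
    (ℚᵘP.≃-trans (ℚᵘP.*-cong (toℚᵘ-integer (↧ q)) (ℚᵘP.≃-refl {toℚᵘ q})) (ℚᵘP.≃-trans (clear q) (ℚᵘP.≃-sym (toℚᵘ-integer (↥ q))))))
    where
    clear : ∀ q → mkℚᵘ (↧ q) 0 ℚᵘ.* toℚᵘ q ℚᵘ.≃ mkℚᵘ (↥ q) 0
    clear q@(mkℚ _ _ _) = *≡* (trans (ℤP.*-identityʳ (↧ q ℤ.* ↥ q)) (trans (ℤP.*-comm (↧ q) (↥ q))
        (cong (λ n → ↥ q ℤ.* + n) (sym (ℕP.*-identityˡ (↧ₙ q))))))

  *-cancelˡ : ∀ {r} x y → r ≢ 0ℚ → r * x ≡ r * y → x ≡ y
  *-cancelˡ {r} x y r≢0 eq = trans (undo x) (trans (cong (1/ r *_) eq) (sym (undo y)))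
    where
    instance
      nz : NonZero r
      nz = ≢-nonZero r≢0
    undo : ∀ z → z ≡ 1/ r * (r * z)
    undo z = trans (sym (*-identityˡ z)) (trans (cong (_* z) (sym (*-inverseˡ r))) (*-assoc (1/ r) r z))

  clear-denominators : ∀ a b → (↧ a ℤ.* ↧ b) / 1 * a ≡ (↥ a ℤ.* ↧ b) / 1
  clear-denominators a b = trans (cong (_* a) (trans (cong (_/ 1) (ℤP.*-comm (↧ a) (↧ b))) (/1-* (↧ b) (↧ a))))
    (trans (*-assoc (↧ b / 1) (↧ a / 1) a) (trans (cong (↧ b / 1 *_) (denominator-* a))
      (trans (sym (/1-* (↧ b) (↥ a))) (cong (_/ 1) (ℤP.*-comm (↧ b) (↥ a))))))

  ↧≢0 : ∀ q → ↧ q ≢ + 0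
  ↧≢0 (mkℚ _ _ _) ()

  ℚ-algebra : ℤAlgebra
  ℚ-algebra = record
    { isCommutativeRing = +-*-isCommutativeRing ; ι = λ z → z / 1
    ; ι-+ = /1-+ ; ι-* = /1-* ; ι-neg = /1-neg ; ι-0 = refl ; ι-1 = refl }

-- Quadratic extensions and integral bases

module QuadraticExtension (R : ℤAlgebra) (d : ℤAlgebra.Carrier R) where
  open ℤAlgebra R
  open Identities R using (solve; _:+_; _:*_; :-_; con; #_; _:=_)

  -- The product is bracketed exactly as in `_*K_`, so the ring laws proved here are those of the
  -- field of the statement.
  extension : ℤAlgebra
  extension = record
    { Carrier = Carrier × Carrier
    ; _⊕_ = add ; _⊗_ = mul ; ⊝_ = neg ; 𝟘 = 𝟘 , 𝟘 ; 𝟙 = 𝟙 , 𝟘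
    ; isCommutativeRing = record
      { isRing = record
        { +-isAbelianGroup = record
          { isGroup = record
            { isMonoid = record
              { isSemigroup = record
                { isMagma = record { isEquivalence = isEquivalence ; ∙-cong = cong₂ add }
                ; assoc = λ { (a , b) (c , e) (f , g) → cong₂ _,_ (+-assoc a c f) (+-assoc b e g) } }
              ; identity = (λ { (a , b) → cong₂ _,_ (+-identityˡ a) (+-identityˡ b) }) ,
                    (λ { (a , b) → cong₂ _,_ (+-identityʳ a) (+-identityʳ b) }) }
            ; inverse = (λ { (a , b) → cong₂ _,_ (-‿inverseˡ a) (-‿inverseˡ b) }) ,
                  (λ { (a , b) → cong₂ _,_ (-‿inverseʳ a) (-‿inverseʳ b) })
            ; ⁻¹-cong = cong neg }
          ; comm = λ { (a , b) (c , e) → cong₂ _,_ (+-comm a c) (+-comm b e) } }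
        ; *-cong = cong₂ mul
        ; *-assoc = λ { (a , b) (c , e) (f , g) → cong₂ _,_
            (solve 7 (λ d a b c e f g → (a :* c :+ d :* b :* e) :* f :+ d :* (a :* e :+ b :* c) :* g := a :*
                (c :* f :+ d :* e :* g) :+ d :* b :* (c :* g :+ e :* f)) refl d a b c e f g)
            (solve 7 (λ d a b c e f g → (a :* c :+ d :* b :* e) :* g :+ (a :* e :+ b :* c) :* f := a :*
                (c :* g :+ e :* f) :+ b :* (c :* f :+ d :* e :* g)) refl d a b c e f g) }
        ; *-identity = (λ { (a , b)
              → cong₂ _,_ (trans (cong₂ _⊕_ (*-identityˡ a) (trans (cong (_⊗ b) (zeroʳ d)) (zeroˡ b))) (+-identityʳ a))
              (trans (cong₂ _⊕_ (*-identityˡ b) (zeroˡ a)) (+-identityʳ b)) })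
                     , (λ { (a , b) → cong₂ _,_ (trans (cong₂ _⊕_ (*-identityʳ a) (zeroʳ (d ⊗ b))) (+-identityʳ a))
                         (trans (cong₂ _⊕_ (zeroʳ a) (*-identityʳ b)) (+-identityˡ b)) })
        ; distrib = (λ { (a , b) (c , e) (f , g) → cong₂ _,_
            (solve 7 (λ d a b c e f g → a :* (c :+ f) :+ d :* b :* (e :+ g)
                := a :* c :+ d :* b :* e :+ (a :* f :+ d :* b :* g)) refl d a b c e f g)
            (solve 6 (λ a b c e f g → a :* (e :+ g) :+ b :* (c :+ f) := a :* e :+ b :* c :+ (a :* g :+ b :* f)) refl a b c e f g) })
                  , (λ { (a , b) (c , e) (f , g) → cong₂ _,_
            (solve 7 (λ d a b c e f g → (c :+ f) :* a :+ d :* (e :+ g)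
                :* b := c :* a :+ d :* e :* b :+ (f :* a :+ d :* g :* b)) refl d a b c e f g)
            (solve 6 (λ a b c e f g → (c :+ f) :* b :+ (e :+ g) :* a := c :* b :+ e :* a :+ (f :* b :+ g :* a)) refl a b c e f g) }) }
      ; *-comm = λ { (a , b) (c , e) → cong₂ _,_
            (solve 5 (λ d a b c e → a :* c :+ d :* b :* e := c :* a :+ d :* e :* b) refl d a b c e)
            (solve 4 (λ a b c e → a :* e :+ b :* c := c :* b :+ e :* a) refl a b c e) } }
    ; ι = λ z → ι z , 𝟘
    ; ι-+ = λ m n → cong₂ _,_ (ι-+ m n) (sym (+-identityʳ 𝟘))
    ; ι-* = λ m n → cong₂ _,_ (trans (ι-* m n) (sym (trans (cong (ι m ⊗ ι n ⊕_) (zeroʳ (d ⊗ 𝟘))) (+-identityʳ _))))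
          (sym (trans (cong₂ _⊕_ (zeroʳ (ι m)) (zeroˡ (ι n))) (+-identityʳ 𝟘)))
    ; ι-neg = λ m → cong₂ _,_ (ι-neg m) (sym (trans (sym (+-identityˡ (⊝ 𝟘))) (-‿inverseʳ 𝟘)))
    ; ι-0 = cong (_, 𝟘) ι-0
    ; ι-1 = cong (_, 𝟘) ι-1
    }
    where
    add mul : Carrier × Carrier → Carrier × Carrier → Carrier × Carrier
    add (a , b) (c , e) = a ⊕ c , b ⊕ e
    mul (a , b) (c , e) = a ⊗ c ⊕ d ⊗ b ⊗ e , a ⊗ e ⊕ b ⊗ c
    neg : Carrier × Carrier → Carrier × Carrier
    neg (a , b) = ⊝ a , ⊝ b

  scalar-mul : ∀ n a b → (n ⊗ a ⊕ d ⊗ 𝟘 ⊗ b , n ⊗ b ⊕ 𝟘 ⊗ a) ≡ (n ⊗ a , n ⊗ b)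
  scalar-mul n a b = cong₂ _,_ (trans (cong (λ z → n ⊗ a ⊕ z ⊗ b) (zeroʳ d)) (trans (cong (n ⊗ a ⊕_) (zeroˡ b)) (+-identityʳ (n ⊗ a))))
    (trans (cong (n ⊗ b ⊕_) (zeroˡ a)) (+-identityʳ (n ⊗ b)))

  -- h and g are the coordinates of ω = h + g√d, later (0, 1) for the real field and (½, ½) for the
  -- imaginary one. The two hypotheses fix the trace and the norm of ω.
  module Basis (τ ν : ℤ) (h g : Carrier) (2h≡τ : h ⊕ h ≡ ι τ) (norm≡ν : h ⊗ h ⊖ d ⊗ g ⊗ g ≡ ι ν) where

    trace-formula : ∀ m n → (m ⊕ n ⊗ h) ⊕ (m ⊕ n ⊗ h) ≡ ι (+ 2) ⊗ m ⊕ ι τ ⊗ n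
    trace-formula m n = trans (solve 3 (λ m n h → (m :+ n :* h) :+ (m :+ n :* h) := # 2 :* m :+ (h :+ h) :* n) refl m n h)
      (cong (λ z → ι (+ 2) ⊗ m ⊕ z ⊗ n) 2h≡τ)

    norm-formula : ∀ m n → (m ⊕ n ⊗ h) ⊗ (m ⊕ n ⊗ h) ⊖ d ⊗ (n ⊗ g) ⊗ (n ⊗ g) ≡ m ⊗ m ⊕ ι τ ⊗ (m ⊗ n) ⊕ ι ν ⊗ (n ⊗ n)
    norm-formula m n = trans (solve 5 (λ m n h g d → (m :+ n :* h) :* (m :+ n :* h) :+ :- (d :* (n :* g) :* (n :* g))
        := m :* m :+ (h :+ h) :* (m :* n) :+ (h :* h :+ :- (d :* g :* g)) :* (n :* n)) refl m n h g d)
      (cong₂ (λ x y → m ⊗ m ⊕ x ⊗ (m ⊗ n) ⊕ y ⊗ (n ⊗ n)) 2h≡τ norm≡ν)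

    embed : ℤ → ℤ → Carrier × Carrier
    embed m n = ι m ⊕ ι n ⊗ h , ι n ⊗ g

    embed-ι : ∀ z → embed z (+ 0) ≡ (ι z , 𝟘)
    embed-ι z = cong₂ _,_ (trans (cong (λ x → ι z ⊕ x ⊗ h) ι-0) (trans (cong (ι z ⊕_) (zeroˡ h)) (+-identityʳ (ι z))))
      (trans (cong (_⊗ g) ι-0) (zeroˡ g))

    embed-+ : ∀ m n m′ n′ → embed (m ℤ.+ m′) (n ℤ.+ n′) ≡ ((ι m ⊕ ι n ⊗ h) ⊕ (ι m′ ⊕ ι n′ ⊗ h) , ι n ⊗ g ⊕ ι n′ ⊗ g)
    embed-+ m n m′ n′ = cong₂ _,_
      (trans (cong₂ (λ x y → x ⊕ y ⊗ h) (ι-+ m m′) (ι-+ n n′))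
        (solve 5 (λ m n m′ n′ h → m :+ m′ :+ (n :+ n′) :* h := (m :+ n :* h) :+ (m′ :+ n′ :* h)) refl (ι m) (ι n) (ι m′) (ι n′) h))
      (trans (cong (_⊗ g) (ι-+ n n′)) (solve 3 (λ n n′ g → (n :+ n′) :* g := n :* g :+ n′ :* g) refl (ι n) (ι n′) g))

    embed-* : ∀ m n m′ n′ → embed (m ℤ.* m′ ℤ.- ν ℤ.* (n ℤ.* n′)) (m ℤ.* n′ ℤ.+ n ℤ.* m′ ℤ.+ τ ℤ.* (n ℤ.* n′))
      ≡ ((ι m ⊕ ι n ⊗ h) ⊗ (ι m′ ⊕ ι n′ ⊗ h) ⊕ d ⊗ (ι n ⊗ g) ⊗ (ι n′ ⊗ g) , (ι m ⊕ ι n ⊗ h) ⊗ (ι n′ ⊗ g) ⊕ ι n ⊗ g ⊗ (ι m′ ⊕ ι n′ ⊗ h))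
    embed-* m n m′ n′ = trans (cong₂ (λ x y → x ⊕ y ⊗ h , y ⊗ g)
        (trans (ι-+ (m ℤ.* m′) (ℤ.- (ν ℤ.* (n ℤ.* n′)))) (cong₂ _⊕_ (ι-* m m′) (trans (ι-neg (ν ℤ.* (n ℤ.* n′)))
            (cong ⊝_ (trans (ι-* ν (n ℤ.* n′)) (cong₂ _⊗_ (sym norm≡ν) (ι-* n n′)))))))
        (trans (ι-+ (m ℤ.* n′ ℤ.+ n ℤ.* m′) (τ ℤ.* (n ℤ.* n′)))
            (cong₂ _⊕_ (trans (ι-+ (m ℤ.* n′) (n ℤ.* m′)) (cong₂ _⊕_ (ι-* m n′) (ι-* n m′)))
          (trans (ι-* τ (n ℤ.* n′)) (cong₂ _⊗_ (sym 2h≡τ) (ι-* n n′))))))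
      (cong₂ _,_
        (solve 7 (λ m n m′ n′ h g d → (m :* m′ :+ :- ((h :* h :+ :- (d :* g :* g)) :* (n :* n′)))
            :+ (m :* n′ :+ n :* m′ :+ (h :+ h) :* (n :* n′)) :* h
           := (m :+ n :* h) :* (m′ :+ n′ :* h) :+ d :* (n :* g) :* (n′ :* g)) refl (ι m) (ι n) (ι m′) (ι n′) h g d)
        (solve 6 (λ m n m′ n′ h g → (m :* n′ :+ n :* m′ :+ (h :+ h) :* (n :* n′)) :* g
           := (m :+ n :* h) :* (n′ :* g) :+ n :* g :* (m′ :+ n′ :* h)) refl (ι m) (ι n) (ι m′) (ι n′) h g))

    embed-trace : ∀ m n → (ι m ⊕ ι n ⊗ h) ⊕ (ι m ⊕ ι n ⊗ h) ≡ ι (+ 2 ℤ.* m ℤ.+ τ ℤ.* n)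
    embed-trace m n = trans (trace-formula (ι m) (ι n)) (sym (trans (ι-+ (+ 2 ℤ.* m) (τ ℤ.* n)) (cong₂ _⊕_ (ι-* (+ 2) m) (ι-* τ n))))

    embed-norm : ∀ m n → (ι m ⊕ ι n ⊗ h) ⊗ (ι m ⊕ ι n ⊗ h) ⊖ d ⊗ (ι n ⊗ g) ⊗ (ι n ⊗ g) ≡ ι (m ℤ.* m ℤ.+ τ ℤ.* (m ℤ.* n)
        ℤ.+ ν ℤ.* (n ℤ.* n))
    embed-norm m n = trans (norm-formula (ι m) (ι n)) (sym (trans (ι-+ (m ℤ.* m ℤ.+ τ ℤ.* (m ℤ.* n)) (ν ℤ.* (n ℤ.* n)))
      (cong₂ _⊕_ (trans (ι-+ (m ℤ.* m) (τ ℤ.* (m ℤ.* n))) (cong₂ _⊕_ (ι-* m m) (trans (ι-* τ (m ℤ.* n)) (cong (ι τ ⊗_) (ι-* m n)))))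
        (trans (ι-* ν (n ℤ.* n)) (cong (ι ν ⊗_) (ι-* n n))))))

  -- For an element a + b√d given by its trace and norm alone, this isolates the coordinate 2b,
  -- whose integrality is the first step towards an integral basis.
  discriminant-formula : ∀ {a b T M} → a ⊕ a ≡ ι T → a ⊗ a ⊖ d ⊗ b ⊗ b ≡ ι M → d ⊗ (b ⊕ b) ⊗ (b ⊕ b) ≡ ι (T ℤ.* T ℤ.- + 4 ℤ.* M)
  discriminant-formula {a} {b} {T} {M} trace≡ norm≡ = trans (solve 3 (λ a b d → d :* (b :+ b) :* (b :+ b)
      := (a :+ a) :* (a :+ a) :+ :- (# 4 :* (a :* a :+ :- (d :* b :* b)))) refl a b d)
    (trans (cong₂ (λ x y → x ⊗ x ⊖ ι (+ 4) ⊗ y) trace≡ norm≡) (sym (trans (ι-+ (T ℤ.* T) (ℤ.- (+ 4 ℤ.* M)))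
      (cong₂ _⊕_ (ι-* T T) (trans (ι-neg (+ 4 ℤ.* M)) (cong ⊝_ (ι-* (+ 4) M)))))))

  integer-norm : ∀ D A B → d ≡ ι D → ι A ⊗ ι A ⊖ d ⊗ ι B ⊗ ι B ≡ ι (A ℤ.* A ℤ.- D ℤ.* B ℤ.* B)
  integer-norm D A B d≡ = sym (trans (ι-+ (A ℤ.* A) (ℤ.- (D ℤ.* B ℤ.* B))) (cong₂ _⊕_ (ι-* A A)
    (trans (ι-neg (D ℤ.* B ℤ.* B)) (cong ⊝_ (trans (ι-* (D ℤ.* B) B) (cong (_⊗ ι B) (trans (ι-* D B) (cong (_⊗ ι B) (sym d≡)))))))))

  clear-square : ∀ {D S U a b} → d ≡ ι D → d ⊗ S ⊗ S ≡ ι U → ι b ⊗ S ≡ ι a → ι (D ℤ.* (a ℤ.* a)) ≡ ι (U ℤ.* (b ℤ.* b))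
  clear-square {D} {S} {U} {a} {b} d≡ square≡ bS≡a = begin
    ι (D ℤ.* (a ℤ.* a))          ≡⟨ trans (ι-* D (a ℤ.* a)) (cong₂ _⊗_ (sym d≡) (ι-* a a)) ⟩
    d ⊗ (ι a ⊗ ι a)              ≡⟨ cong (λ x → d ⊗ (x ⊗ x)) (sym bS≡a) ⟩
    d ⊗ (ι b ⊗ S ⊗ (ι b ⊗ S))    ≡⟨ solve 3 (λ d b S → d :* (b :* S :* (b :* S)) := d :* S :* S :* (b :* b)) refl d (ι b) S ⟩
    d ⊗ S ⊗ S ⊗ (ι b ⊗ ι b)      ≡⟨ cong₂ _⊗_ square≡ (sym (ι-* b b)) ⟩
    ι U ⊗ ι (b ℤ.* b)            ≡⟨ sym (ι-* U (b ℤ.* b)) ⟩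
    ι (U ℤ.* (b ℤ.* b))          ∎
    where open ≡-Reasoning

  sqrt-norm : 𝟘 ⊗ 𝟘 ⊖ d ⊗ 𝟙 ⊗ 𝟙 ≡ ⊝ d
  sqrt-norm = trans (cong₂ _⊖_ (zeroˡ 𝟘) (trans (*-identityʳ (d ⊗ 𝟙)) (*-identityʳ d))) (+-identityˡ (⊝ d))

  half-norm : ∀ {h N} → h ⊕ h ≡ 𝟙 → d ≡ ι (+ 1 ℤ.- + 4 ℤ.* N) → h ⊗ h ⊖ d ⊗ h ⊗ h ≡ ι N
  half-norm {h} {N} 2h≡1 d≡ = trans (cong (λ x → h ⊗ h ⊖ x ⊗ h ⊗ h)
      (trans d≡ (trans (ι-+ (+ 1) (ℤ.- (+ 4 ℤ.* N)))
      (cong (ι (+ 1) ⊕_) (trans (ι-neg (+ 4 ℤ.* N)) (cong ⊝_ (ι-* (+ 4) N)))))))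
    (trans (solve 2 (λ h n → h :* h :+ :- ((# 1 :+ :- (# 4 :* n)) :* h :* h) := (h :+ h) :* (h :+ h) :* n) refl h (ι N))
      (trans (cong (λ x → x ⊗ x ⊗ ι N) 2h≡1) (trans (cong (_⊗ ι N) (*-identityˡ 𝟙)) (*-identityˡ (ι N)))))

  ⊕-cancelʳ : ∀ z x y → x ⊕ z ≡ y ⊕ z → x ≡ y
  ⊕-cancelʳ z x y eq = trans (undo x) (trans (cong (_⊖ z) eq) (sym (undo y)))
    where
    undo : ∀ x → x ≡ x ⊕ z ⊖ z
    undo x = solve 2 (λ x z → x := x :+ z :+ :- z) refl x z

  double : ∀ x → ι (+ 2) ⊗ x ≡ x ⊕ x
  double = solve 1 (λ x → # 2 :* x := x :+ x) refl

  multiple-of-double : ∀ {g G z} n → g ⊕ g ≡ ι G → z ≡ n ℤ.* G → ι z ≡ ι n ⊗ g ⊕ ι n ⊗ g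
  multiple-of-double {g} {G} {z} n 2g≡G z≡ = trans (cong ι z≡) (trans (ι-* n G) (trans (cong (ι n ⊗_) (sym 2g≡G))
    (solve 2 (λ n g → n :* (g :+ g) := n :* g :+ n :* g) refl (ι n) g)))

-- Clearing denominators: from a curve over the field to models over the order

module FieldTransfer
  (K : ℤAlgebra) (τ ν : ℤ)
  (anisotropic : ∀ x → QuadraticOrder.norm τ ν x ≡ + 0 → x ≡ + 0 QuadraticOrders.∔ + 0 ω)
  (η : QuadraticOrders.Order → ℤAlgebra.Carrier K)
  (η-⊕ : ∀ x y → η (ℤAlgebra._⊕_ (QuadraticOrder.ring τ ν) x y) ≡ ℤAlgebra._⊕_ K (η x) (η y))
  (η-⊗ : ∀ x y → η (ℤAlgebra._⊗_ (QuadraticOrder.ring τ ν) x y) ≡ ℤAlgebra._⊗_ K (η x) (η y))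
  (η-ι : ∀ z → η (ℤAlgebra.ι (QuadraticOrder.ring τ ν) z) ≡ ℤAlgebra.ι K z)
  (η-injective : ∀ {x y} → η x ≡ η y → x ≡ y)
  (ι-cancel : ∀ {N x y} → N ≢ + 0 → ℤAlgebra._⊗_ K (ℤAlgebra.ι K N) x ≡ ℤAlgebra._⊗_ K (ℤAlgebra.ι K N) y → x ≡ y)
  (fraction : ∀ x → ∃₂ λ N o → N ≢ + 0 × ℤAlgebra._⊗_ K (ℤAlgebra.ι K N) x ≡ η o)
  where
  open import Data.Integer using (_*_; _-_)
  open IntegerLemmas
  module O = QuadraticOrder τ ν
  open PrimeIdeals τ ν using (IsPrimeIdeal)
  open Valuations τ ν anisotropic using (⊗-cancelˡ; pow12-≢𝟘; norm≢0)
  open GoodModels τ ν anisotropic using (GoodModel; ModelSystem; equation)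
  open QuadraticOrders
  open ℤAlgebra K
  open Identities K

  cong₅ : (f : Carrier → Carrier → Carrier → Carrier → Carrier → Carrier) → ∀ {a a′ b b′ c c′ d d′ e e′} →
    a ≡ a′ → b ≡ b′ → c ≡ c′ → d ≡ d′ → e ≡ e′ → f a b c d e ≡ f a′ b′ c′ d′ e′
  cong₅ f refl refl refl refl refl = refl

  η-neg : ∀ x → η (O.⊝ x) ≡ ⊝ η x
  η-neg x = begin
    η (O.⊝ x)                    ≡⟨ cong η (O.solve 1 (λ x → O.:- x O.:= O.con (ℤ.- + 1) O.:* x) refl x) ⟩
    η (O.ι (ℤ.- + 1) O.⊗ x)      ≡⟨ η-⊗ (O.ι (ℤ.- + 1)) x ⟩
    η (O.ι (ℤ.- + 1)) ⊗ η x      ≡⟨ cong (_⊗ η x) (η-ι (ℤ.- + 1)) ⟩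
    ι (ℤ.- + 1) ⊗ η x            ≡⟨ solve 1 (λ x → con (ℤ.- + 1) :* x := :- x) refl (η x) ⟩
    ⊝ η x                        ∎
    where open ≡-Reasoning

  η-⊖ : ∀ x y → η (x O.⊖ y) ≡ η x ⊖ η y
  η-⊖ x y = trans (η-⊕ x (O.⊝ y)) (cong (η x ⊕_) (η-neg y))

  η-sq : ∀ x → η (O.sq x) ≡ sq (η x)
  η-sq x = η-⊗ x x

  η-pow12 : ∀ x → η (O.pow12 x) ≡ pow12 (η x)
  η-pow12 x = trans (η-sq (O.pow6 x))
      (cong sq (trans (η-⊗ (O.sq x) (O.pow4 x)) (cong₂ _⊗_ (η-sq x) (trans (η-sq (O.sq x)) (cong sq (η-sq x))))))

  η-scalar : ∀ z x → η (O.ι z O.⊗ x) ≡ ι z ⊗ η x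
  η-scalar z x = trans (η-⊗ (O.ι z) x) (cong (_⊗ η x) (η-ι z))

  η-b2 : ∀ a1 a2 → η (O.b2 a1 a2) ≡ b2 (η a1) (η a2)
  η-b2 a1 a2 = trans (η-⊕ _ _) (cong₂ _⊕_ (η-⊗ a1 a1) (η-scalar (+ 4) a2))

  η-b4 : ∀ a1 a3 a4 → η (O.b4 a1 a3 a4) ≡ b4 (η a1) (η a3) (η a4)
  η-b4 a1 a3 a4 = trans (η-⊕ _ _) (cong₂ _⊕_ (η-scalar (+ 2) a4) (η-⊗ a1 a3))

  η-b6 : ∀ a3 a6 → η (O.b6 a3 a6) ≡ b6 (η a3) (η a6)
  η-b6 a3 a6 = trans (η-⊕ _ _) (cong₂ _⊕_ (η-⊗ a3 a3) (η-scalar (+ 4) a6))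

  η-⊗⊗ : ∀ x y z → η (x O.⊗ y O.⊗ z) ≡ η x ⊗ η y ⊗ η z
  η-⊗⊗ x y z = trans (η-⊗ (x O.⊗ y) z) (cong (_⊗ η z) (η-⊗ x y))

  η-b8 : ∀ a1 a2 a3 a4 a6 → η (O.b8 a1 a2 a3 a4 a6) ≡ b8 (η a1) (η a2) (η a3) (η a4) (η a6)
  η-b8 a1 a2 a3 a4 a6 = trans (η-⊖ _ _) (cong₂ _⊖_ (trans (η-⊕ _ _) (cong₂ _⊕_ (trans (η-⊖ _ _) (cong₂ _⊖_ (trans (η-⊕ _ _) (cong₂ _⊕_
    (η-⊗⊗ a1 a1 a6) (trans (η-scalar (+ 4) (a2 O.⊗ a6)) (cong (ι (+ 4) ⊗_) (η-⊗ a2 a6))))) (η-⊗⊗ a1 a3 a4)))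
        (η-⊗⊗ a2 a3 a3))) (η-⊗ a4 a4))

  η-c4 : ∀ a1 a2 a3 a4 a6 → η (O.c4 a1 a2 a3 a4 a6) ≡ c4 (η a1) (η a2) (η a3) (η a4) (η a6)
  η-c4 a1 a2 a3 a4 a6 = trans (η-⊖ _ _) (cong₂ _⊖_ (trans (η-sq (O.b2 a1 a2)) (cong sq (η-b2 a1 a2)))
    (trans (η-scalar (+ 24) (O.b4 a1 a3 a4)) (cong (ι (+ 24) ⊗_) (η-b4 a1 a3 a4))))

  η-Δᵇ : ∀ b2 b4 b6 b8 → η (O.Δᵇ b2 b4 b6 b8) ≡ Δᵇ (η b2) (η b4) (η b6) (η b8)
  η-Δᵇ b2 b4 b6 b8 = trans (η-⊕ _ _) (cong₂ _⊕_ (trans (η-⊖ _ _) (cong₂ _⊖_ (trans (η-⊖ _ _) (cong₂ _⊖_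
    (trans (η-neg _) (cong ⊝_ (η-⊗⊗ b2 b2 b8)))
    (trans (η-scalar (+ 8) _) (cong (ι (+ 8) ⊗_) (η-⊗⊗ b4 b4 b4)))))
    (trans (η-scalar (+ 27) _) (cong (ι (+ 27) ⊗_) (η-⊗ b6 b6)))))
    (trans (η-scalar (+ 9) _) (cong (ι (+ 9) ⊗_) (η-⊗⊗ b2 b4 b6))))

  η-Δ : ∀ a1 a2 a3 a4 a6 → η (O.Δ a1 a2 a3 a4 a6) ≡ Δ (η a1) (η a2) (η a3) (η a4) (η a6)
  η-Δ a1 a2 a3 a4 a6 = trans (η-Δᵇ (O.b2 a1 a2) (O.b4 a1 a3 a4) (O.b6 a3 a6) (O.b8 a1 a2 a3 a4 a6))
    (cong₄ Δᵇ (η-b2 a1 a2) (η-b4 a1 a3 a4) (η-b6 a3 a6) (η-b8 a1 a2 a3 a4 a6))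

  η-𝟘 : η O.𝟘 ≡ 𝟘
  η-𝟘 = trans (η-ι (+ 0)) ι-0

  ι⊗≡𝟘 : ∀ {N x} → N ≢ + 0 → ι N ⊗ x ≡ 𝟘 → x ≡ 𝟘
  ι⊗≡𝟘 {N} N≢ eq = ι-cancel N≢ (trans eq (sym (zeroʳ (ι N))))

  fraction-≢𝟘 : ∀ {N x o} → N ≢ + 0 → ι N ⊗ x ≡ η o → x ≢ 𝟘 → o ≢ O.𝟘
  fraction-≢𝟘 N≢ eq x≢ o≡ = x≢ (ι⊗≡𝟘 N≢ (trans eq (trans (cong η o≡) η-𝟘)))

  η-pow4 : ∀ x → η (O.pow4 x) ≡ pow4 (η x)
  η-pow4 x = trans (η-sq (O.sq x)) (cong sq (η-sq x))

  η-pow6 : ∀ x → η (O.pow6 x) ≡ pow6 (η x)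
  η-pow6 x = trans (η-⊗ (O.sq x) (O.pow4 x)) (cong₂ _⊗_ (η-sq x) (η-pow4 x))

  η-norm : ∀ x → η x ⊗ η (O.conj x) ≡ ι (O.norm x)
  η-norm x = trans (sym (η-⊗ x (O.conj x))) (trans (cong η (O.x⊗conj x)) (η-ι (O.norm x)))

  record LocalAt (P : Order → Set) (x : Carrier) : Set where
    constructor localAt
    field
      σ b : Order
      σ∉P : ¬ P σ
      σ⊗x≡ : η σ ⊗ x ≡ η b

  record ReductionAt (P : Order → Set) (a1 a2 a3 a4 a6 : Carrier) : Set where
    field
      u r s t a1′ a2′ a3′ a4′ a6′ y : Carrier
      u≢𝟘 : u ≢ 𝟘
      e1 : u ⊗ a1′ ≡ Translation.A1 r s t a1 a2 a3 a4 a6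
      e2 : u ⊗ u ⊗ a2′ ≡ Translation.A2 r s t a1 a2 a3 a4 a6
      e3 : u ⊗ u ⊗ u ⊗ a3′ ≡ Translation.A3 r s t a1 a2 a3 a4 a6
      e4 : u ⊗ u ⊗ u ⊗ u ⊗ a4′ ≡ Translation.A4 r s t a1 a2 a3 a4 a6
      e6 : u ⊗ u ⊗ u ⊗ u ⊗ u ⊗ u ⊗ a6′ ≡ Translation.A6 r s t a1 a2 a3 a4 a6
      l1 : LocalAt P a1′
      l2 : LocalAt P a2′
      l3 : LocalAt P a3′
      l4 : LocalAt P a4′
      l6 : LocalAt P a6′
      ly : LocalAt P y
      unit : Δ a1′ a2′ a3′ a4′ a6′ ⊗ y ≡ 𝟙

  module Curve (a1 a2 a3 a4 a6 : Carrier) (Δ≢𝟘 : Δ a1 a2 a3 a4 a6 ≢ 𝟘) (J₁ J₂ : ℤ)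
    (j-relation : ι J₂ ⊗ (c4 a1 a2 a3 a4 a6 ⊗ c4 a1 a2 a3 a4 a6 ⊗ c4 a1 a2 a3 a4 a6) ≡ ι J₁ ⊗ Δ a1 a2 a3 a4 a6) where

    ΔW : Carrier
    ΔW = Δ a1 a2 a3 a4 a6

    N : ℤ
    N = proj₁ (fraction ΔW)

    δ : Order
    δ = proj₁ (proj₂ (fraction ΔW))

    N≢0 : N ≢ + 0
    N≢0 = proj₁ (proj₂ (proj₂ (fraction ΔW)))

    N⊗Δ≡ : ι N ⊗ ΔW ≡ η δ
    N⊗Δ≡ = proj₂ (proj₂ (proj₂ (fraction ΔW)))

    Δ₀ : Order
    -- As δ represents N times the discriminant of the curve, the product N¹¹ δ represents N¹² times
    -- it: an element of the order that differs from the discriminant by a twelfth power.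
    Δ₀ = O.ι N O.⊗ O.pow4 (O.ι N) O.⊗ O.pow6 (O.ι N) O.⊗ δ

    ηΔ₀ : η Δ₀ ≡ pow12 (ι N) ⊗ ΔW
    ηΔ₀ = trans (η-⊗ (O.ι N O.⊗ O.pow4 (O.ι N) O.⊗ O.pow6 (O.ι N)) δ)
      (trans (cong₂ _⊗_ (trans (η-⊗⊗ (O.ι N) (O.pow4 (O.ι N)) (O.pow6 (O.ι N)))
          (cong₂ _⊗_ (cong₂ _⊗_ (η-ι N) (trans (η-pow4 (O.ι N)) (cong pow4 (η-ι N)))) (trans (η-pow6 (O.ι N))
              (cong pow6 (η-ι N))))) (sym N⊗Δ≡))
        (solve 2 (λ n d → n :* pow4′ n :* pow6′ n :* (n :* d) := pow12′ n :* d) refl (ι N) ΔW))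

    Δ₀≢𝟘 : Δ₀ ≢ O.𝟘
    Δ₀≢𝟘 e = Δ≢𝟘 (ι⊗≡𝟘 {(N ²) ⁶} (⁶-≢0 (²-≢0 N≢0)) (trans (cong (_⊗ ΔW) pow) (trans (sym ηΔ₀) (trans (cong η e) η-𝟘))))
      where
      pow : ι ((N ²) ⁶) ≡ pow12 (ι N)
      pow = trans (ι-* ((N ²) ²) ((N ²) ⁴)) (trans (cong₂ _⊗_ (ι-4 N) (trans (ι-* ((N ²) ²) ((N ²) ²)) (cong sq (ι-4 N))))
        (solve 1 (λ n → sq′ (n :* n) :* sq′ (sq′ (n :* n)) := pow12′ n) refl (ι N)))
        where
        ι-4 : ∀ n → ι ((n ²) ²) ≡ sq (ι n ⊗ ι n)
        ι-4 n = trans (ι-* (n ²) (n ²)) (cong sq (ι-* n n))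

    module Reduction {P : Order → Set} (isP : IsPrimeIdeal P) (reduction : ReductionAt P a1 a2 a3 a4 a6) where
      open ReductionAt reduction
      open LocalAt
      open IsPrimeIdeal isP
      open Translation r s t a1 a2 a3 a4 a6 using (module ChangeOfVariables)
      open ChangeOfVariables {u} {a1′} {a2′} {a3′} {a4′} {a6′} e1 e2 e3 e4 e6 using (c4-change; 1728Δ-change)

      c4′ Δ′ : Carrier
      c4′ = c4 a1′ a2′ a3′ a4′ a6′
      Δ′ = Δ a1′ a2′ a3′ a4′ a6′

      ΔW≡ : ΔW ≡ pow12 u ⊗ Δ′
      -- The factor 1728 left over from comparing c₄ and c₆ is cancelled here.
      ΔW≡ = sym (ι-cancel {+ 1728} (λ ()) 1728Δ-change)

      S τ₁ τ₂ τ₃ τ₄ τ₆ : Order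
      -- S clears the denominators of all five coefficients and lies outside P. Replacing aᵢ′ by Sⁱ
      -- aᵢ′ is again a change of variables; it multiplies the discriminant by S¹², which is a unit
      -- at P.
      S = σ l1 O.⊗ σ l2 O.⊗ σ l3 O.⊗ σ l4 O.⊗ σ l6
      τ₁ = (σ l2 O.⊗ σ l3 O.⊗ σ l4 O.⊗ σ l6) O.⊗ b l1
      τ₂ = (σ l1 O.⊗ σ l3 O.⊗ σ l4 O.⊗ σ l6) O.⊗ b l2
      τ₃ = (σ l1 O.⊗ σ l2 O.⊗ σ l4 O.⊗ σ l6) O.⊗ b l3
      τ₄ = (σ l1 O.⊗ σ l2 O.⊗ σ l3 O.⊗ σ l6) O.⊗ b l4
      τ₆ = (σ l1 O.⊗ σ l2 O.⊗ σ l3 O.⊗ σ l4) O.⊗ b l6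

      S∉ : ¬ P S
      S∉ = ∉-⊗ (∉-⊗ (∉-⊗ (∉-⊗ (σ∉P l1) (σ∉P l2)) (σ∉P l3)) (σ∉P l4)) (σ∉P l6)

      ηS : Carrier
      ηS = η S

      common : ∀ {x} ρ (l : LocalAt P x) → S ≡ ρ O.⊗ σ l → η (ρ O.⊗ b l) ≡ ηS ⊗ x
      common {x} ρ l e = sym (begin
        ηS ⊗ x                    ≡⟨ cong (λ z → η z ⊗ x) e ⟩
        η (ρ O.⊗ σ l) ⊗ x         ≡⟨ cong (_⊗ x) (η-⊗ ρ (σ l)) ⟩
        η ρ ⊗ η (σ l) ⊗ x         ≡⟨ *-assoc (η ρ) (η (σ l)) x ⟩
        η ρ ⊗ (η (σ l) ⊗ x)       ≡⟨ cong (η ρ ⊗_) (σ⊗x≡ l) ⟩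
        η ρ ⊗ η (b l)             ≡⟨ sym (η-⊗ ρ (b l)) ⟩
        η (ρ O.⊗ b l)             ∎)
        where open ≡-Reasoning

      A₂ A₃ A₄ A₆ : Order
      A₂ = S O.⊗ τ₂
      A₃ = S O.⊗ S O.⊗ τ₃
      A₄ = S O.⊗ S O.⊗ S O.⊗ τ₄
      A₆ = S O.⊗ S O.⊗ S O.⊗ S O.⊗ S O.⊗ τ₆

      ητ₁ : η τ₁ ≡ ηS ⊗ a1′
      ητ₁ = common _ l1 (O.solve 5 (λ a b c d e → a O.:* b O.:* c O.:* d O.:* e O.:= b O.:* c O.:* d O.:* e O.:* a) refl
          (σ l1) (σ l2) (σ l3) (σ l4) (σ l6))

      ηA₂ : η A₂ ≡ ηS ⊗ ηS ⊗ a2′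
      ηA₂ = trans (η-⊗ S τ₂) (trans (cong (ηS ⊗_) (common _ l2
        (O.solve 5 (λ a b c d e → a O.:* b O.:* c O.:* d O.:* e O.:= a O.:* c O.:* d O.:* e O.:* b) refl (σ l1) (σ l2)
            (σ l3) (σ l4) (σ l6))))
        (sym (*-assoc ηS ηS a2′)))

      ηA₃ : η A₃ ≡ ηS ⊗ ηS ⊗ ηS ⊗ a3′
      ηA₃ = trans (η-⊗⊗ S S τ₃) (trans (cong (ηS ⊗ ηS ⊗_) (common _ l3
        (O.solve 5 (λ a b c d e → a O.:* b O.:* c O.:* d O.:* e O.:= a O.:* b O.:* d O.:* e O.:* c) refl (σ l1) (σ l2)
            (σ l3) (σ l4) (σ l6))))
        (sym (*-assoc (ηS ⊗ ηS) ηS a3′)))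

      ηA₄ : η A₄ ≡ ηS ⊗ ηS ⊗ ηS ⊗ ηS ⊗ a4′
      ηA₄ = trans (η-⊗ (S O.⊗ S O.⊗ S) τ₄) (trans (cong₂ _⊗_ (η-⊗⊗ S S S) (common _ l4
        (O.solve 5 (λ a b c d e → a O.:* b O.:* c O.:* d O.:* e O.:= a O.:* b O.:* c O.:* e O.:* d) refl (σ l1) (σ l2)
            (σ l3) (σ l4) (σ l6))))
        (sym (*-assoc (ηS ⊗ ηS ⊗ ηS) ηS a4′)))

      ηA₆ : η A₆ ≡ ηS ⊗ ηS ⊗ ηS ⊗ ηS ⊗ ηS ⊗ ηS ⊗ a6′
      ηA₆ = trans (η-⊗ (S O.⊗ S O.⊗ S O.⊗ S O.⊗ S) τ₆)
          (trans (cong₂ _⊗_ (trans (η-⊗⊗ (S O.⊗ S O.⊗ S) S S) (cong (λ z → z ⊗ ηS ⊗ ηS) (η-⊗⊗ S S S)))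
        (common _ l6 refl)) (sym (*-assoc (ηS ⊗ ηS ⊗ ηS ⊗ ηS ⊗ ηS) ηS a6′)))

      module Sc = Scaling ηS a1′ a2′ a3′ a4′ a6′

      c4″ Δ″ : Order
      c4″ = O.c4 τ₁ A₂ A₃ A₄ A₆
      Δ″ = O.Δ τ₁ A₂ A₃ A₄ A₆

      ηc4″ : η c4″ ≡ pow4 ηS ⊗ c4′
      ηc4″ = trans (η-c4 τ₁ A₂ A₃ A₄ A₆) (trans (cong₅ c4 ητ₁ ηA₂ ηA₃ ηA₄ ηA₆) Sc.c4-scale)

      ηΔ″ : η Δ″ ≡ pow12 ηS ⊗ Δ′
      ηΔ″ = trans (η-Δ τ₁ A₂ A₃ A₄ A₆) (trans (cong₅ Δ ητ₁ ηA₂ ηA₃ ηA₄ ηA₆) Sc.Δ-scale)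

      -- The inverse y of Δ′ is P-integral too, so Δ″ divides S¹² times the denominator of y, and
      -- this product lies outside P.
      Δ″∉ : ¬ P Δ″
      Δ″∉ Δ″∈ = ∉-⊗ (∉-pow12 S∉) (σ∉P ly) (subst P (trans (O.*-comm (b ly) Δ″) (η-injective unit-equation)) (absorb (b ly) Δ″ Δ″∈))
        where
        open ≡-Reasoning
        unit-equation : η (Δ″ O.⊗ b ly) ≡ η (O.pow12 S O.⊗ σ ly)
        unit-equation = begin
          η (Δ″ O.⊗ b ly)                          ≡⟨ η-⊗ Δ″ (b ly) ⟩
          η Δ″ ⊗ η (b ly)                          ≡⟨ cong₂ _⊗_ ηΔ″ (sym (σ⊗x≡ ly)) ⟩
          pow12 ηS ⊗ Δ′ ⊗ (η (σ ly) ⊗ y)           ≡⟨ solve 4 (λ s d z y → s :* d :* (z :* y) := s :* z :* (d :* y))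
              refl (pow12 ηS) Δ′ (η (σ ly)) y ⟩
          pow12 ηS ⊗ η (σ ly) ⊗ (Δ′ ⊗ y)           ≡⟨ cong (pow12 ηS ⊗ η (σ ly) ⊗_) unit ⟩
          pow12 ηS ⊗ η (σ ly) ⊗ 𝟙                  ≡⟨ *-identityʳ (pow12 ηS ⊗ η (σ ly)) ⟩
          pow12 ηS ⊗ η (σ ly)                      ≡⟨ cong (_⊗ η (σ ly)) (sym (η-pow12 S)) ⟩
          η (O.pow12 S) ⊗ η (σ ly)                 ≡⟨ sym (η-⊗ (O.pow12 S) (σ ly)) ⟩
          η (O.pow12 S O.⊗ σ ly)                   ∎

      n : ℤ
      n = proj₁ (fraction u)

      o : Order
      o = proj₁ (proj₂ (fraction u))

      n≢0 : n ≢ + 0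
      n≢0 = proj₁ (proj₂ (proj₂ (fraction u)))

      n⊗u≡ : ι n ⊗ u ≡ η o
      n⊗u≡ = proj₂ (proj₂ (proj₂ (fraction u)))

      o≢𝟘 : o ≢ O.𝟘
      o≢𝟘 = fraction-≢𝟘 n≢0 n⊗u≡ u≢𝟘

      S≢𝟘 : S ≢ O.𝟘
      S≢𝟘 e = S∉ (subst P (sym e) zero∈)

      -- Follows from Δ₀ = N¹² u¹² Δ′, Δ″ = S¹² Δ′ and n u = o. The conjugate of S turns the
      -- denominator S into its norm, the rational integer that `ScaledUnit` asks for.
      scaling : O.pow12 (O.ι (n * O.norm S)) O.⊗ Δ₀ ≡ O.pow12 (O.ι N O.⊗ o O.⊗ O.conj S) O.⊗ Δ″
      scaling = η-injective (begin
        η (O.pow12 (O.ι (n * O.norm S)) O.⊗ Δ₀)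
          ≡⟨ trans (η-⊗ (O.pow12 (O.ι (n * O.norm S))) Δ₀) (cong₂ _⊗_ (η-pow12 (O.ι (n * O.norm S))) ηΔ₀) ⟩
        pow12 (η (O.ι (n * O.norm S))) ⊗ (pow12 (ι N) ⊗ ΔW)
          ≡⟨ cong₂ (λ x z → pow12 x ⊗ (pow12 (ι N) ⊗ z)) (trans (η-ι (n * O.norm S)) (trans (ι-* n (O.norm S))
              (cong (ι n ⊗_) (sym (η-norm S))))) ΔW≡ ⟩
        pow12 (ι n ⊗ (ηS ⊗ ηS̄)) ⊗ (pow12 (ι N) ⊗ (pow12 u ⊗ Δ′))
          ≡⟨ solve 6 (λ n s s̄ m u d → pow12′ (n :* (s :* s̄)) :* (pow12′ m :* (pow12′ u :* d))
              := pow12′ (m :* (n :* u) :* s̄) :* (pow12′ s :* d)) refl (ι n) ηS ηS̄ (ι N) u Δ′ ⟩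
        pow12 (ι N ⊗ (ι n ⊗ u) ⊗ ηS̄) ⊗ (pow12 ηS ⊗ Δ′)
          ≡⟨ cong₂ (λ x z → pow12 x ⊗ z) (sym η-o) (sym ηΔ″) ⟩
        pow12 (η (O.ι N O.⊗ o O.⊗ O.conj S)) ⊗ η Δ″
          ≡⟨ trans (cong (_⊗ η Δ″) (sym (η-pow12 (O.ι N O.⊗ o O.⊗ O.conj S)))) (sym (η-⊗ (O.pow12 (O.ι N O.⊗ o O.⊗ O.conj S)) Δ″)) ⟩
        η (O.pow12 (O.ι N O.⊗ o O.⊗ O.conj S) O.⊗ Δ″) ∎)
        where
        open ≡-Reasoning
        ηS̄ = η (O.conj S)
        η-o : η (O.ι N O.⊗ o O.⊗ O.conj S) ≡ ι N ⊗ (ι n ⊗ u) ⊗ ηS̄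
        η-o = trans (η-⊗⊗ (O.ι N) o (O.conj S)) (cong₂ (λ x z → x ⊗ z ⊗ ηS̄) (η-ι N) (sym n⊗u≡))

      -- Multiplying by o¹² = (n u)¹² brings both sides back to the original equation, where the
      -- relation is known; the factor cancels because o ≠ 0.
      j-relation″ : O.ι J₂ O.⊗ (c4″ O.⊗ c4″ O.⊗ c4″) ≡ O.ι J₁ O.⊗ Δ″
      j-relation″ = ⊗-cancelˡ _ _ (pow12-≢𝟘 o≢𝟘) (η-injective (begin
        η (O.pow12 o O.⊗ (O.ι J₂ O.⊗ (c4″ O.⊗ c4″ O.⊗ c4″)))
          ≡⟨ trans (η-⊗ (O.pow12 o) _)
              (cong₂ _⊗_ η-pow-o (trans (η-scalar J₂ _)
              (cong (ι J₂ ⊗_) (trans (η-⊗⊗ c4″ c4″ c4″) (cong (λ x → x ⊗ x ⊗ x) ηc4″))))) ⟩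
        pow12 (ι n ⊗ u) ⊗ (ι J₂ ⊗ (pow4 ηS ⊗ c4′ ⊗ (pow4 ηS ⊗ c4′) ⊗ (pow4 ηS ⊗ c4′)))
          ≡⟨ solve 5 (λ n u j s c → pow12′ (n :* u) :* (j :* (pow4′ s :* c :* (pow4′ s :* c) :* (pow4′ s :* c)))
               := pow12′ n :* pow12′ s :* (j :* (pow4′ u :* c :* (pow4′ u :* c) :* (pow4′ u :* c)))) refl (ι n) u (ι J₂) ηS c4′ ⟩
        pow12 (ι n) ⊗ pow12 ηS ⊗ (ι J₂ ⊗ (pow4 u ⊗ c4′ ⊗ (pow4 u ⊗ c4′) ⊗ (pow4 u ⊗ c4′)))
          ≡⟨ cong (pow12 (ι n) ⊗ pow12 ηS ⊗_) (trans (cong (λ x → ι J₂ ⊗ (x ⊗ x ⊗ x)) c4-change) j-relation) ⟩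
        pow12 (ι n) ⊗ pow12 ηS ⊗ (ι J₁ ⊗ ΔW)
          ≡⟨ cong (λ z → pow12 (ι n) ⊗ pow12 ηS ⊗ (ι J₁ ⊗ z)) ΔW≡ ⟩
        pow12 (ι n) ⊗ pow12 ηS ⊗ (ι J₁ ⊗ (pow12 u ⊗ Δ′))
          ≡⟨ solve 5 (λ n u j s d → pow12′ n :* pow12′ s :* (j :* (pow12′ u :* d)) := pow12′ (n :* u) :*
              (j :* (pow12′ s :* d))) refl (ι n) u (ι J₁) ηS Δ′ ⟩
        pow12 (ι n ⊗ u) ⊗ (ι J₁ ⊗ (pow12 ηS ⊗ Δ′))
          ≡⟨ sym (trans (η-⊗ (O.pow12 o) _) (cong₂ _⊗_ η-pow-o (trans (η-scalar J₁ Δ″) (cong (ι J₁ ⊗_) ηΔ″)))) ⟩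
        η (O.pow12 o O.⊗ (O.ι J₁ O.⊗ Δ″)) ∎))
        where
        open ≡-Reasoning
        η-pow-o : η (O.pow12 o) ≡ pow12 (ι n ⊗ u)
        η-pow-o = trans (η-pow12 o) (cong pow12 (sym n⊗u≡))

      goodModel : GoodModel Δ₀ J₁ J₂ P
      goodModel = record
        { E = equation τ₁ A₂ A₃ A₄ A₆
        ; scaled = record { n = n * O.norm S ; o = O.ι N O.⊗ o O.⊗ O.conj S ; δ = Δ″ ; n≢0 = *-≢0 n≢0 (norm≢0 S≢𝟘)
              ; scaling = scaling ; δ∉P = Δ″∉ }
        ; δ≡D = refl
        ; j-relation = j-relation″ }

  modelSystem : ∀ a1 a2 a3 a4 a6 → Δ a1 a2 a3 a4 a6 ≢ 𝟘 → ∀ J₁ J₂ →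
    ι J₂ ⊗ (c4 a1 a2 a3 a4 a6 ⊗ c4 a1 a2 a3 a4 a6 ⊗ c4 a1 a2 a3 a4 a6) ≡ ι J₁ ⊗ Δ a1 a2 a3 a4 a6 →
    (∀ {P} → IsPrimeIdeal P → (∃ λ x → P x × x ≢ O.𝟘) → ReductionAt P a1 a2 a3 a4 a6) → ModelSystem J₁ J₂
  modelSystem a1 a2 a3 a4 a6 Δ≢𝟘 J₁ J₂ j-relation reduction = record
    { Δ₀ = Curve.Δ₀ a1 a2 a3 a4 a6 Δ≢𝟘 J₁ J₂ j-relation
    ; Δ₀≢𝟘 = Curve.Δ₀≢𝟘 a1 a2 a3 a4 a6 Δ≢𝟘 J₁ J₂ j-relation
    ; model = λ isP nz → Curve.Reduction.goodModel a1 a2 a3 a4 a6 Δ≢𝟘 J₁ J₂ j-relation isP (reduction isP nz) }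

-- The operations are separate parameters so that, once they are instantiated, the statements
-- below agree with those about the field syntactically rather than up to unfolding.
module RawTransfer
  {A : Set} (_⊕_ _⊗_ _⊟_ : A → A → A) (⊝_ : A → A) (𝟘 𝟙 : A) (ι : ℤ → A) (n· : ℤ → A → A)
  (isCommutativeRing : IsCommutativeRing _≡_ _⊕_ _⊗_ ⊝_ 𝟘 𝟙)
  (ι-+ : ∀ m n → ι (m ℤ.+ n) ≡ ι m ⊕ ι n)
  (ι-* : ∀ m n → ι (m ℤ.* n) ≡ ι m ⊗ ι n)
  (ι-neg : ∀ m → ι (ℤ.- m) ≡ ⊝ ι m)
  (ι-0 : ι (+ 0) ≡ 𝟘) (ι-1 : ι (+ 1) ≡ 𝟙)
  (⊟-def : _⊟_ ≡ λ x y → x ⊕ (⊝ y)) (n·-def : n· ≡ λ z x → ι z ⊗ x)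
  (τ ν : ℤ)
  (anisotropic : ∀ x → QuadraticOrder.norm τ ν x ≡ + 0 → x ≡ + 0 QuadraticOrders.∔ + 0 ω)
  (η : QuadraticOrders.Order → A)
  (η-⊕ : ∀ x y → η (ℤAlgebra._⊕_ (QuadraticOrder.ring τ ν) x y) ≡ η x ⊕ η y)
  (η-⊗ : ∀ x y → η (ℤAlgebra._⊗_ (QuadraticOrder.ring τ ν) x y) ≡ η x ⊗ η y)
  (η-ι : ∀ z → η (ℤAlgebra.ι (QuadraticOrder.ring τ ν) z) ≡ ι z)
  (η-injective : ∀ {x y} → η x ≡ η y → x ≡ y)
  (ι-cancel : ∀ {N x y} → N ≢ + 0 → ι N ⊗ x ≡ ι N ⊗ y → x ≡ y)
  (fraction : ∀ x → ∃₂ λ N o → N ≢ + 0 × ι N ⊗ x ≡ η o)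
  where
  open QuadraticOrders
  open PrimeIdeals τ ν using (IsPrimeIdeal)
  open GoodModels τ ν anisotropic using (ModelSystem)

  field-algebra : ℤAlgebra
  field-algebra = record
    { isCommutativeRing = isCommutativeRing ; ι = ι ; ι-+ = ι-+ ; ι-* = ι-* ; ι-neg = ι-neg ; ι-0 = ι-0 ; ι-1 = ι-1 }

  LocalAt : (Order → Set) → A → Set
  LocalAt = FieldTransfer.LocalAt field-algebra τ ν anisotropic η η-⊕ η-⊗ η-ι η-injective ι-cancel fraction

  c4ᴷ Δᴷ : A → A → A → A → A → A
  c4ᴷ = Identities.c4 field-algebra
  Δᴷ = Identities.Δ field-algebra

  record Coefficients : Set where
    constructor coefficients
    field
      a1 a2 a3 a4 a6 : A

  -- The invariants are values accompanied by their defining equations, so that those of the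
  -- statement can be supplied with `refl`.
  record Invariants (W : Coefficients) : Set where
    open Coefficients W
    field
      B2 B4 B6 B8 C4 D : A
      B2≡ : B2 ≡ (a1 ⊗ a1) ⊕ (n· (+ 4) a2)
      B4≡ : B4 ≡ (n· (+ 2) a4) ⊕ (a1 ⊗ a3)
      B6≡ : B6 ≡ (a3 ⊗ a3) ⊕ (n· (+ 4) a6)
      B8≡ : B8 ≡ (((((a1 ⊗ a1) ⊗ a6) ⊕ (n· (+ 4) (a2 ⊗ a6))) ⊟ ((a1 ⊗ a3) ⊗ a4)) ⊕ ((a2 ⊗ a3) ⊗ a3)) ⊟ (a4 ⊗ a4)
      C4≡ : C4 ≡ (B2 ⊗ B2) ⊟ (n· (+ 24) B4)
      D≡ : D ≡ (((⊝ ((B2 ⊗ B2) ⊗ B8)) ⊟ (n· (+ 8) ((B4 ⊗ B4) ⊗ B4))) ⊟ (n· (+ 27) (B6 ⊗ B6))) ⊕ (n· (+ 9) ((B2 ⊗ B4) ⊗ B6))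

    C4≡c4 : C4 ≡ c4ᴷ a1 a2 a3 a4 a6
    C4≡c4 = trans C4≡ (trans (cong₂ (λ _∸_ m → (B2 ⊗ B2) ∸ (m (+ 24) B4)) ⊟-def n·-def)
        (cong₂ (Identities.c4ᵇ field-algebra) (trans B2≡ (cong (λ m → (a1 ⊗ a1) ⊕ (m (+ 4) a2)) n·-def))
        (trans B4≡ (cong (λ m → (m (+ 2) a4) ⊕ (a1 ⊗ a3)) n·-def))))

    D≡Δ : D ≡ Δᴷ a1 a2 a3 a4 a6
    D≡Δ = trans D≡ (trans (cong₂ (λ _∸_ m → (((⊝ ((B2 ⊗ B2) ⊗ B8)) ∸ (m (+ 8) ((B4 ⊗ B4) ⊗ B4))) ∸ (m (+ 27) (B6 ⊗ B6)))
        ⊕ (m (+ 9) ((B2 ⊗ B4) ⊗ B6))) ⊟-def n·-def)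
      (cong₄ (Identities.Δᵇ field-algebra) (trans B2≡ (cong (λ m → (a1 ⊗ a1) ⊕ (m (+ 4) a2)) n·-def))
          (trans B4≡ (cong (λ m → (m (+ 2) a4) ⊕ (a1 ⊗ a3)) n·-def)) (trans B6≡ (cong (λ m → (a3 ⊗ a3) ⊕ (m (+ 4) a6))
          n·-def)) (trans B8≡ (cong₂ (λ _∸_ m → (((((a1 ⊗ a1) ⊗ a6) ⊕ (m (+ 4) (a2 ⊗ a6))) ∸ ((a1 ⊗ a3) ⊗ a4)) ⊕
          ((a2 ⊗ a3) ⊗ a3)) ∸ (a4 ⊗ a4)) ⊟-def n·-def))))

  record GoodReductionData (P : Order → Set) (W : Coefficients) : Set where
    open Coefficients W
    field
      W′ : Coefficients
    open Coefficients W′ public using () renaming (a1 to a1′; a2 to a2′; a3 to a3′; a4 to a4′; a6 to a6′)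
    field
      u r s t : A
      u≢𝟘 : u ≢ 𝟘
      e1 : u ⊗ a1′ ≡ a1 ⊕ (n· (+ 2) s)
      e2 : (u ⊗ u) ⊗ a2′ ≡ ((a2 ⊟ (s ⊗ a1)) ⊕ (n· (+ 3) r)) ⊟ (s ⊗ s)
      e3 : ((u ⊗ u) ⊗ u) ⊗ a3′ ≡ (a3 ⊕ (r ⊗ a1)) ⊕ (n· (+ 2) t)
      e4 : (((u ⊗ u) ⊗ u) ⊗ u) ⊗ a4′ ≡ ((((a4 ⊟ (s ⊗ a3)) ⊕ (n· (+ 2) (r ⊗ a2))) ⊟ ((t ⊕ (r ⊗ s)) ⊗ a1)) ⊕
          (n· (+ 3) (r ⊗ r))) ⊟ (n· (+ 2) (s ⊗ t))
      e6 : (((((u ⊗ u) ⊗ u) ⊗ u) ⊗ u) ⊗ u) ⊗ a6′ ≡ (((((a6 ⊕ (r ⊗ a4)) ⊕ ((r ⊗ r) ⊗ a2)) ⊕ ((r ⊗ r) ⊗ r)) ⊟ (t ⊗ a3)) ⊟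
          (t ⊗ t)) ⊟ ((r ⊗ t) ⊗ a1)
      l1 : LocalAt P a1′
      l2 : LocalAt P a2′
      l3 : LocalAt P a3′
      l4 : LocalAt P a4′
      l6 : LocalAt P a6′
      I′ : Invariants W′
      y : A
      ly : LocalAt P y
      unit : Invariants.D I′ ⊗ y ≡ 𝟙

  module _ {P : Order → Set} {W : Coefficients} (G : GoodReductionData P W) where
    open Coefficients W
    open GoodReductionData G

    reductionAt : FieldTransfer.ReductionAt field-algebra τ ν anisotropic η η-⊕ η-⊗ η-ι η-injective ι-cancel fraction P a1 a2 a3 a4 a6
    reductionAt = record
      { u = u ; r = r ; s = s ; t = t ; y = y ; u≢𝟘 = u≢𝟘
      ; a1′ = a1′ ; a2′ = a2′ ; a3′ = a3′ ; a4′ = a4′ ; a6′ = a6′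
      ; e1 = trans e1 (cong (λ m → a1 ⊕ (m (+ 2) s)) n·-def)
      ; e2 = trans e2 (cong₂ (λ _∸_ m → ((a2 ∸ (s ⊗ a1)) ⊕ (m (+ 3) r)) ∸ (s ⊗ s)) ⊟-def n·-def)
      ; e3 = trans e3 (cong (λ m → (a3 ⊕ (r ⊗ a1)) ⊕ (m (+ 2) t)) n·-def)
      ; e4 = trans e4 (cong₂ (λ _∸_ m → ((((a4 ∸ (s ⊗ a3)) ⊕ (m (+ 2) (r ⊗ a2))) ∸ ((t ⊕ (r ⊗ s)) ⊗ a1)) ⊕
            (m (+ 3) (r ⊗ r))) ∸ (m (+ 2) (s ⊗ t))) ⊟-def n·-def)
      ; e6 = trans e6 (cong₂ (λ _∸_ m → (((((a6 ⊕ (r ⊗ a4)) ⊕ ((r ⊗ r) ⊗ a2)) ⊕ ((r ⊗ r) ⊗ r)) ∸ (t ⊗ a3)) ∸ (t ⊗ t)) ∸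
            ((r ⊗ t) ⊗ a1)) ⊟-def n·-def)
      ; l1 = l1 ; l2 = l2 ; l3 = l3 ; l4 = l4 ; l6 = l6 ; ly = ly
      ; unit = trans (cong (_⊗ y) (sym (Invariants.D≡Δ I′))) unit }

  modelSystem : (W : Coefficients) (I : Invariants W) → Invariants.D I ≢ 𝟘 → (J₁ J₂ : ℤ) (Q : A) →
    (Invariants.C4 I ⊗ Invariants.C4 I) ⊗ Invariants.C4 I ≡ Q ⊗ Invariants.D I → ι J₂ ⊗ Q ≡ ι J₁ →
    (∀ {P} → IsPrimeIdeal P → (∃ λ x → P x × x ≢ + 0 ∔ + 0 ω) → GoodReductionData P W) → ModelSystem J₁ J₂
  modelSystem W I D≢𝟘 J₁ J₂ Q j≡Q J₂Q≡J₁ good =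
    FieldTransfer.modelSystem field-algebra τ ν anisotropic η η-⊕ η-⊗ η-ι η-injective ι-cancel fraction
      a1 a2 a3 a4 a6 (λ e → D≢𝟘 (trans D≡Δ e)) J₁ J₂ j-relation (λ isP nz → reductionAt (good isP nz))
    where
    open Coefficients W
    open Invariants I
    j-relation : ι J₂ ⊗ ((c4ᴷ a1 a2 a3 a4 a6 ⊗ c4ᴷ a1 a2 a3 a4 a6) ⊗ c4ᴷ a1 a2 a3 a4 a6) ≡ ι J₁ ⊗ Δᴷ a1 a2 a3 a4 a6
    j-relation = trans (cong (λ c → ι J₂ ⊗ ((c ⊗ c) ⊗ c)) (sym C4≡c4)) (trans (cong (ι J₂ ⊗_) j≡Q)
      (trans (sym (ℤAlgebra.*-assoc field-algebra (ι J₂) Q D)) (cong₂ _⊗_ J₂Q≡J₁ D≡Δ)))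

open import Data.Rational as ℚ using (ℚ; 0ℚ; _/_; ↥_; ↧_)

-- The field of the statement and its ring of integers

module QuadraticField (d : ℤ) where
  open RationalLemmas
  open QuadField d

  private
    module Ext = QuadraticExtension ℚ-algebra dℚ

  isCommutativeRing : IsCommutativeRing _≡_ _+K_ _*K_ -K_ 0K 1K
  isCommutativeRing = ℤAlgebra.isCommutativeRing Ext.extension

  fromInt-+ : ∀ m n → fromInt (m ℤ.+ n) ≡ fromInt m +K fromInt n
  fromInt-+ = ℤAlgebra.ι-+ Ext.extension

  fromInt-* : ∀ m n → fromInt (m ℤ.* n) ≡ fromInt m *K fromInt n
  fromInt-* = ℤAlgebra.ι-* Ext.extension

  fromInt-neg : ∀ m → fromInt (ℤ.- m) ≡ -K fromInt m
  fromInt-neg = ℤAlgebra.ι-neg Ext.extension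

  fromInt⊗ : ∀ n a b → fromInt n *K (a , b) ≡ (n / 1 ℚ.* a , n / 1 ℚ.* b)
  fromInt⊗ n = Ext.scalar-mul (n / 1)

  fromInt-cancel : ∀ {N x y} → N ≢ + 0 → fromInt N *K x ≡ fromInt N *K y → x ≡ y
  fromInt-cancel {N} {a , b} {a′ , b′} N≢ eq = cong₂ _,_ (cancel a a′ (cong proj₁ eq′)) (cancel b b′ (cong proj₂ eq′))
    where
    eq′ = trans (sym (fromInt⊗ N a b)) (trans eq (fromInt⊗ N a′ b′))
    cancel : ∀ x y → N / 1 ℚ.* x ≡ N / 1 ℚ.* y → x ≡ y
    cancel x y = *-cancelˡ x y (λ e → N≢ (/1-injective {N} {+ 0} e))

  module Embedding (τ ν : ℤ) (anisotropic : ∀ x → QuadraticOrder.norm τ ν x ≡ + 0 → x ≡ + 0 QuadraticOrders.∔ + 0 ω)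
    (h g : ℚ) (2h≡τ : h ℚ.+ h ≡ τ / 1) (norm≡ν : h ℚ.* h ℚ.- dℚ ℚ.* g ℚ.* g ≡ ν / 1)
    (g≢0 : g ≢ 0ℚ) (G : ℤ) (2g≡G : g ℚ.+ g ≡ G / 1)
    (sqrt-integral : ∀ S u → dℚ ℚ.* S ℚ.* S ≡ u / 1 → ∃ λ z → S ≡ z / 1 × d ℤ.* (z ℤ.* z) ≡ u)
    (lattice : ∀ T z M → T ℤ.* T ℤ.- d ℤ.* (z ℤ.* z) ≡ + 4 ℤ.* M →
       ∃₂ λ m n → T ≡ + 2 ℤ.* m ℤ.+ τ ℤ.* n × z ≡ n ℤ.* G) where

    open import Data.Integer using (_*_; _-_; _+_)
    import Data.Rational.Properties as ℚP
    open QuadraticOrders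
    module O = QuadraticOrder τ ν
    module B = Ext.Basis τ ν h g 2h≡τ norm≡ν
    open IntegerLemmas using (*-≢0)

    η : Order → Quad
    η (m ∔ n ω) = B.embed m n

    η-⊕ : ∀ x y → η (x O.⊕ y) ≡ η x +K η y
    η-⊕ (m ∔ n ω) (m′ ∔ n′ ω) = B.embed-+ m n m′ n′

    η-⊗ : ∀ x y → η (x O.⊗ y) ≡ η x *K η y
    η-⊗ (m ∔ n ω) (m′ ∔ n′ ω) = B.embed-* m n m′ n′

    η-ι : ∀ z → η (O.ι z) ≡ fromInt z
    η-ι = B.embed-ι

    η-injective : ∀ {x y} → η x ≡ η y → x ≡ y
    η-injective {m ∔ n ω} {m′ ∔ n′ ω} eq = cong₂ _∔_ω m≡ n≡
      where
      n≡ : n ≡ n′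
      n≡ = /1-injective (*-cancelˡ (n / 1) (n′ / 1) g≢0 (trans (ℚP.*-comm g (n / 1)) (trans (cong proj₂ eq) (ℚP.*-comm (n′ / 1) g))))
      m≡ : m ≡ m′
      m≡ = /1-injective (Ext.⊕-cancelʳ (n / 1 ℚ.* h) (m / 1) (m′ / 1)
          (trans (cong proj₁ eq) (cong (λ k → m′ / 1 ℚ.+ k / 1 ℚ.* h) (sym n≡))))

    2≢0 : + 2 ≢ + 0
    2≢0 ()

    double-cancel : ∀ x y → x ℚ.+ x ≡ y ℚ.+ y → x ≡ y
    double-cancel x y eq = *-cancelˡ x y (λ e → 2≢0 (/1-injective {+ 2} {+ 0} e))
        (trans (Ext.double x) (trans eq (sym (Ext.double y))))

    η-integral : ∀ o → Integral (η o)
    η-integral (m ∔ n ω) = (+ 2 * m + τ * n , B.embed-trace m n) , (m * m + τ * (m * n) + ν * (n * n) , B.embed-norm m n)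

    -- This identifies the maximal order. Trace T and norm M give d (2b)² = T² - 4M, so
    -- `sqrt-integral` makes 2b an integer z, and T² - d z² = 4M places (T, z) in the lattice of the
    -- order.
    integral⇒ : ∀ x → Integral x → ∃ λ o → x ≡ η o
    integral⇒ (a , b) ((T , trace≡) , (M , norm≡)) = from-sqrt (sqrt-integral (b ℚ.+ b) (T * T - + 4 * M)
        (Ext.discriminant-formula {a} {b} {T} {M} trace≡ norm≡))
      where
      from-sqrt : (∃ λ z → b ℚ.+ b ≡ z / 1 × d * (z * z) ≡ T * T - + 4 * M) → ∃ λ o → (a , b) ≡ η o
      from-sqrt (z , 2b≡z , dz²≡) = from-lattice (lattice T z M (trans (cong (λ w → T * T - w) dz²≡) (cancel (T * T) (+ 4 * M))))
        where
        cancel : ∀ x y → x - (x - y) ≡ y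
        cancel = solve-∀
        from-lattice : (∃₂ λ m n → T ≡ + 2 * m + τ * n × z ≡ n * G) → ∃ λ o → (a , b) ≡ η o
        from-lattice (m , n , T≡ , z≡) = (m ∔ n ω) , cong₂ _,_
          (double-cancel a (m / 1 ℚ.+ n / 1 ℚ.* h) (trans trace≡ (trans (cong (_/ 1) T≡) (sym (B.embed-trace m n)))))
          (double-cancel b (n / 1 ℚ.* g) (trans 2b≡z (Ext.multiple-of-double n 2g≡G z≡)))

    fraction : ∀ x → ∃₂ λ N o → N ≢ + 0 × fromInt N *K x ≡ η o
    fraction (a , b) = ↧ a * ↧ b , proj₁ integral , *-≢0 (↧≢0 a) (↧≢0 b) ,
        trans (fromInt⊗ (↧ a * ↧ b) a b) (trans (cong₂ _,_ (clear-denominators a b)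
          (trans (cong (λ N → N / 1 ℚ.* b) (ℤP.*-comm (↧ a) (↧ b))) (clear-denominators b a))) (proj₂ integral))
      where
      A B′ : ℤ
      A = ↥ a * ↧ b
      B′ = ↥ b * ↧ a
      integral : ∃ λ o → (A / 1 , B′ / 1) ≡ η o
      integral = integral⇒ (A / 1 , B′ / 1) ((A + A , sym (/1-+ A A)) , (A * A - d * B′ * B′ , Ext.integer-norm d A B′ refl))

    module Raw = RawTransfer _+K_ _*K_ _-K_ -K_ 0K 1K fromInt n· isCommutativeRing fromInt-+ fromInt-* fromInt-neg refl refl refl refl
      τ ν anisotropic η η-⊕ η-⊗ η-ι η-injective fromInt-cancel fraction
    open Raw using (LocalAt; Coefficients; coefficients; Invariants; GoodReductionData)
    open PrimeIdeals τ ν using (IsPrimeIdeal)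
    open GoodModels τ ν anisotropic using (ModelSystem)

    -- Good reduction is assumed at primes that are predicates on the field, so a prime of the order
    -- is presented to the hypothesis through its image under `η`.
    Image : (Order → Set) → Quad → Set
    Image P x = ∃ λ o → x ≡ η o × P o

    module _ {P : Order → Set} (isP : IsPrimeIdeal P) where
      open IsPrimeIdeal isP

      image-zero : Image P 0K
      image-zero = O.𝟘 , sym (η-ι (+ 0)) , zero∈

      image-+ : ∀ x y → Image P x → Image P y → Image P (x +K y)
      image-+ x y (a , x≡ , a∈) (b , y≡ , b∈) = a O.⊕ b , trans (cong₂ _+K_ x≡ y≡) (sym (η-⊕ a b)) , +-closed a b a∈ b∈

      image-absorb : ∀ r x → Integral r → Image P x → Image P (r *K x)
      image-absorb r x r-integral (a , x≡ , a∈) = from-order (integral⇒ r r-integral)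
        where
        from-order : (∃ λ ρ → r ≡ η ρ) → Image P (r *K x)
        from-order (ρ , r≡) = ρ O.⊗ a , trans (cong₂ _*K_ r≡ x≡) (sym (η-⊗ ρ a)) , absorb ρ a a∈

      image-proper : ¬ Image P 1K
      image-proper (o , eq , o∈) = proper (subst P (η-injective {o} {O.𝟙} (trans (sym eq) (sym (η-ι (+ 1))))) o∈)

      image-primality : ∀ x y → Integral x → Integral y → Image P (x *K y) → Image P x ⊎ Image P y
      image-primality x y x-integral y-integral (c , xy≡ , c∈) = from-order (integral⇒ x x-integral) (integral⇒ y y-integral)
        where
        from-order : (∃ λ a → x ≡ η a) → (∃ λ b → y ≡ η b) → Image P x ⊎ Image P y
        from-order (a , x≡) (b , y≡) = [ (λ a∈ → inj₁ (a , x≡ , a∈)) , (λ b∈ → inj₂ (b , y≡ , b∈)) ]′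
          (prime a b (subst P (η-injective {c} {a O.⊗ b} (trans (sym xy≡) (trans (cong₂ _*K_ x≡ y≡) (sym (η-⊗ a b))))) c∈))

      image-prime : (∃ λ x → P x × x ≢ O.𝟘) → IsNonzeroPrimeIdeal (Image P)
      image-prime (x₀ , x₀∈ , x₀≢) = record
        { ⊆O = λ { x (o , x≡ , _) → subst Integral (sym x≡) (η-integral o) }
        ; zero∈ = image-zero
        ; +-closed = image-+
        ; absorb = image-absorb
        ; proper = image-proper
        ; prime = image-primality
        ; nonzero = η x₀ , (x₀ , refl , x₀∈) , λ e → x₀≢ (η-injective {x₀} {O.𝟘} (trans e (sym (η-ι (+ 0)))))
        }

    localAt-image : ∀ {P x} → Local (Image P) x → LocalAt P x
    localAt-image {P} {x} (s , s-integral , s∉ , sx-integral) = record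
      { σ = proj₁ s≡ ; b = proj₁ sx≡ ; σ∉P = λ σ∈ → s∉ (proj₁ s≡ , proj₂ s≡ , σ∈)
      ; σ⊗x≡ = trans (cong (_*K x) (sym (proj₂ s≡))) (proj₂ sx≡) }
      where
      s≡ = integral⇒ s s-integral
      sx≡ = integral⇒ (s *K x) sx-integral

    coefficients-of : Weierstrass → Coefficients
    coefficients-of W = coefficients (Weierstrass.a1 W) (Weierstrass.a2 W) (Weierstrass.a3 W) (Weierstrass.a4 W) (Weierstrass.a6 W)

    invariants : ∀ W → Invariants (coefficients-of W)
    invariants W = record { B2 = b2 W ; B4 = b4 W ; B6 = b6 W ; B8 = b8 W ; C4 = c4 W ; D = disc W
                          ; B2≡ = refl ; B4≡ = refl ; B6≡ = refl ; B8≡ = refl ; C4≡ = refl ; D≡ = refl }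

    reduction-data : ∀ {P} E → GoodReductionAt E (Image P) → GoodReductionData P (coefficients-of (EllipticCurve.eqn E))
    reduction-data E (W′ , u , r , s , t , (u≢ , e1 , e2 , e3 , e4 , e6) , l1 , l2 , l3 , l4 , l6 , (_ , y , ly , unit)) = record
      { W′ = coefficients-of W′ ; u = u ; r = r ; s = s ; t = t ; u≢𝟘 = u≢ ; e1 = e1 ; e2 = e2 ; e3 = e3 ; e4 = e4 ; e6 = e6
      ; l1 = localAt-image l1 ; l2 = localAt-image l2 ; l3 = localAt-image l3 ; l4 = localAt-image l4 ; l6 = localAt-image l6
      ; I′ = invariants W′ ; y = y ; ly = localAt-image ly ; unit = unit }

    modelSystem : ∀ E → EverywhereGoodReduction E → (j : jRational E) → ModelSystem (↥ proj₁ j) (↧ proj₁ j)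
    modelSystem E good (q , j≡q) = Raw.modelSystem (coefficients-of (EllipticCurve.eqn E))
        (invariants (EllipticCurve.eqn E)) (EllipticCurve.Δ≢0 E)
        (↥ q) (↧ q) (emb q) j≡q denominator-clears (λ {P} isP nz → reduction-data E (good (Image P) (image-prime isP nz)))
      where
      denominator-clears : fromInt (↧ q) *K emb q ≡ fromInt (↥ q)
      denominator-clears = trans (fromInt⊗ (↧ q) q 0ℚ) (cong₂ _,_ (denominator-* q) (ℚP.*-zeroʳ (↧ q / 1)))

open import Data.Integer using (-_)

-- The radicands p and -p

module PrimeRadicand (p : ℕ) (prime-p : Prime p) (p≡3 : Residues.≡ + 3 [8] (+ p)) where
  open import Data.Integer using (_+_; _*_; _-_)
  open import Data.Integer.Divisibility.Signed
  open import Data.Rational as ℚ using (ℚ; 0ℚ; 1ℚ; ½; _/_; ↥_; ↧_; ↧ₙ_; mkℚ)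
  import Data.Rational.Properties as ℚP
  open NaturalValuations using (prime-divisor; prime∣prime)
  open IntegerLemmas
  open IntegerRing
  open RationalLemmas using (/1-injective; denominator-*; ℚ-algebra; /1-neg)

  numerator-denominator-coprime : ∀ q → Coprimality.Coprime ∣ ↥ q ∣ (↧ₙ q)
  numerator-denominator-coprime (mkℚ n d-1 c) = Coprimality.recompute c

  odd-numerator-or-denominator : ∀ q → Odd (↥ q) ⊎ Odd (↧ q)
  odd-numerator-or-denominator q = cases (even-or-odd (↥ q)) (even-or-odd (↧ q))
    where
    cases : (∃ λ k → ↥ q ≡ + 2 * k) ⊎ Odd (↥ q) → (∃ λ k → ↧ q ≡ + 2 * k) ⊎ Odd (↧ q) → Odd (↥ q) ⊎ Odd (↧ q)
    cases (inj₂ o) _ = inj₁ o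
    cases (inj₁ _) (inj₂ o) = inj₂ o
    cases (inj₁ (i , ei)) (inj₁ (j , ej)) = ⊥-elim (ℕP.1+n≢0 (ℕP.suc-injective
      (numerator-denominator-coprime q (Residues.even-abs {↥ q} {i} ei , Residues.even-abs {↧ q} {j} ej))))

  module _ (d : ℤ) (∣d∣≡p : ∣ d ∣ ≡ p) where

    -- A prime ℓ that divides b, and hence not a, would make ℓ² divide d, which is impossible
    -- because the absolute value of d is prime.
    no-prime-in-denominator : ∀ {a b u} → d * (a * a) ≡ u * (b * b) → Coprimality.Coprime ∣ a ∣ ∣ b ∣ → ∀ {ℓ} → Prime ℓ → ¬ + ℓ ∣ b
    no-prime-in-denominator {a} {b} {u} eq c {ℓ} pr (divides v b≡) = [ in-d , ∤a² ]′ (euclid pr d (a * a) ℓ∣)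
      where
      ∤a² : ¬ + ℓ ∣ a * a
      ∤a² e = Residues.coprime⇒no-common-prime {ℓ} {a} {b} pr c (euclid-square pr a e) (divides v b≡)
      ℓ∣ : + ℓ ∣ d * (a * a)
      ℓ∣ = divides (u * (v * v * + ℓ)) (trans eq (trans (cong (λ x → u * (x * x)) b≡)
        (solve 3 (λ u v l → u :* (v :* l :* (v :* l)) := u :* (v :* v :* l) :* l) refl u v (+ ℓ))))
      in-d : ¬ + ℓ ∣ d
      in-d (divides w d≡) = [ ∤w , ∤a² ]′ (euclid pr w (a * a) (divides (u * (v * v)) (*-cancelˡ {+ ℓ} (w * (a * a))
          (u * (v * v) * + ℓ) ℓ≢0
          (trans (solve 3 (λ l w a → l :* (w :* (a :* a)) := w :* l :* (a :* a)) refl (+ ℓ) w a)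
            (trans (cong (_* (a * a)) (sym d≡)) (trans eq (trans (cong (λ x → u * (x * x)) b≡)
              (solve 3 (λ u v l → u :* (v :* l :* (v :* l)) := l :* (u :* (v :* v) :* l)) refl u v (+ ℓ)))))))))
        where
        instance
          nzℓ : ℕ.NonZero ℓ
          nzℓ = prime⇒nonZero pr
        ℓ≢0 : + ℓ ≢ + 0
        ℓ≢0 e = ℕ.≢-nonZero⁻¹ ℓ (ℤP.+-injective e)
        p≡wℓ : p ≡ ∣ w ∣ ℕ.* ℓ
        p≡wℓ = trans (sym ∣d∣≡p) (trans (cong ∣_∣ d≡) (ℤP.abs-* w (+ ℓ)))
        ℓ≡p : ℓ ≡ p
        ℓ≡p = prime∣prime pr prime-p (ℕD.divides ∣ w ∣ p≡wℓ)
        ∣w∣≡1 : ∣ w ∣ ≡ 1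
        ∣w∣≡1 = ℕP.*-cancelʳ-≡ ∣ w ∣ 1 ℓ (trans (sym p≡wℓ) (trans (sym ℓ≡p) (sym (ℕP.*-identityˡ ℓ))))
        ∤w : ¬ + ℓ ∣ w
        ∤w e = ℕ.nonTrivial⇒≢1 {{prime⇒nonTrivial pr}} (ℕD.∣1⇒≡1 (subst (ℓ ℕD.∣_) ∣w∣≡1 (∣⇒∣ᵤ e)))

    sqrt-integral : ∀ S u → d / 1 ℚ.* S ℚ.* S ≡ u / 1 → ∃ λ z → S ≡ z / 1 × d * (z * z) ≡ u
    sqrt-integral S u eq = ↥ S , S≡ , trans cleared (trans (cong (λ b → u * (b * b)) ↧≡1) (ℤP.*-identityʳ u))
      where
      cleared : d * (↥ S * ↥ S) ≡ u * (↧ S * ↧ S)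
      cleared = /1-injective (QuadraticExtension.clear-square ℚ-algebra (d / 1) {d} {S} {u} {↥ S} {↧ S} refl eq (denominator-* S))
      ↧ₙ≡1 : Relation.Nullary.Dec (↧ₙ S ≡ 1) → ↧ₙ S ≡ 1
      ↧ₙ≡1 (yes e) = e
      ↧ₙ≡1 (no ≢1) = let ℓ , pr , ℓ∣ = prime-divisor (↧ₙ S) {{_}} ≢1 in
        ⊥-elim (no-prime-in-denominator {↥ S} {↧ S} {u} cleared (numerator-denominator-coprime S) pr (∣ᵤ⇒∣ ℓ∣))
      ↧≡1 : ↧ S ≡ + 1
      ↧≡1 = cong +_ (↧ₙ≡1 (↧ₙ S ℕ.≟ 1))
      S≡ : S ≡ ↥ S / 1
      S≡ = trans (sym (ℚP.*-identityˡ S)) (trans (cong (λ n → n / 1 ℚ.* S) (sym ↧≡1)) (denominator-* S))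

  module Real where
    open RealQuadratic p prime-p p≡3

    -- As p ≡ 3 modulo 4, the equation gives T² + z² ≡ 0 modulo 4, so both are even: the integers of
    -- ℚ(√p) are ℤ[√p], and G = 2 is twice the coordinate g = 1.
    lattice : ∀ T z M → T * T - + p * (z * z) ≡ + 4 * M → ∃₂ λ m n → T ≡ + 2 * m + + 0 * n × z ≡ n * + 2
    lattice T z M eq = cases (square-mod-4 T) (square-mod-4 z)
      where
      open BinaryForms.SumOfSquares {+ p} {q} (proj₂ p≡3) using (square-mod-4; even-square)
      clash : ∀ i k → ¬ 4 ℕD.∣ i ℕ.+ k → (∃ λ a → T ² ≡ + i + + 4 * a) → (∃ λ b → z ² ≡ + k + + 4 * b) → ⊥
      clash i k ∤ (a , ea) (b , eb) = no-multiple {4} {i ℕ.+ k} ∤ {a - + k - + 2 * (q * + k) - (+ 3 + + 8 * q) * b - M}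
        (trans (solve 6 (λ i k a b q M → i :+ k :+ # 4 :* (a :+ :- k :+ :- (# 2 :* (q :* k)) :+ :- ((# 3 :+ # 8 :* q) :* b) :+ :- M)
            := (i :+ # 4 :* a :+ :- ((# 3 :+ # 8 :* q) :* (k :+ # 4 :* b))) :+ :- (# 4 :* M)) refl (+ i) (+ k) a b q M)
          (x≡y⇒x-y≡0 (trans (cong₂ (λ x y → x - y) (sym ea) (sym (cong₂ _*_ (proj₂ p≡3) eb))) eq)))
      cases : (∃ λ y → T ≡ + 2 * y) ⊎ (∃ λ k → T ² ≡ + 1 + + 4 * k) → (∃ λ y → z ≡ + 2 * y) ⊎ (∃ λ k → z ² ≡ + 1 + + 4 * k) →
        ∃₂ λ m n → T ≡ + 2 * m + + 0 * n × z ≡ n * + 2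
      cases (inj₁ (m , eT)) (inj₁ (n , ez)) = m , n , trans eT (sym (ℤP.+-identityʳ (+ 2 * m))) , trans ez (ℤP.*-comm (+ 2) n)
      cases (inj₁ eT) (inj₂ oz) = ⊥-elim (clash 0 1 (ℕD.>⇒∤ (ℕ.s≤s (ℕ.s≤s ℕ.z≤n))) (even-square eT) oz)
      cases (inj₂ oT) (inj₁ ez) = ⊥-elim (clash 1 0 (ℕD.>⇒∤ (ℕ.s≤s (ℕ.s≤s ℕ.z≤n))) oT (even-square ez))
      cases (inj₂ oT) (inj₂ oz) = ⊥-elim (clash 1 1 (ℕD.>⇒∤ (ℕ.s≤s (ℕ.s≤s (ℕ.s≤s ℕ.z≤n)))) oT oz)

    modelSystem : (E : QuadField.EllipticCurve (+ p)) → QuadField.EverywhereGoodReduction (+ p) E → (j : QuadField.jRational (+ p) E) →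
      GoodModels.ModelSystem (+ 0) (- + p) anisotropic (↥ proj₁ j) (↧ proj₁ j)
    modelSystem = QuadraticField.Embedding.modelSystem (+ p) (+ 0) (- + p) anisotropic 0ℚ 1ℚ refl
      (trans (QuadraticExtension.sqrt-norm ℚ-algebra (+ p / 1)) (sym (/1-neg (+ p)))) (λ ()) (+ 2) refl
          (sqrt-integral (+ p) refl) lattice

    no-model-system : ∀ j → ¬ GoodModels.ModelSystem (+ 0) (- + p) anisotropic (↥ j) (↧ j)
    no-model-system j M = no-good-models Δ₀ Δ₀≢𝟘 (↥ j) (↧ j) (RationalLemmas.↧≢0 j) (odd-numerator-or-denominator j)
        model isPrimeIdeal 2∈P classify
      where open GoodModels.ModelSystem M

    no-curve : (E : QuadField.EllipticCurve (+ p)) → ¬ (QuadField.EverywhereGoodReduction (+ p) E × QuadField.jRational (+ p) E)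
    no-curve E (good , j) = no-model-system (proj₁ j) (modelSystem E good j)

  module Imaginary where
    open ImaginaryQuadratic p prime-p p≡3

    -- Modulo 2, T² + p z² ≡ (T - z)², so T and z have the same parity. Half-integral coordinates
    -- therefore occur, and G = 1 is twice g = ½.
    lattice : ∀ T z M → T * T - - + p * (z * z) ≡ + 4 * M → ∃₂ λ m n → T ≡ + 2 * m + + 1 * n × z ≡ n * + 1
    lattice T z M eq = [ (λ { (m , e) → m , z , trans (solve 2 (λ T z → T := (T :+ :- z) :+ # 1 :* z) refl T z)
        (cong (λ x → x + + 1 * z) e) , sym (ℤP.*-identityʳ z) })
                       , (λ o → ⊥-elim (Residues.parity-clash (+ 2 * M , ℤP.*-assoc (+ 2) (+ 2) M) (sym eq)
                           (odd-lhs o))) ]′ (even-or-odd (T - z))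
      where
      odd-lhs : Odd (T - z) → Odd (T * T - - + p * (z * z))
      odd-lhs o = subst Odd (sym (trans (cong (λ p → T * T - - p * (z * z)) (proj₂ p≡3))
        (solve 3 (λ T z q → T :* T :+ :- ((:- (# 3 :+ # 8 :* q)) :* (z :* z)) := (T :+ :- z) :* (T :+ :- z) :+ # 2 :*
            (T :* z :+ (# 1 :+ # 4 :* q) :* (z :* z))) refl T z q)))
        (Residues.odd+even (odd-* o o) (T * z + (+ 1 + + 4 * q) * (z * z) , refl))

    -p≡1-4ν : - + p ≡ + 1 - + 4 * ν
    -p≡1-4ν = trans (cong -_ (sym 4ν-1≡p)) (solve 1 (λ n → :- (# 4 :* n :+ :- # 1) := # 1 :+ :- (# 4 :* n)) refl ν)

    modelSystem : (E : QuadField.EllipticCurve (- + p)) → QuadField.EverywhereGoodReduction (- + p) E →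
        (j : QuadField.jRational (- + p) E) →
      GoodModels.ModelSystem (+ 1) ν anisotropic (↥ proj₁ j) (↧ proj₁ j)
    modelSystem = QuadraticField.Embedding.modelSystem (- + p) (+ 1) ν anisotropic ½ ½ refl
      (QuadraticExtension.half-norm ℚ-algebra (- + p / 1) {½} {ν} refl (cong (_/ 1) -p≡1-4ν)) (λ ()) (+ 1) refl
      (sqrt-integral (- + p) (ℤP.∣-i∣≡∣i∣ (+ p))) lattice

    no-model-system : ∀ j → ¬ GoodModels.ModelSystem (+ 1) ν anisotropic (↥ j) (↧ j)
    no-model-system j M = no-good-models Δ₀ Δ₀≢𝟘 (↥ j) (↧ j) (RationalLemmas.↧≢0 j) (odd-numerator-or-denominator j)
        model isPrimeIdeal 2∈P classify
      where open GoodModels.ModelSystem M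

    no-curve : (E : QuadField.EllipticCurve (- + p)) → ¬ (QuadField.EverywhereGoodReduction (- + p) E × QuadField.jRational (- + p) E)
    no-curve E (good , j) = no-model-system (proj₁ j) (modelSystem E good j)

theorem1p7 : (p : ℕ) → Prime p → p % 8 ≡ 3 →
    ((E : QuadField.EllipticCurve (+ p)) →
    ¬ (QuadField.EverywhereGoodReduction (+ p) E × QuadField.jRational (+ p) E))
    × ((E : QuadField.EllipticCurve (- (+ p))) →
    ¬ (QuadField.EverywhereGoodReduction (- (+ p)) E × QuadField.jRational (- (+ p)) E))
theorem1p7 p prime-p p%8≡3 = Real.no-curve , Imaginary.no-curve
  where
  open import Data.Nat.DivMod using (m≡m%n+[m/n]*n) renaming (_/_ to _div_)
  p≡3 : Residues.≡ + 3 [8] (+ p)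
  p≡3 = + (p div 8) , trans (cong +_ (trans (m≡m%n+[m/n]*n p 8) (cong₂ ℕ._+_ p%8≡3 (ℕP.*-comm (p div 8) 8))))
      (cong (λ x → + 3 ℤ.+ x) (ℤP.pos-* 8 (p div 8)))
  open PrimeRadicand p prime-p p≡3
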